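{- Let $V$ have dimension $2$ and let $P$ and $Q$ be $\mathbb{L}$-polygons in $V$. Then $\mathcal{U}_P=\mathcal{U}_Q$ (that is, $|P\cap\mathbb{L}'|=|Q\cap\mathbb{L}'|$ for every rank-$2$ lattice $\mathbb{L}'\supseteq\mathbb{L}$ in $V$) if and only if the following two conditions are satisfied: (i) $\operatorname{Area}(P)=\operatorname{Area}(Q)$; (ii) there exist $\mathbb{L}$-polygons $X$ and $Y$, each allowed to degenerate to a segment or a single point (i.e. each is the convex hull of a nonempty finite subset of $\mathbb{L}$), such that $P$ is a lattice translate of $X+Y$ and $Q$ is a lattice translate of $X-Y$.
   Context: $V$ is a real vector space of dimension $2$ and $\mathbb{L}\subset V$ is a lattice of rank $2$ (the $\mathbb{Z}$-span of a basis of $V$). An $\mathbb{L}$-polytope is the convex hull of a nonempty finite set of points of $\mathbb{L}$; an $\mathbb{L}$-polygon is a two-dimensional $\mathbb{L}$-polytope in $V$, except that for $X$ and $Y$ in (ii) segments and single points are also allowed. For a finite set $A$, $|A|$ is its cardinality. The universal counting function of an $\mathbb{L}$-polytope $P$ is the function $\mathcal{U}_P$ assigning to each rank-$2$ lattice $\mathbb{L}'\supseteq\mathbb{L}$ in $V$ the number $\mathcal{U}_P(\mathbb{L}')=|P\cap\mathbb{L}'|$. $X+Y=\{x+y: x\in X, y\in Y\}$ and $X-Y=\{x-y:x\in X,y\in Y\}$ (Minkowski sum of $X$ with $Y$, respectively with $-Y$). A lattice translate of a set $S$ is a set $S+v$ with $v\in\mathbb{L}$. $\operatorname{Area}$ is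 any fixed Lebesgue measure on $V$ (for instance normalized so that a fundamental parallelogram of $\mathbb{L}$ has area $1$). -}

module Defs where

open import Algebra.Apartness.Bundles using (HeytingField)
open import Algebra.Bundles using (CommutativeRing)
open import Algebra.Module.Bundles using (Module)
import Algebra.Definitions.RawMonoid as RawMonoidDefs
open import Data.Fin.Base using (Fin; zero; suc)
open import Data.Fin.Patterns using (0F; 1F)
open import Data.Integer.Base using (ℤ; +_; -[1+_])
open import Data.Nat.Base as ℕ using (ℕ; suc)
open import Data.Product.Base using (Σ; Σ-syntax; ∃-syntax; _×_; proj₁)
open import Data.Sum.Base using (_⊎_)
open import Data.Vec.Functional using (Vector)
open import Function.Base using (_∘_)
open import Function.Bundles using (Inverse; _⇔_)
open import Level using (Level; _⊔_) renaming (suc to lsuc)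
open import Relation.Binary.Bundles using (Setoid)
open import Relation.Binary.Core using (Rel)
open import Relation.Binary.Structures using (IsStrictPartialOrder)
import Relation.Binary.Construct.On as On
import Relation.Binary.PropositionalEquality.Properties as ≡
open import Relation.Nullary.Negation using (¬_)
open import Relation.Unary using (Pred; _∈_; _∩_; _⊆_; _≐_)

-- The real numbers, axiomatised as a Cauchy-complete Archimedean ordered field.
-- Classically this determines ℝ up to isomorphism. No decidability of the order
-- is assumed, so constructively defined reals also satisfy the axioms.
-- Cotransitivity, tightness, invertibility and 1# # 0# come from the Heyting
-- field structure.
record RealField (c ℓ₁ ℓ₂ : Level) : Set (lsuc (c ⊔ ℓ₁ ⊔ ℓ₂)) where
  infix 4 _<_ _≤_
  field
    heytingField : HeytingField c ℓ₁ ℓ₂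

  open HeytingField heytingField public

  commutativeRing : CommutativeRing c ℓ₁
  commutativeRing = record { isCommutativeRing = isCommutativeRing }

  open CommutativeRing commutativeRing public
    using (+-rawMonoid)
  open RawMonoidDefs +-rawMonoid public
    using (sum) renaming (_×_ to _·_)

  field
    _<_                  : Rel Carrier ℓ₂
    isStrictPartialOrder : IsStrictPartialOrder _≈_ _<_
    #⇔<⊎>                : ∀ {x y} → x # y ⇔ (x < y ⊎ y < x)
    +-monoˡ-<            : ∀ {x y} z → x < y → x + z < y + z
    *-pos                : ∀ {x y} → 0# < x → 0# < y → 0# < x * y
    archimedean          : ∀ x → ∃[ n ] x < n · 1#

  _≤_ : Rel Carrier ℓ₂
  x ≤ y = ¬ (y < x)

  -- m and n range symmetrically, so no absolute value is needed.
  IsCauchy : (ℕ → Carrier) → Set (c ⊔ ℓ₂)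
  IsCauchy s = ∀ ε → 0# < ε →
    ∃[ N ] (∀ m n → N ℕ.≤ m → N ℕ.≤ n → s m - s n < ε)

  _ConvergesTo_ : (ℕ → Carrier) → Carrier → Set (c ⊔ ℓ₂)
  s ConvergesTo l = ∀ ε → 0# < ε →
    ∃[ N ] (∀ n → N ℕ.≤ n → (s n - l < ε) × (l - s n < ε))

  field
    complete : ∀ s → IsCauchy s → ∃[ l ] s ConvergesTo l

  fromℤ : ℤ → Carrier
  fromℤ (+ n)      = n · 1#
  fromℤ (-[1+ n ]) = - (suc n · 1#)

module Geometry
  {c ℓ₁ ℓ₂ m ℓm : Level}
  (ℝ : RealField c ℓ₁ ℓ₂)
  (V : Module (RealField.commutativeRing ℝ) m ℓm)
  where

  open RealField ℝ hiding (zero)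
  open Module V
    using (Carrierᴹ; _≈ᴹ_; _+ᴹ_; -ᴹ_; 0ᴹ; _*ₗ_; ≈ᴹ-setoid; +ᴹ-rawMonoid)
  open RawMonoidDefs +ᴹ-rawMonoid using () renaming (sum to sumᴹ)

  linComb : ∀ {n} → Vector Carrier n → Vector Carrierᴹ n → Carrierᴹ
  linComb a v = sumᴹ (λ i → a i *ₗ v i)

  LinearlyIndependent : ∀ {n} → Vector Carrierᴹ n → Set (c ⊔ ℓ₁ ⊔ ℓm)
  LinearlyIndependent v = ∀ a → linComb a v ≈ᴹ 0ᴹ → ∀ i → a i ≈ 0#

  Spanning : ∀ {n} → Vector Carrierᴹ n → Set (c ⊔ m ⊔ ℓm)
  Spanning v = ∀ x → ∃[ a ] x ≈ᴹ linComb a v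

  record Basis (n : ℕ) : Set (c ⊔ ℓ₁ ⊔ m ⊔ ℓm) where
    field
      vectors     : Vector Carrierᴹ n
      independent : LinearlyIndependent vectors
      spanning    : Spanning vectors

  AffinelyIndependent : ∀ {n} → Vector Carrierᴹ (suc n) → Set (c ⊔ ℓ₁ ⊔ ℓm)
  AffinelyIndependent p =
    LinearlyIndependent (λ i → p (suc i) +ᴹ -ᴹ p zero)

  HasAffinelyIndependent : ∀ {ℓ} → Pred Carrierᴹ ℓ → ℕ → Set (c ⊔ ℓ₁ ⊔ m ⊔ ℓm ⊔ ℓ)
  HasAffinelyIndependent S n =
    Σ[ p ∈ Vector Carrierᴹ (suc n) ] (∀ i → p i ∈ S) × AffinelyIndependent p

  -- The dimension of the affine hull of S.
  HasDimension : ∀ {ℓ} → Pred Carrierᴹ ℓ → ℕ → Set (c ⊔ ℓ₁ ⊔ m ⊔ ℓm ⊔ ℓ)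
  HasDimension S d = HasAffinelyIndependent S d × ¬ HasAffinelyIndependent S (suc d)

  -- A lattice of full rank n, presented by a basis; as a subset of V it is
  -- latticePoints. Nothing below depends on which ℤ-basis is chosen.
  record Lattice (n : ℕ) : Set (c ⊔ ℓ₁ ⊔ m ⊔ ℓm) where
    field
      basis : Basis n

    open Basis basis public

    latticePoints : Pred Carrierᴹ ℓm
    latticePoints x = ∃[ z ] x ≈ᴹ linComb (fromℤ ∘ z) vectors

  open Lattice using (latticePoints)

  conv : ∀ {n} → Vector Carrierᴹ n → Pred Carrierᴹ (c ⊔ ℓ₁ ⊔ ℓ₂ ⊔ ℓm)
  conv v x = ∃[ w ] (∀ i → 0# ≤ w i) × (sum w ≈ 1#) × (x ≈ᴹ linComb w v)

  record Polytope {n : ℕ} (L : Lattice n) : Set (m ⊔ ℓm) where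
    field
      {size}     : ℕ
      generators : Vector Carrierᴹ (suc size)
      inLattice  : ∀ i → generators i ∈ latticePoints L

    points : Pred Carrierᴹ (c ⊔ ℓ₁ ⊔ ℓ₂ ⊔ ℓm)
    points = conv generators

  open Polytope using (points)

  record Polygon (L : Lattice 2) : Set (c ⊔ ℓ₁ ⊔ ℓ₂ ⊔ m ⊔ ℓm) where
    field
      polytope       : Polytope L
      twoDimensional : HasDimension (points polytope) 2

    open Polytope polytope public

  -- S has exactly n elements up to the equality of V.
  HasCardinality : ∀ {ℓ} → Pred Carrierᴹ ℓ → ℕ → Set (m ⊔ ℓm ⊔ ℓ)
  HasCardinality S n =
    Inverse (≡.setoid (Fin n)) (On.setoid {B = Σ Carrierᴹ S} ≈ᴹ-setoid proj₁)

  -- The graph of the universal counting function of P at the lattice L′.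
  CountingFunction : ∀ {n} {L : Lattice n} → Polytope L → Lattice n → ℕ →
                     Set (c ⊔ ℓ₁ ⊔ ℓ₂ ⊔ m ⊔ ℓm)
  CountingFunction P L′ k = HasCardinality (points P ∩ latticePoints L′) k

  EqualCountingFunctions : ∀ {n} {L : Lattice n} → Polytope L → Polytope L →
                           Set (c ⊔ ℓ₁ ⊔ ℓ₂ ⊔ m ⊔ ℓm)
  EqualCountingFunctions {n} {L} P Q =
    ∀ (L′ : Lattice n) → latticePoints L ⊆ latticePoints L′ →
    ∃[ k ] CountingFunction P L′ k × CountingFunction Q L′ k

  infixl 6 _⊕_ _⊖_

  _⊕_ : ∀ {a b} → Pred Carrierᴹ a → Pred Carrierᴹ b → Pred Carrierᴹ (m ⊔ ℓm ⊔ a ⊔ b)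
  (A ⊕ B) x = ∃[ a ] ∃[ b ] a ∈ A × b ∈ B × x ≈ᴹ a +ᴹ b

  _⊖_ : ∀ {a b} → Pred Carrierᴹ a → Pred Carrierᴹ b → Pred Carrierᴹ (m ⊔ ℓm ⊔ a ⊔ b)
  (A ⊖ B) x = ∃[ a ] ∃[ b ] a ∈ A × b ∈ B × x ≈ᴹ a +ᴹ -ᴹ b

  translate : ∀ {a} → Pred Carrierᴹ a → Carrierᴹ → Pred Carrierᴹ (m ⊔ ℓm ⊔ a)
  translate S v x = ∃[ s ] s ∈ S × x ≈ᴹ s +ᴹ v

  IsLatticeTranslate : ∀ {n a b} → Lattice n → Pred Carrierᴹ a → Pred Carrierᴹ b →
                       Set (m ⊔ ℓm ⊔ a ⊔ b)
  IsLatticeTranslate L A S = ∃[ v ] v ∈ latticePoints L × A ≐ translate S v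

  -- Lebesgue measure on compact subsets of V, normalised so that the
  -- fundamental parallelogram spanned by the basis of L has measure 1. A box is
  -- a closed parallelogram with sides parallel to the basis vectors. For a
  -- compact set, finite covers by boxes give the same infimum as countable ones,
  -- so finite covers suffice. Every other Lebesgue measure is a positive multiple
  -- of this one, so equality of areas does not depend on the normalisation.
  module Measure (L : Lattice 2) where

    record Box : Set (c ⊔ ℓ₂) where
      field
        lower upper : Vector Carrier 2
        lower≤upper : ∀ i → lower i ≤ upper i

      boxPoints : Pred Carrierᴹ (c ⊔ ℓ₂ ⊔ ℓm)
      boxPoints x = ∃[ t ] (∀ i → lower i ≤ t i × t i ≤ upper i)
                         × x ≈ᴹ linComb t (Lattice.vectors L)

      boxArea : Carrier
      boxArea = (upper zero - lower zero) * (upper (suc zero) - lower (suc zero))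

    open Box

    Covers : ∀ {k ℓ} → Vector Box k → Pred Carrierᴹ ℓ → Set (c ⊔ ℓ₂ ⊔ m ⊔ ℓm ⊔ ℓ)
    Covers B S = ∀ x → x ∈ S → ∃[ i ] x ∈ boxPoints (B i)

    totalArea : ∀ {k} → Vector Box k → Carrier
    totalArea B = sum (boxArea ∘ B)

    IsArea : ∀ {ℓ} → Pred Carrierᴹ ℓ → Carrier → Set (c ⊔ ℓ₂ ⊔ m ⊔ ℓm ⊔ ℓ)
    IsArea S a =
        (∀ {k} (B : Vector Box k) → Covers B S → a ≤ totalArea B)
      × (∀ ε → 0# < ε →
           ∃[ k ] Σ[ B ∈ Vector Box k ] Covers B S × totalArea B < a + ε)

    EqualAreas : ∀ {ℓ ℓ′} → Pred Carrierᴹ ℓ → Pred Carrierᴹ ℓ′ →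
                 Set (c ⊔ ℓ₂ ⊔ m ⊔ ℓm ⊔ ℓ ⊔ ℓ′)
    EqualAreas S T = ∃[ a ] IsArea S a × IsArea T a

  open Measure public using (EqualAreas)

{-# OPTIONS --safe #-}

-- A lattice polygon is described by its leftmost vertex and the multisets of its
-- upper and of its lower edge vectors, all directed to the right. Minkowski sums
-- concatenate these multisets and reflection exchanges them, so X + Y and X - Y
-- have the same edges up to sign. By Pick's theorem, the number of points of a
-- finer lattice in a polygon depends only on its area and on the lattice lengths
-- of its edges. Conversely, comparing the counts for L and ½L recovers the area,
-- and stretching the lattice in one direction singles out the total length of the
-- edges parallel to it. Hence, after cutting edges into primitive vectors, the
-- unions of the upper and lower multisets of P and Q agree: up P + lo P = up Q +
-- lo Q. The common refinement of these two splittings gives the edges of X (in up P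
-- and up Q, and in lo P and lo Q) and of Y (the remaining ones); both close up
-- because P and Q do.
module Submission where

open import Defs
open import Algebra.Apartness.Bundles using (HeytingField)
open import Algebra.Bundles using (CommutativeMonoid; CommutativeRing; RawRing)
open import Algebra.Module.Bundles using (Module)
open import Data.Empty using (⊥-elim)
open import Data.Fin.Base as Fin using (Fin; zero; suc)
import Data.Fin.Properties as Finₚ
open import Data.Fin.Patterns using (0F; 1F)
import Data.Integer.Base as ℤ
import Data.Integer.Properties as ℤₚ
import Data.Integer.DivMod as ℤ/
open import Data.Integer.Tactic.RingSolver using (solve-∀)
open import Data.List.Base as List using (List; []; _∷_; _++_; length; map; lookup; tabulate)
import Data.List.Properties as Listₚ
open import Data.List.Membership.Propositional using (_∈_)
import Data.List.Membership.Propositional.Properties as ∈ₚ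
open import Data.List.Relation.Unary.All as All using (All; []; _∷_)
import Data.List.Relation.Unary.All.Properties as Allₚ
open import Data.List.Relation.Unary.AllPairs using (AllPairs; []; _∷_)
open import Data.List.Relation.Unary.Any as Any using (Any; here; there)
import Data.List.Relation.Unary.Any.Properties as Anyₚ
open import Data.List.Relation.Unary.Unique.Propositional using (Unique)
import Data.List.Relation.Unary.Unique.Propositional.Properties as Uniqueₚ
open import Data.List.Relation.Binary.Permutation.Propositional as Perm using (_↭_; prep; swap; ↭-refl; ↭-sym; ↭-trans)
import Data.List.Relation.Binary.Permutation.Propositional.Properties as Permₚ
open import Data.Maybe.Base using (Maybe; just; nothing)
open import Data.Nat.Base as ℕ using (ℕ; zero; suc; z≤n; s≤s)
import Data.Nat.Properties as ℕₚ
open import Data.Product.Base using (Σ; Σ-syntax; ∃; ∃-syntax; _×_; _,_; proj₁; proj₂)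
open import Data.Sum.Base using (_⊎_; inj₁; inj₂; [_,_]′)
open import Function.Base using (_∘_; id)
open import Function.Bundles using (Inverse; _⇔_; mk⇔; Equivalence)
open import Level using (Level; _⊔_)
open import Relation.Binary.Bundles using (Setoid)
open import Relation.Binary.Structures using (IsStrictPartialOrder)
open import Relation.Binary.Definitions using (tri<; tri≈; tri>)
open import Relation.Binary.PropositionalEquality as ≡ using (_≡_; _≢_; refl; cong; cong₂; subst; subst₂; module ≡-Reasoning)
open import Relation.Nullary using (¬_; Dec; yes; no; contradiction)

-- No order on the reals is decided, so the combinatorics takes place in ℤ², and polygons enter it
-- only through their support functions at integer directions. Gordan's alternative is the bridge
-- back: a lattice point that no integer direction separates from the vertices is a rational mean of
-- three of them. In this language a Minkowski sum is a sum of functions, and a finer lattice is an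
-- integer matrix `M`, which replaces `H` by `H ∘ mulᵀ M`.
--
-- On upward directions the support function of the upper boundary is, up to translation, that of
-- the zonotope of its edges, and so forgets their order; likewise below. This is why multisets
-- suffice. A general `M`, however, can turn edges to the left and mix the two boundaries, so Pick's
-- theorem is applied after a unimodular change to triangular form.
--
-- The area is defined by real covers. It is half of an integer: counting points of the lattices L/n
-- bounds every cover from below, and squares at the lattice points of a slightly thickened multiple
-- of the polygon give covers that are nearly optimal.

-- Integer vectors in the plane and Gordan's alternative.

module Plane where
  open ℤ using (ℤ; +_; -[1+_]; 0ℤ; 1ℤ; _+_; _*_; _-_; -_; _≤_; _<_; +<+; +≤+; ∣_∣)

  Pt : Set
  Pt = ℤ × ℤ

  infixl 6 _⊞_
  infixr 7 _⊡_

  _⊞_ : Pt → Pt → Pt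
  (a , b) ⊞ (c , d) = (a + c , b + d)

  ⊟_ : Pt → Pt
  ⊟ (a , b) = (- a , - b)

  _⊡_ : ℤ → Pt → Pt
  n ⊡ (a , b) = (n * a , n * b)

  𝟎 : Pt
  𝟎 = (0ℤ , 0ℤ)

  dot det : Pt → Pt → ℤ
  dot (a , b) (c , d) = a * c + b * d
  det (a , b) (c , d) = a * d - b * c

  _≟_ : (z w : Pt) → Dec (z ≡ w)
  (a , b) ≟ (c , d) with a ℤₚ.≟ c | b ℤₚ.≟ d
  ... | yes refl | yes refl = yes refl
  ... | no a≢c   | _        = no λ { refl → a≢c refl }
  ... | _        | no b≢d   = no λ { refl → b≢d refl }

  0≤+ : ∀ {i j} → 0ℤ ≤ i → 0ℤ ≤ j → 0ℤ ≤ i + j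
  0≤+ = ℤₚ.+-mono-≤

  0≤* : ∀ {i j} → 0ℤ ≤ i → 0ℤ ≤ j → 0ℤ ≤ i * j
  0≤* {+ m} {+ n} _ _ = subst (0ℤ ≤_) (ℤₚ.pos-* m n) (+≤+ z≤n)

  0≤square : ∀ p → 0ℤ ≤ p * p
  0≤square (+ n)    = 0≤* (+≤+ (z≤n {n})) (+≤+ (z≤n {n}))
  0≤square -[1+ n ] = +≤+ z≤n

  0<* : ∀ {i j} → 0ℤ < i → 0ℤ < j → 0ℤ < i * j
  0<* {+ suc m} {+ suc n} _ _ = +<+ (s≤s z≤n)
  0<* {+ zero} (+<+ ()) _
  0<* {+ suc m} {+ zero} _ (+<+ ())

  ≤⇒0≤ : ∀ {i j} → i ≤ j → 0ℤ ≤ j - i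
  ≤⇒0≤ = ℤₚ.i≤j⇒0≤j-i

  -- Inequalities are proved by certificates: `d` is a sum of products of nonnegative terms, and the
  -- equation `d ≡ j - i` is a ring identity.
  ≤-by : ∀ {i j d} → 0ℤ ≤ d → d ≡ j - i → i ≤ j
  ≤-by 0≤d refl = ℤₚ.0≤i-j⇒j≤i 0≤d

  -- Over ℤ a strict inequality is the weak one 0 ≤ j - i - 1, so strict inequalities fit the same
  -- certificates.
  <⇒1≤ : ∀ {i j} → i < j → 0ℤ ≤ j - i - 1ℤ
  <⇒1≤ {i} {j} i<j = subst (0ℤ ≤_) (lem i j) (≤⇒0≤ (ℤₚ.i<j⇒suc[i]≤j i<j))
    where
    lem : ∀ i j → j - (1ℤ + i) ≡ j - i - 1ℤ
    lem = solve-∀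

  <-by : ∀ {i j d} → 0ℤ ≤ d → d ≡ j - i - 1ℤ → i < j
  <-by {i} {j} 0≤d eq = ℤₚ.suc[i]≤j⇒i<j (≤-by 0≤d (≡.trans eq (lem i j)))
    where
    lem : ∀ i j → j - i - 1ℤ ≡ j - (1ℤ + i)
    lem = solve-∀

  <-or-≥ : ∀ i j → i < j ⊎ j ≤ i
  <-or-≥ i j with i ℤₚ.<? j
  ... | yes p = inj₁ p
  ... | no p  = inj₂ (ℤₚ.≮⇒≥ p)

  *-cancel-≤ : ∀ {i j k} → 0ℤ < k → k * i ≤ k * j → i ≤ j
  *-cancel-≤ {i} {j} {k} 0<k = ℤₚ.*-cancelˡ-≤-pos i j k {{ℤ.positive 0<k}}

  0≤-neg : ∀ {i} → i ≤ 0ℤ → 0ℤ ≤ - i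
  0≤-neg = ℤₚ.neg-mono-≤

  <⇒0< : ∀ {i j} → i < j → 0ℤ < j - i
  <⇒0< {i} {j} p = <-by (<⇒1≤ p) (lem i j)
    where
    lem : ∀ i j → j - i - 1ℤ ≡ j - i - 0ℤ - 1ℤ
    lem = solve-∀

  det-self : ∀ z → det z z ≡ 0ℤ
  det-self (a , b) = lem a b
    where
    lem : ∀ a b → a * b - b * a ≡ 0ℤ
    lem = solve-∀

  dot-⊞ˡ : ∀ z w u → dot (z ⊞ w) u ≡ dot z u + dot w u
  dot-⊞ˡ (a , b) (c , d) (e , f) = lem a b c d e f
    where
    lem : ∀ a b c d e f → (a + c) * e + (b + d) * f ≡ (a * e + b * f) + (c * e + d * f)
    lem = solve-∀

  dot-⊟ˡ : ∀ z u → dot (⊟ z) u ≡ - dot z u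
  dot-⊟ˡ (a , b) (e , f) = lem a b e f
    where
    lem : ∀ a b e f → - a * e + - b * f ≡ - (a * e + b * f)
    lem = solve-∀

  dot-⊟ʳ : ∀ z u → dot z (⊟ u) ≡ - dot z u
  dot-⊟ʳ (a , b) (e , f) = lem a b e f
    where
    lem : ∀ a b e f → a * - e + b * - f ≡ - (a * e + b * f)
    lem = solve-∀

  ⊟-involutive : ∀ z → ⊟ (⊟ z) ≡ z
  ⊟-involutive (a , b) = cong₂ _,_ (ℤₚ.neg-involutive a) (ℤₚ.neg-involutive b)

  -- Supplies the multiplier in `rotated` by which integers that are at least 1 outweigh finitely
  -- many given ones.
  bounded-below : ∀ {n} (t : Fin n → ℤ) → ∃[ N ] (∀ i → 0ℤ < + N + t i)
  bounded-below {zero}  t = 0 , λ ()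
  bounded-below {suc n} t with bounded-below (t ∘ suc)
  ... | N , N-bound = suc (N ℕ.+ ∣ t zero ∣) , λ where
      zero    → <-by (0≤+ (+≤+ (z≤n {N})) (abs-bound (t zero))) (lem₀ (+ N) (+ ∣ t zero ∣) (t zero))
      (suc i) → <-by (0≤+ (+≤+ (z≤n {suc ∣ t zero ∣})) (<⇒1≤ (N-bound i))) (lem₁ (+ N) (+ ∣ t zero ∣) (t (suc i)))
    where
    abs-bound : ∀ i → 0ℤ ≤ + ∣ i ∣ + i
    abs-bound (+ n)    = +≤+ z≤n
    abs-bound -[1+ n ] = ℤₚ.≤-reflexive (≡.sym (ℤₚ.+-inverseʳ (+ suc n)))
    lem₀ : ∀ N a i → N + (a + i) ≡ 1ℤ + (N + a) + i - 0ℤ - 1ℤ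
    lem₀ = solve-∀
    lem₁ : ∀ N a i → (1ℤ + a) + (N + i - 0ℤ - 1ℤ) ≡ 1ℤ + (N + a) + i - 0ℤ - 1ℤ
    lem₁ = solve-∀

  -- The indices may coincide; nontriviality is the positive sum of the coefficients.
  record Balanced {n} (d : Fin n → Pt) : Set where
    constructor balanced
    field
      i j k : Fin n
      a b c : ℤ
      0≤a : 0ℤ ≤ a
      0≤b : 0ℤ ≤ b
      0≤c : 0ℤ ≤ c
      0<a+b+c : 0ℤ < a + b + c
      sum≡𝟎 : a ⊡ d i ⊞ b ⊡ d j ⊞ c ⊡ d k ≡ 𝟎

  -- Gordan's alternative in the plane, with the Carathéodory bound of three terms.
  gordan : ∀ {n} (d : Fin n → Pt) → Balanced d ⊎ (∃[ u ] ∀ i → 0ℤ < dot (d i) u)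
  gordan {zero}  d = inj₂ (𝟎 , λ ())
  gordan {suc n} d with gordan (d ∘ suc)
  ... | inj₁ (balanced i j k a b c p q r s e) = inj₁ (balanced (suc i) (suc j) (suc k) a b c p q r s e)
  ... | inj₂ (u , u-pos) = new
    where
    d₀ = d zero

    Goal = Balanced d ⊎ (∃[ u ] ∀ i → 0ℤ < dot (d i) u)

    σ : Fin n → ℤ
    σ i = det (d (suc i)) d₀

    vanishing : d₀ ≡ 𝟎 → Goal
    vanishing e = inj₁ (balanced zero zero zero 1ℤ 0ℤ 0ℤ (+≤+ z≤n) (+≤+ z≤n) (+≤+ z≤n) (+<+ (s≤s z≤n))
      (subst (λ v → 1ℤ ⊡ v ⊞ 0ℤ ⊡ v ⊞ 0ℤ ⊡ v ≡ 𝟎) (≡.sym e) refl))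

    -- Both coordinates of (z·u) w - (w·u) z are multiples of `det z w`, which vanishes here; the
    -- signs of the two coefficients come from the choice of `u`.
    parallel : dot d₀ u ≤ 0ℤ → (∃[ i ] σ i ≡ 0ℤ) → Goal
    parallel p (i , σ≡0) = inj₁ (balanced zero (suc i) zero (dot (d (suc i)) u) (- dot d₀ u) 0ℤ
      (ℤₚ.<⇒≤ (u-pos i)) (0≤-neg p) (+≤+ z≤n)
      (<-by (0≤+ (<⇒1≤ (u-pos i)) (0≤-neg p)) (lem₀ (dot (d (suc i)) u) (- dot d₀ u)))
      (lem (d (suc i)) d₀ u σ≡0))
      where
      lem₀ : ∀ a b → a - 0ℤ - 1ℤ + b ≡ a + b + 0ℤ - 0ℤ - 1ℤ
      lem₀ = solve-∀
      lem₁ : ∀ x y p q a b → (x * a + y * b) * p + - (p * a + q * b) * x + 0ℤ * p ≡ - b * (x * q - y * p)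
      lem₁ = solve-∀
      lem₂ : ∀ x y p q a b → (x * a + y * b) * q + - (p * a + q * b) * y + 0ℤ * q ≡ a * (x * q - y * p)
      lem₂ = solve-∀
      lem : ∀ z w u → det z w ≡ 0ℤ → dot z u ⊡ w ⊞ (- dot w u) ⊡ z ⊞ 0ℤ ⊡ w ≡ 𝟎
      lem (x , y) (p , q) (a , b) e = cong₂ _,_
        (≡.trans (lem₁ x y p q a b) (≡.trans (cong (- b *_) e) (ℤₚ.*-zeroʳ (- b))))
        (≡.trans (lem₂ x y p q a b) (≡.trans (cong (a *_) e) (ℤₚ.*-zeroʳ a)))

    -- Cramer's identity det(a,b)c + det(b,c)a + det(c,a)b = 0; pairing it with u
    -- shows that the third coefficient has the right sign.
    opposite : dot d₀ u ≤ 0ℤ → ∀ i j → 0ℤ < σ i → σ j < 0ℤ → Goal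
    opposite p i j σi>0 σj<0 = inj₁ (balanced (suc j) (suc i) zero (σ i) (- σ j) (det (d (suc j)) (d (suc i)))
      (ℤₚ.<⇒≤ σi>0) (0≤-neg (ℤₚ.<⇒≤ σj<0)) 0≤det
      (<-by (0≤+ (<⇒1≤ σi>0) (0≤+ (0≤-neg (ℤₚ.<⇒≤ σj<0)) 0≤det)) (lem₀ (σ i) (- σ j) (det (d (suc j)) (d (suc i)))))
      (cramer (d (suc i)) d₀ (d (suc j))))
      where
      lem₀ : ∀ a b c → a - 0ℤ - 1ℤ + (b + c) ≡ a + b + c - 0ℤ - 1ℤ
      lem₀ = solve-∀
      lem₁ : ∀ x y p q s t → (x * q - y * p) * s + - (s * q - t * p) * x + (s * y - t * x) * p ≡ 0ℤ
      lem₁ = solve-∀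
      lem₂ : ∀ x y p q s t → (x * q - y * p) * t + - (s * q - t * p) * y + (s * y - t * x) * q ≡ 0ℤ
      lem₂ = solve-∀
      cramer : ∀ a b c → det a b ⊡ c ⊞ (- det c b) ⊡ a ⊞ det c a ⊡ b ≡ 𝟎
      cramer (x , y) (p , q) (s , t) = cong₂ _,_ (lem₁ x y p q s t) (lem₂ x y p q s t)
      lem₃ : ∀ x y p q s t a b → (s * y - t * x) * - (p * a + q * b) ≡ (x * q - y * p) * (s * a + t * b) + -
          (s * q - t * p) * (x * a + y * b)
      lem₃ = solve-∀
      product>0 : ∀ z w v u → 0ℤ < det z w * dot v u + - det v w * dot z u → 0ℤ < det v z * - dot w u
      product>0 (x , y) (p , q) (s , t) (a , b) = subst (0ℤ <_) (≡.sym (lem₃ x y p q s t a b))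
      0≤det : 0ℤ ≤ det (d (suc j)) (d (suc i))
      0≤det with <-or-≥ (det (d (suc j)) (d (suc i))) 0ℤ
      ... | inj₂ q = q
      ... | inj₁ q = ⊥-elim (ℤₚ.<⇒≱
              (product>0 (d (suc i)) d₀ (d (suc j)) u
                (ℤₚ.+-mono-< (0<* σi>0 (u-pos j)) (0<* (ℤₚ.neg-mono-< σj<0) (u-pos i))))
              (≤-by (0≤* (0≤-neg (ℤₚ.<⇒≤ q)) (0≤-neg p)) (lem₄ (det (d (suc j)) (d (suc i))) (dot d₀ u))))
        where
        lem₄ : ∀ a b → - a * - b ≡ 0ℤ - a * - b
        lem₄ = solve-∀

    -- All other vectors lie strictly on one side of the line through `d₀`. A large multiple of the
    -- normal of this line is positive on them and zero on `d₀`; adding `d₀` itself makes it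
    -- positive there too, with value |d₀|².
    rotated : d₀ ≢ 𝟎 → ∀ (s : ℤ) → (∀ i → 0ℤ < s * σ i) → Goal
    rotated d₀≢𝟎 s pos with bounded-below (λ i → dot (d (suc i)) d₀)
    ... | N , N-bound = inj₂ (u′ d₀ , λ where
        zero    → subst (0ℤ <_) (≡.sym (lem d₀)) (norm>0 d₀ d₀≢𝟎)
        (suc i) → subst (0ℤ <_) (≡.sym (lem′ (d (suc i)) d₀))
                    (<-by (0≤+ (0≤* (+≤+ (z≤n {N})) (<⇒1≤ (pos i))) (<⇒1≤ (N-bound i)))
                          (lem″ (+ N) (s * σ i) (dot (d (suc i)) d₀))))
      where
      u′ : Pt → Pt
      u′ (p , q) = (+ N * (s * q) + p , + N * (s * - p) + q)
      lem″ : ∀ N a b → N * (a - 0ℤ - 1ℤ) + (N + b - 0ℤ - 1ℤ) ≡ N * a + b - 0ℤ - 1ℤ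
      lem″ = solve-∀
      lem₁ : ∀ N s p q → p * (N * (s * q) + p) + q * (N * (s * - p) + q) ≡ p * p + q * q
      lem₁ = solve-∀
      lem : ∀ w → dot w (u′ w) ≡ dot w w
      lem (p , q) = lem₁ (+ N) s p q
      lem₂ : ∀ N s x y p q → x * (N * (s * q) + p) + y * (N * (s * - p) + q) ≡ N * (s * (x * q - y * p)) +
          (x * p + y * q)
      lem₂ = solve-∀
      lem′ : ∀ z w → dot z (u′ w) ≡ + N * (s * det z w) + dot z w
      lem′ (x , y) (p , q) = lem₂ (+ N) s x y p q
      norm>0 : ∀ w → w ≢ 𝟎 → 0ℤ < dot w w
      norm>0 (+ zero , + zero)       w≢𝟎 = ⊥-elim (w≢𝟎 refl)
      norm>0 (+ zero , + suc n)      w≢𝟎 = +<+ (s≤s z≤n)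
      norm>0 (+ zero , -[1+ n ])     w≢𝟎 = +<+ (s≤s z≤n)
      norm>0 (+ suc m , q)           w≢𝟎 = ℤₚ.+-mono-<-≤ (+<+ (s≤s (z≤n {m ℕ.+ m ℕ.* suc m}))) (0≤square q)
      norm>0 (-[1+ m ] , q)          w≢𝟎 = ℤₚ.+-mono-<-≤ (+<+ (s≤s (z≤n {m ℕ.+ m ℕ.* suc m}))) (0≤square q)

    new : Goal
    new with <-or-≥ 0ℤ (dot d₀ u) | d₀ ≟ 𝟎
    ... | inj₁ p | _ = inj₂ (u , λ { zero → p ; (suc i) → u-pos i })
    ... | inj₂ p | yes e = vanishing e
    ... | inj₂ p | no d₀≢𝟎 with Finₚ.any? (λ i → σ i ℤₚ.≟ 0ℤ)
    ...   | yes e = parallel p e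
    ...   | no ≢0 with Finₚ.any? (λ i → 0ℤ ℤₚ.<? σ i) | Finₚ.any? (λ i → σ i ℤₚ.<? 0ℤ)
    ...     | yes (i , q) | yes (j , r) = opposite p i j q r
    ...     | no none | _ = rotated d₀≢𝟎 (- 1ℤ) negative
      where
      lem : ∀ i → - i ≡ - 1ℤ * i
      lem = solve-∀
      negative : ∀ i → 0ℤ < - 1ℤ * σ i
      negative i with ℤₚ.<-cmp (σ i) 0ℤ
      ... | tri< q _ _ = subst (0ℤ <_) (lem (σ i)) (ℤₚ.neg-mono-< q)
      ... | tri≈ _ q _ = ⊥-elim (≢0 (i , q))
      ... | tri> _ _ q = ⊥-elim (none (i , q))
    ...     | _ | no none = rotated d₀≢𝟎 1ℤ positive
      where
      positive : ∀ i → 0ℤ < 1ℤ * σ i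
      positive i with ℤₚ.<-cmp (σ i) 0ℤ
      ... | tri< q _ _ = ⊥-elim (none (i , q))
      ... | tri≈ _ q _ = ⊥-elim (≢0 (i , q))
      ... | tri> _ _ q = subst (0ℤ <_) (≡.sym (ℤₚ.*-identityˡ (σ i))) q

-- Upper hulls of finite point sets by gift wrapping.

module Chains where
  open ℤ using (ℤ; +_; -[1+_]; 0ℤ; _+_; _*_; _-_; -_; _≤_; _<_; +<+)
  open Plane

  infix 5 _⇢_

  _⇢_ : Pt → Pt → Pt
  v ⇢ w = w ⊞ ⊟ v

  -- Vertical vectors count as directed to the right when they point up. The order of points is then
  -- total, so the extreme vertices are unique and vertical edges need no separate list.
  LexPos LexNonNeg : Pt → Set
  LexPos    (p , q) = (0ℤ < p) ⊎ (p ≡ 0ℤ × 0ℤ < q)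
  LexNonNeg (p , q) = (0ℤ < p) ⊎ (p ≡ 0ℤ × 0ℤ ≤ q)

  -- The half-plane is closed: horizontal directions belong to both the upper and the lower
  -- boundary.
  Upward : Pt → Set
  Upward (a , b) = 0ℤ ≤ b

  pos : ℤ → ℤ
  pos i = 0ℤ ℤ.⊔ i

  -- The support function of the zonotope Σ [0,f].
  zono : List Pt → Pt → ℤ
  zono []      u = 0ℤ
  zono (f ∷ F) u = pos (dot f u) + zono F u

  total : List Pt → Pt
  total []      = 𝟎
  total (f ∷ F) = f ⊞ total F

  0≤pos : ∀ i → 0ℤ ≤ pos i
  0≤pos i = ℤₚ.i≤i⊔j 0ℤ i

  ≤pos : ∀ i → i ≤ pos i
  ≤pos i = ℤₚ.i≤j⊔i 0ℤ i

  pos-≥ : ∀ {i} → 0ℤ ≤ i → pos i ≡ i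
  pos-≥ = ℤₚ.i≤j⇒i⊔j≡j

  pos-≤ : ∀ {i} → i ≤ 0ℤ → pos i ≡ 0ℤ
  pos-≤ = ℤₚ.i≥j⇒i⊔j≡i

  pos-neg : ∀ i → pos (- i) ≡ pos i - i
  pos-neg (+ zero)    = refl
  pos-neg (+ suc n)   = ≡.sym (ℤₚ.+-inverseʳ (+ suc n))
  pos-neg (-[1+ n ])  = ≡.sym (ℤₚ.+-identityˡ _)

  0≤zono : ∀ F u → 0ℤ ≤ zono F u
  0≤zono []      u = ℤₚ.≤-refl
  0≤zono (f ∷ F) u = 0≤+ (0≤pos (dot f u)) (0≤zono F u)

  LexPos⇒LexNonNeg : ∀ {f} → LexPos f → LexNonNeg f
  LexPos⇒LexNonNeg (inj₁ p)       = inj₁ p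
  LexPos⇒LexNonNeg (inj₂ (e , q)) = inj₂ (e , ℤₚ.<⇒≤ q)

  LexNonNeg⇒0≤x : ∀ {f} → LexNonNeg f → 0ℤ ≤ proj₁ f
  LexNonNeg⇒0≤x (inj₁ p)       = ℤₚ.<⇒≤ p
  LexNonNeg⇒0≤x (inj₂ (e , q)) = ℤₚ.≤-reflexive (≡.sym e)

  LexPos-dec : ∀ f → LexPos f ⊎ LexNonNeg (⊟ f)
  LexPos-dec (p , q) with ℤₚ.<-cmp p 0ℤ
  ... | tri< a _ _ = inj₂ (inj₁ (ℤₚ.neg-mono-< a))
  ... | tri> _ _ c = inj₁ (inj₁ c)
  ... | tri≈ _ refl _ with <-or-≥ 0ℤ q
  ...   | inj₁ r = inj₁ (inj₂ (refl , r))
  ...   | inj₂ r = inj₂ (inj₂ (refl , ℤₚ.neg-mono-≤ r))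

  LexNonNeg-⊞ : ∀ {f g} → LexNonNeg f → LexNonNeg g → LexNonNeg (f ⊞ g)
  LexNonNeg-⊞ (inj₁ p) g                           = inj₁ (ℤₚ.+-mono-<-≤ p (LexNonNeg⇒0≤x g))
  LexNonNeg-⊞ (inj₂ (e , q)) (inj₁ p)              = inj₁ (ℤₚ.+-mono-≤-< (ℤₚ.≤-reflexive (≡.sym e)) p)
  LexNonNeg-⊞ (inj₂ (refl , q)) (inj₂ (refl , q′)) = inj₂ (refl , 0≤+ q q′)

  LexPos-asym : ∀ {f} → LexPos f → ¬ LexNonNeg (⊟ f)
  LexPos-asym {p , q} (inj₁ 0<p) r = ℤₚ.<⇒≱ (ℤₚ.neg-mono-< 0<p) (LexNonNeg⇒0≤x r)
  LexPos-asym {p , q} (inj₂ (refl , 0<q)) (inj₁ (+<+ ()))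
  LexPos-asym {p , q} (inj₂ (refl , 0<q)) (inj₂ (_ , r)) = ℤₚ.<⇒≱ (ℤₚ.neg-mono-< 0<q) r

  -- det f g ≤ 0 says that f is at least as steep as g.
  steeper : ∀ f g u → LexPos f → 0ℤ ≤ proj₁ g → det f g ≤ 0ℤ → Upward u → dot f u < 0ℤ → dot g u ≤ 0ℤ
  steeper (p , q) (s , t) (a , b) (inj₁ 0<p) 0≤s det≤0 0≤b neg =
    *-cancel-≤ 0<p (≤-by (0≤+ (0≤* 0≤s (0≤-neg (ℤₚ.<⇒≤ neg))) (0≤* 0≤b (0≤-neg det≤0))) (lem p q s t a b))
    where
    lem : ∀ p q s t a b → s * - (p * a + q * b) + b * - (p * t - q * s) ≡ p * 0ℤ - p * (s * a + t * b)
    lem = solve-∀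
  steeper (p , q) (s , t) (a , b) (inj₂ (refl , 0<q)) 0≤s det≤0 0≤b neg =
    ⊥-elim (ℤₚ.<⇒≱ neg (subst (0ℤ ≤_) (lem q a b) (0≤* (ℤₚ.<⇒≤ 0<q) 0≤b)))
    where
    lem : ∀ q a b → q * b ≡ 0ℤ * a + q * b
    lem = solve-∀

  -- With p and s the first coordinates of `f` and `g`, and b the second one of `u`, p (f·u - g·u) =
  -- (p - s)(f·u) - b det f g, where both terms are nonnegative. If p = 0, then f - g is vertical
  -- and points up.
  under-segment : ∀ f g u → LexNonNeg g → LexNonNeg (g ⇢ f) → det f g ≤ 0ℤ → Upward u →
                  0ℤ ≤ dot f u → dot g u ≤ dot f u
  under-segment (p , q) (s , t) (a , b) g≥0 f≥g det≤0 0≤b 0≤fu with <-or-≥ 0ℤ p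
  ... | inj₁ 0<p = *-cancel-≤ 0<p
        (≤-by (0≤+ (0≤* (LexNonNeg⇒0≤x f≥g) 0≤fu) (0≤* 0≤b (0≤-neg det≤0))) (lem p q s t a b))
    where
    lem : ∀ p q s t a b → (p + - s) * (p * a + q * b) + b * - (p * t - q * s) ≡ p * (p * a + q * b) - p *
        (s * a + t * b)
    lem = solve-∀
  ... | inj₂ p≤0 with f≥g
  ...   | inj₁ s<p = ⊥-elim (ℤₚ.<⇒≱ s<p (≤-by (0≤+ (0≤-neg p≤0) (LexNonNeg⇒0≤x g≥0)) (lem p s)))
    where
    lem : ∀ p s → - p + s ≡ 0ℤ - (p + - s)
    lem = solve-∀
  ...   | inj₂ (e , r) = ≤-by (0≤* r 0≤b)
        (≡.trans (≡.sym (≡.trans (cong (λ i → i * a + (q + - t) * b) e) (lem₀ ((q + - t) * b) a))) (lem p q s t a b))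
    where
    lem₀ : ∀ i a → 0ℤ * a + i ≡ i
    lem₀ = solve-∀
    lem : ∀ p q s t a b → (p + - s) * a + (q + - t) * b ≡ p * a + q * b - (s * a + t * b)
    lem = solve-∀

  -- If p, s, x are the first coordinates of `f`, `g`, `h`, then s det f h = x det f g + p det g h.
  -- For vertical `g` this says nothing, but then `f` has to be vertical as well.
  steeper-trans : ∀ f g h → LexPos f → LexPos g → LexPos h → det f g ≤ 0ℤ → det g h ≤ 0ℤ → det f h ≤ 0ℤ
  steeper-trans f@(p , q) g@(s , t) h@(x , y) f>0 (inj₁ 0<s) h>0 fg gh =
    *-cancel-≤ 0<s (≤-by (0≤+ (0≤* (LexNonNeg⇒0≤x (LexPos⇒LexNonNeg {h} h>0)) (0≤-neg fg))
                              (0≤* (LexNonNeg⇒0≤x (LexPos⇒LexNonNeg {f} f>0)) (0≤-neg gh))) (lem p q s t x y))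
    where
    lem : ∀ p q s t x y → x * - (p * t - q * s) + p * - (s * y - t * x) ≡ s * 0ℤ - s * (p * y - q * x)
    lem = solve-∀
  steeper-trans f@(p , q) (s , t) h@(x , y) (inj₁ 0<p) (inj₂ (refl , 0<t)) h>0 fg gh =
    ⊥-elim (ℤₚ.<⇒≱ (0<* 0<p 0<t) (subst (_≤ 0ℤ) (lem p q t) fg))
    where
    lem : ∀ p q t → p * t - q * 0ℤ ≡ p * t
    lem = solve-∀
  steeper-trans (p , q) (s , t) h@(x , y) (inj₂ (refl , 0<q)) (inj₂ (refl , 0<t)) h>0 fg gh =
    ≤-by (0≤* (ℤₚ.<⇒≤ 0<q) (LexNonNeg⇒0≤x (LexPos⇒LexNonNeg {h} h>0))) (lem q x y)
    where
    lem : ∀ q x y → q * x ≡ 0ℤ - (0ℤ * y - q * x)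
    lem = solve-∀

  -- The hull is recorded by its ends and its effect on upward directions: `bound` and `attained`
  -- say that the maximum over `xs` is that of a translated zonotope. The order of the edges leaves
  -- no trace in this.
  record Chain (first : Pt) (xs : List Pt) : Set where
    field
      last       : Pt
      edges      : List Pt
      first∈     : first ∈ xs
      last∈      : last ∈ xs
      first≤     : ∀ {s} → s ∈ xs → LexNonNeg (first ⇢ s)
      ≤last      : ∀ {s} → s ∈ xs → LexNonNeg (s ⇢ last)
      edges>0    : All LexPos edges
      total≡     : total edges ≡ first ⇢ last
      bound      : ∀ u → Upward u → ∀ {s} → s ∈ xs → dot s u ≤ dot first u + zono edges u
      attained   : ∀ u → Upward u → ∃[ s ] s ∈ xs × dot s u ≡ dot first u + zono edges u

  ⇢-self : ∀ v → v ⇢ v ≡ 𝟎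
  ⇢-self (a , b) = cong₂ _,_ (ℤₚ.+-inverseʳ a) (ℤₚ.+-inverseʳ b)

  ⇢-trans : ∀ u v w → (u ⇢ v) ⊞ (v ⇢ w) ≡ u ⇢ w
  ⇢-trans (a , b) (c , d) (e , f) = cong₂ _,_ (lem a c e) (lem b d f)
    where
    lem : ∀ a c e → (c + - a) + (e + - c) ≡ e + - a
    lem = solve-∀

  ⊟-⇢ : ∀ v w → ⊟ (v ⇢ w) ≡ w ⇢ v
  ⊟-⇢ (a , b) (c , d) = cong₂ _,_ (lem a c) (lem b d)
    where
    lem : ∀ a c → - (c + - a) ≡ a + - c
    lem = solve-∀

  LexNonNeg-self : ∀ v → LexNonNeg (v ⇢ v)
  LexNonNeg-self v = subst LexNonNeg (≡.sym (⇢-self v)) (inj₂ (refl , ℤₚ.≤-refl))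

  dot-⇢ : ∀ v w u → dot w u ≡ dot v u + dot (v ⇢ w) u
  dot-⇢ (a , b) (c , d) (e , f) = lem a b c d e f
    where
    lem : ∀ a b c d e f → c * e + d * f ≡ (a * e + b * f) + ((c + - a) * e + (d + - b) * f)
    lem = solve-∀

  LexPos? : ∀ f → Dec (LexPos f)
  LexPos? f with LexPos-dec f
  ... | inj₁ p = yes p
  ... | inj₂ q = no λ p → LexPos-asym p q

  steepest : ∀ v x xs → All (λ s → LexPos (v ⇢ s)) (x ∷ xs) →
             ∃[ s ] s ∈ x ∷ xs × All (λ t → det (v ⇢ s) (v ⇢ t) ≤ 0ℤ) (x ∷ xs)
  steepest v x [] _ = x , here refl , ℤₚ.≤-reflexive (det-self (v ⇢ x)) ∷ []
  steepest v x (y ∷ ys) (x>0 ∷ ys>0) with steepest v y ys ys>0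
  ... | s , s∈ , s-max with <-or-≥ 0ℤ (det (v ⇢ s) (v ⇢ x))
  ...   | inj₂ p = s , there s∈ , p ∷ s-max
  ...   | inj₁ p = x , here refl , ℤₚ.≤-reflexive (det-self (v ⇢ x)) ∷ All.zipWith (λ {t} → better {t}) (ys>0 , s-max)
    where
    lem₂ : ∀ a b c d → - (a * d - b * c) ≡ c * b - d * a
    lem₂ = solve-∀
    swapped : ∀ f g → 0ℤ < det f g → det g f ≤ 0ℤ
    swapped (a , b) (c , d) q = subst (_≤ 0ℤ) (lem₂ a b c d) (ℤₚ.neg-mono-≤ (ℤₚ.<⇒≤ q))
    better : ∀ {t} → LexPos (v ⇢ t) × det (v ⇢ s) (v ⇢ t) ≤ 0ℤ → det (v ⇢ x) (v ⇢ t) ≤ 0ℤ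
    better {t} (t>0 , q) = steeper-trans (v ⇢ x) (v ⇢ s) (v ⇢ t) x>0 (All.lookup ys>0 s∈) t>0
        (swapped (v ⇢ s) (v ⇢ x) p) q

  -- Gift wrapping: the next edge of the upper boundary leads from v to the
  -- steepest point.
  wrap : ∀ n v xs → length xs ℕ.≤ n → All (λ s → LexPos (v ⇢ s)) xs → Chain v (v ∷ xs)
  wrap n v [] _ _ = record
    { last = v ; edges = [] ; first∈ = here refl ; last∈ = here refl
    ; first≤ = λ { (here refl) → LexNonNeg-self v } ; ≤last = λ { (here refl) → LexNonNeg-self v }
    ; edges>0 = [] ; total≡ = ≡.sym (⇢-self v)
    ; bound = λ { u _ (here refl) → ℤₚ.≤-reflexive (≡.sym (ℤₚ.+-identityʳ _)) }
    ; attained = λ u _ → v , here refl , ≡.sym (ℤₚ.+-identityʳ _) }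
  wrap (suc n) v xs₀@(x ∷ xs) (s≤s len) pos>0 with steepest v x xs pos>0
  ... | s , s∈ , s-max = record
    { last = C.last ; edges = f ∷ C.edges ; first∈ = here refl ; last∈ = there (embed C.last∈)
    ; first≤ = λ { (here refl) → LexNonNeg-self v ; (there t∈) → LexPos⇒LexNonNeg (All.lookup pos>0 t∈) }
    ; ≤last = λ { (here refl) → subst LexNonNeg (⇢-trans v s C.last)
          (LexNonNeg-⊞ {f} (LexPos⇒LexNonNeg f>0) (C.≤last (here refl)))
                ; (there t∈) → ≤last t∈ }
    ; edges>0 = f>0 ∷ C.edges>0
    ; total≡ = ≡.trans (cong (f ⊞_) C.total≡) (⇢-trans v s C.last)
    ; bound = bound ; attained = attained }
    where
    f = v ⇢ s
    f>0 : LexPos f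
    f>0 = All.lookup pos>0 s∈
    after = λ t → LexPos? (s ⇢ t)
    -- Points before `s` lie under the edge `f` and are dropped; so is `s` itself, hence the list
    -- gets shorter and the fuel suffices.
    ys = List.filter after xs₀
    self-not : ¬ LexPos (s ⇢ s)
    self-not p = LexPos-asym p (subst LexNonNeg (≡.sym (⊟-⇢ s s)) (LexNonNeg-self s))
    shorter : length ys ℕ.≤ n
    shorter = ℕₚ.≤-trans (ℕₚ.≤-pred (Listₚ.filter-notAll after xs₀ (Any.map (λ { refl → self-not }) s∈))) len
    chain = wrap n s ys shorter (Allₚ.all-filter after xs₀)
    module C = Chain chain
    embed : ∀ {t} → t ∈ s ∷ ys → t ∈ xs₀
    embed (here refl) = s∈
    embed (there t∈)  = proj₁ (∈ₚ.∈-filter⁻ after t∈)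
    locate : ∀ {t} → t ∈ xs₀ → t ∈ ys ⊎ LexNonNeg (t ⇢ s)
    locate {t} t∈ with LexPos-dec (s ⇢ t)
    ... | inj₁ p = inj₁ (∈ₚ.∈-filter⁺ after t∈ p)
    ... | inj₂ p = inj₂ (subst LexNonNeg (⊟-⇢ s t) p)
    ≤last : ∀ {t} → t ∈ xs₀ → LexNonNeg (t ⇢ C.last)
    ≤last {t} t∈ with locate t∈
    ... | inj₁ t∈ys = C.≤last (there t∈ys)
    ... | inj₂ t≤s  = subst LexNonNeg (⇢-trans t s C.last) (LexNonNeg-⊞ {t ⇢ s} t≤s (C.≤last (here refl)))
    uphill : ∀ u → 0ℤ ≤ dot f u → dot v u + (pos (dot f u) + zono C.edges u) ≡ dot s u + zono C.edges u
    uphill u p = ≡.trans (≡.sym (ℤₚ.+-assoc (dot v u) _ _))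
      (cong (_+ zono C.edges u) (≡.trans (cong (λ i → dot v u + i) (pos-≥ p)) (≡.sym (dot-⇢ v s u))))
    -- The rest attains its maximum at some `t`. The vector from `v` to `t` is no steeper than `f`,
    -- hence neither is the one from `s` to `t` (`det-shift`), and it descends together with `f`. So
    -- the maximum is already taken at `s`.
    flat : ∀ u → Upward u → dot f u < 0ℤ → zono C.edges u ≡ 0ℤ
    flat u up neg with C.attained u up
    ... | t , t∈ , eq = ℤₚ.≤-antisym
          (≤-by (≤⇒0≤ (t-below t∈)) (≡.trans (cong (λ i → dot s u - i) eq) (lem (dot s u) (zono C.edges u))))
          (0≤zono C.edges u)
      where
      lem : ∀ a b → a - (a + b) ≡ 0ℤ - b
      lem = solve-∀
      det-shift : ∀ v s t → det (v ⇢ s) (s ⇢ t) ≡ det (v ⇢ s) (v ⇢ t)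
      det-shift (a , b) (c , d) (e , g) = det-lem a b c d e g
        where
        det-lem : ∀ a b c d e g → (c + - a) * (g + - d) - (d + - b) * (e + - c) ≡ (c + - a) * (g + - b) - (d + - b)
            * (e + - a)
        det-lem = solve-∀
      t-below : ∀ {t} → t ∈ s ∷ ys → dot t u ≤ dot s u
      t-below (here refl) = ℤₚ.≤-refl
      t-below {t} (there t∈) = ≤-by (0≤-neg (steeper f (s ⇢ t) u f>0
          (LexNonNeg⇒0≤x (LexPos⇒LexNonNeg (All.lookup (Allₚ.all-filter after xs₀) t∈)))
          (subst (_≤ 0ℤ) (≡.sym (det-shift v s t)) (All.lookup s-max (embed (there t∈)))) up neg))
        (≡.trans (lem₃ (dot s u) (dot (s ⇢ t) u)) (cong (λ i → dot s u - i) (≡.sym (dot-⇢ s t u))))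
        where
        lem₃ : ∀ a b → - b ≡ a - (a + b)
        lem₃ = solve-∀
    downhill : ∀ u → Upward u → dot f u < 0ℤ → dot v u + (pos (dot f u) + zono C.edges u) ≡ dot v u
    downhill u up neg = ≡.trans (cong₂ (λ i j → dot v u + (i + j)) (pos-≤ (ℤₚ.<⇒≤ neg)) (flat u up neg))
        (ℤₚ.+-identityʳ _)
    ≤-shift : ∀ a {b c} → b ≤ c → a + b ≤ a + c
    ≤-shift a = ℤₚ.+-monoʳ-≤ a
    bound : ∀ u → Upward u → ∀ {t} → t ∈ v ∷ xs₀ → dot t u ≤ dot v u + (pos (dot f u) + zono C.edges u)
    bound u up (here refl) = subst (_≤ dot v u + (pos (dot f u) + zono C.edges u)) (ℤₚ.+-identityʳ _)
      (≤-shift (dot v u) (0≤+ (0≤pos (dot f u)) (0≤zono C.edges u)))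
    bound u up {t} (there t∈) with <-or-≥ (dot f u) 0ℤ
    ... | inj₁ neg = subst₂ _≤_ (≡.sym (dot-⇢ v t u)) (≡.trans (ℤₚ.+-identityʳ _) (≡.sym (downhill u up neg)))
            (≤-shift (dot v u) (steeper f (v ⇢ t) u f>0 (LexNonNeg⇒0≤x (LexPos⇒LexNonNeg (All.lookup pos>0 t∈)))
                (All.lookup s-max t∈) up neg))
    ... | inj₂ p with locate t∈
    ...   | inj₁ t∈ys = subst (dot t u ≤_) (≡.sym (uphill u p)) (C.bound u up (there t∈ys))
    -- A dropped point: it lies between `v` and `s` and not above the edge, so `s` beats it in every
    -- direction in which the edge does not descend.
    ...   | inj₂ t≤s  = subst (dot t u ≤_) (≡.sym (uphill u p))
          (ℤₚ.≤-trans t≤ (subst (_≤ dot s u + zono C.edges u) (ℤₚ.+-identityʳ _)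
          (≤-shift (dot s u) (0≤zono C.edges u))))
      where
      t≤ : dot t u ≤ dot s u
      t≤ = subst₂ _≤_ (≡.sym (dot-⇢ v t u)) (≡.sym (dot-⇢ v s u)) (≤-shift (dot v u)
             (under-segment f (v ⇢ t) u (LexPos⇒LexNonNeg (All.lookup pos>0 t∈))
               (subst LexNonNeg (lem v s t) t≤s) (All.lookup s-max t∈) up p))
        where
        lem₁ : ∀ a c e → c + - e ≡ (c + - a) + - (e + - a)
        lem₁ = solve-∀
        lem : ∀ v s t → t ⇢ s ≡ (v ⇢ t) ⇢ (v ⇢ s)
        lem (a , b) (c , d) (e , g) = cong₂ _,_ (lem₁ a c e) (lem₁ b d g)
    attained : ∀ u → Upward u → ∃[ t ] t ∈ v ∷ xs₀ × dot t u ≡ dot v u + (pos (dot f u) + zono C.edges u)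
    attained u up with <-or-≥ (dot f u) 0ℤ
    ... | inj₁ neg = v , here refl , ≡.sym (downhill u up neg)
    ... | inj₂ p with C.attained u up
    ...   | t , t∈ , eq = t , there (embed t∈) , ≡.trans eq (≡.sym (uphill u p))

-- Support functions of lattice polygons and their edge lists.

module Support where
  open ℤ using (ℤ; +_; -[1+_]; 0ℤ; _+_; _*_; _-_; -_; _≤_; _<_)
  open Plane
  open Chains

  support : ∀ {n} → (Fin (suc n) → Pt) → Pt → ℤ
  support {zero}  S u = dot (S zero) u
  support {suc n} S u = dot (S zero) u ℤ.⊔ support (S ∘ suc) u

  support-upper : ∀ {n} (S : Fin (suc n) → Pt) u i → dot (S i) u ≤ support S u
  support-upper {zero}  S u zero    = ℤₚ.≤-refl
  support-upper {suc n} S u zero    = ℤₚ.i≤i⊔j _ _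
  support-upper {suc n} S u (suc i) = ℤₚ.≤-trans (support-upper (S ∘ suc) u i) (ℤₚ.i≤j⊔i (dot (S zero) u) _)

  support-attained : ∀ {n} (S : Fin (suc n) → Pt) u → ∃[ i ] support S u ≡ dot (S i) u
  support-attained {zero}  S u = zero , refl
  support-attained {suc n} S u with ℤₚ.⊔-sel (dot (S zero) u) (support (S ∘ suc) u) | support-attained (S ∘ suc) u
  ... | inj₁ e | _     = zero , e
  ... | inj₂ e | i , f = suc i , ≡.trans e f

  support-unique : ∀ {n} (S : Fin (suc n) → Pt) u {m} →
                   (∀ i → dot (S i) u ≤ m) → (∃[ i ] dot (S i) u ≡ m) → support S u ≡ m
  support-unique S u {m} ub (i , e) with support-attained S u
  ... | j , e′ = ℤₚ.≤-antisym (subst (_≤ m) (≡.sym e′) (ub j)) (subst (_≤ support S u) e (support-upper S u i))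

  leftmost : ∀ x xs → ∃[ v ] v ∈ x ∷ xs × All (λ s → LexNonNeg (v ⇢ s)) (x ∷ xs)
  leftmost x [] = x , here refl , LexNonNeg-self x ∷ []
  leftmost x (y ∷ ys) with leftmost y ys
  ... | v , v∈ , v≤ with LexPos-dec (x ⇢ v)
  ...   | inj₁ x<v = x , here refl , LexNonNeg-self x ∷
                     All.map (λ {s} v≤s → subst LexNonNeg (⇢-trans x v s)
                         (LexNonNeg-⊞ {x ⇢ v} (LexPos⇒LexNonNeg x<v) v≤s)) v≤
  ...   | inj₂ v≤x = v , there v∈ , subst LexNonNeg (⊟-⇢ x v) v≤x ∷ v≤

  LexNonNeg-antisym : ∀ v w → LexNonNeg (v ⇢ w) → LexNonNeg (w ⇢ v) → v ≡ w
  LexNonNeg-antisym v w p q with LexPos? (v ⇢ w)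
  ... | yes r = ⊥-elim (LexPos-asym r (subst LexNonNeg (≡.sym (⊟-⇢ v w)) q))
  ... | no ¬r = zero-diff v w (vanish p ¬r)
    where
    vanish : ∀ {f} → LexNonNeg f → ¬ LexPos f → f ≡ 𝟎
    vanish (inj₁ 0<p) ¬r = ⊥-elim (¬r (inj₁ 0<p))
    vanish {_ , t} (inj₂ (refl , 0≤q)) ¬r = cong (0ℤ ,_) (ℤₚ.≤-antisym (ℤₚ.≮⇒≥ (λ 0<q → ¬r (inj₂ (refl , 0<q)))) 0≤q)
    zero-diff : ∀ v w → v ⇢ w ≡ 𝟎 → v ≡ w
    zero-diff (a , b) (c , d) e = cong₂ _,_ (≡.sym (ℤₚ.i-j≡0⇒i≡j c a (cong proj₁ e)))
        (≡.sym (ℤₚ.i-j≡0⇒i≡j d b (cong proj₂ e)))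

  Chain-resp : ∀ {v xs ys} → (∀ {s} → s ∈ xs → s ∈ ys) → (∀ {s} → s ∈ ys → s ∈ xs) → Chain v xs → Chain v ys
  Chain-resp to from c = record
    { last = last ; edges = edges ; first∈ = to first∈ ; last∈ = to last∈
    ; first≤ = first≤ ∘ from ; ≤last = ≤last ∘ from ; edges>0 = edges>0 ; total≡ = total≡
    ; bound = λ u up → bound u up ∘ from
    ; attained = λ u up → let s , s∈ , e = attained u up in s , to s∈ , e }
    where open Chain c

  upper-chain : ∀ x xs → ∃[ v ] Chain v (x ∷ xs)
  upper-chain x xs with leftmost x xs
  ... | v , v∈ , v≤ = v , Chain-resp to from (wrap _ v ys ℕₚ.≤-refl (Allₚ.all-filter right (x ∷ xs)))
    where
    right = λ t → LexPos? (v ⇢ t)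
    ys = List.filter right (x ∷ xs)
    to : ∀ {s} → s ∈ v ∷ ys → s ∈ x ∷ xs
    to (here refl) = v∈
    to (there s∈)  = proj₁ (∈ₚ.∈-filter⁻ right s∈)
    from : ∀ {s} → s ∈ x ∷ xs → s ∈ v ∷ ys
    from {s} s∈ with LexPos-dec (v ⇢ s)
    ... | inj₁ p = there (∈ₚ.∈-filter⁺ right s∈ p)
    ... | inj₂ q = here (≡.sym (LexNonNeg-antisym v s (All.lookup v≤ s∈) (subst LexNonNeg (⊟-⇢ v s) q)))

  -- H is the support function of the polygon with leftmost (lowest) vertex base
  -- whose upper and lower boundaries consist of the edge vectors up and lo, all
  -- directed to the right.
  record Boundary (H : Pt → ℤ) : Set where
    field
      base   : Pt
      up lo  : List Pt
      up>0   : All LexPos up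
      lo>0   : All LexPos lo
      closed : total up ≡ total lo
      upper  : ∀ u → Upward u → H u ≡ dot base u + zono up u
      lower  : ∀ u → Upward (⊟ u) → H u ≡ dot base u + zono lo u

  -- Reflecting a zonotope is translating it by minus its `total`. Hence the lower boundary can also
  -- be described by edges directed to the right.
  zono-⊟ : ∀ F u → zono F (⊟ u) ≡ zono F u - dot (total F) u
  zono-⊟ []      u = refl
  zono-⊟ (f ∷ F) u = ≡.trans (cong₂ _+_ (≡.trans (cong pos (dot-⊟ʳ f u)) (pos-neg (dot f u))) (zono-⊟ F u))
    (≡.trans (lem (pos (dot f u)) (dot f u) (zono F u) (dot (total F) u))
             (cong (λ i → pos (dot f u) + zono F u - i) (≡.sym (dot-⊞ˡ f (total F) u))))
    where
    lem : ∀ a b c d → a - b + (c - d) ≡ a + c - (b + d)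
    lem = solve-∀

  dot-⊟⊟ : ∀ z u → dot (⊟ z) (⊟ u) ≡ dot z u
  dot-⊟⊟ z u = ≡.trans (dot-⊟ˡ z (⊟ u)) (≡.trans (cong -_ (dot-⊟ʳ z u)) (ℤₚ.neg-involutive _))

  abstract
    -- The lower boundary is the upper hull of -S. Reflection turns its edges to the left and
    -- reading it from the other end turns them back, so the same vectors serve as lower edges.
    boundary : ∀ {n} (S : Fin (suc n) → Pt) → Boundary (support S)
    boundary S with upper-chain (S zero) (tabulate (S ∘ suc)) | upper-chain (⊟ S zero) (tabulate (λ i → ⊟ S (suc i)))
    ... | v , c | v′ , c′ = record
      { base = v ; up = C.edges ; lo = C′.edges ; up>0 = C.edges>0 ; lo>0 = C′.edges>0
      ; closed = ≡.trans C.total≡ (≡.sym (≡.trans C′.total≡ (≡.trans (cong₂ _⇢_ first′ last′) (lem C.last v))))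
      ; upper = upper
      ; lower = λ u down → ≡.trans (lower u down) (lower-lem u) }
      where
      module C = Chain c
      module C′ = Chain c′
      upper : ∀ u → Upward u → support S u ≡ dot v u + zono C.edges u
      upper u up with C.attained u up
      ... | s , s∈ , e with ∈ₚ.∈-tabulate⁻ {f = S} s∈
      ...   | i , refl = support-unique S u (λ i → C.bound u up (∈ₚ.∈-tabulate⁺ {f = S} i)) (i , e)
      v′≡ : ∃[ i ] v′ ≡ ⊟ S i
      v′≡ = ∈ₚ.∈-tabulate⁻ {f = ⊟_ ∘ S} C′.first∈
      last′≡ : ∃[ i ] C′.last ≡ ⊟ S i
      last′≡ = ∈ₚ.∈-tabulate⁻ {f = ⊟_ ∘ S} C′.last∈
      flip : ∀ v w → ⊟ v ⇢ ⊟ w ≡ w ⇢ v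
      flip (a , b) (c , d) = cong₂ _,_ (flip-lem a c) (flip-lem b d)
        where
        flip-lem : ∀ a c → - c + - (- a) ≡ a + - c
        flip-lem = solve-∀
      extreme : ∀ {w} → w ∈ tabulate S → ∃[ i ] w ≡ S i
      extreme = ∈ₚ.∈-tabulate⁻
      -- Reflection reverses the lexicographic order, so the two hulls share their ends.
      first′ : v′ ≡ ⊟ C.last
      first′ with v′≡ | extreme C.last∈
      ... | i , e | j , e′ = ≡.trans e (cong ⊟_ (LexNonNeg-antisym (S i) C.last (C.≤last (∈ₚ.∈-tabulate⁺ {f = S} i))
            (subst LexNonNeg (≡.trans (cong₂ _⇢_ e (cong ⊟_ (≡.sym e′))) (flip (S i) C.last))
                (C′.first≤ (∈ₚ.∈-tabulate⁺ {f = ⊟_ ∘ S} j)))))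
      last′ : C′.last ≡ ⊟ v
      last′ with last′≡ | extreme C.first∈
      ... | i , e | j , e′ = ≡.trans e
            (cong ⊟_ (≡.sym (LexNonNeg-antisym v (S i) (C.first≤ (∈ₚ.∈-tabulate⁺ {f = S} i))
            (subst LexNonNeg (≡.trans (cong₂ _⇢_ (cong ⊟_ (≡.sym e′)) e) (flip v (S i)))
                (C′.≤last (∈ₚ.∈-tabulate⁺ {f = ⊟_ ∘ S} j))))))
      lem : ∀ a b → ⊟ a ⇢ ⊟ b ≡ b ⇢ a
      lem = flip
      lower : ∀ u → Upward (⊟ u) → support S u ≡ dot v′ (⊟ u) + zono C′.edges (⊟ u)
      lower u down with C′.attained (⊟ u) down
      ... | s , s∈ , e with ∈ₚ.∈-tabulate⁻ {f = ⊟_ ∘ S} s∈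
      ...   | i , refl = support-unique S u
              (λ i → subst (_≤ _) (dot-⊟⊟ (S i) u) (C′.bound (⊟ u) down (∈ₚ.∈-tabulate⁺ {f = ⊟_ ∘ S} i)))
              (i , ≡.trans (≡.sym (dot-⊟⊟ (S i) u)) e)
      lower-lem : ∀ u → dot v′ (⊟ u) + zono C′.edges (⊟ u) ≡ dot v u + zono C′.edges u
      lower-lem u = ≡.trans (cong₂ _+_ (≡.trans (cong (λ w → dot w (⊟ u)) first′) (dot-⊟⊟ C.last u))
          (zono-⊟ C′.edges u))
        (≡.trans (cong (λ w → dot C.last u + (zono C′.edges u - dot w u))
            (≡.trans C′.total≡ (≡.trans (cong₂ _⇢_ first′ last′) (lem C.last v))))
          (≡.trans (cong (_+ (zono C′.edges u - dot (v ⇢ C.last) u)) (dot-⇢ v C.last u))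
              (lem₂ (dot v u) (dot (v ⇢ C.last) u) (zono C′.edges u))))
        where
        lem₂ : ∀ a b c → a + b + (c - b) ≡ a + c
        lem₂ = solve-∀

  total-++ : ∀ F G → total (F ++ G) ≡ total F ⊞ total G
  total-++ [] G = cong₂ _,_ (≡.sym (ℤₚ.+-identityˡ _)) (≡.sym (ℤₚ.+-identityˡ _))
  total-++ (f ∷ F) G = ≡.trans (cong (f ⊞_) (total-++ F G))
      (cong₂ _,_ (≡.sym (ℤₚ.+-assoc (proj₁ f) _ _)) (≡.sym (ℤₚ.+-assoc (proj₂ f) _ _)))

  zono-++ : ∀ F G u → zono (F ++ G) u ≡ zono F u + zono G u
  zono-++ []      G u = ≡.sym (ℤₚ.+-identityˡ _)
  zono-++ (f ∷ F) G u = ≡.trans (cong (λ i → pos (dot f u) + i) (zono-++ F G u))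
      (≡.sym (ℤₚ.+-assoc (pos (dot f u)) _ _))

  module _ where
    open Boundary

    boundary-resp : ∀ {H H′} → (∀ u → H u ≡ H′ u) → Boundary H → Boundary H′
    boundary-resp eq B = record
      { base = base B ; up = up B ; lo = lo B ; up>0 = up>0 B ; lo>0 = lo>0 B ; closed = closed B
      ; upper = λ u p → ≡.trans (≡.sym (eq u)) (upper B u p)
      ; lower = λ u p → ≡.trans (≡.sym (eq u)) (lower B u p) }

    boundary-+ : ∀ {H H′} → Boundary H → Boundary H′ → Boundary (λ u → H u + H′ u)
    boundary-+ {H} {H′} B C = record
      { base = base B ⊞ base C ; up = up B ++ up C ; lo = lo B ++ lo C
      ; up>0 = Allₚ.++⁺ (up>0 B) (up>0 C) ; lo>0 = Allₚ.++⁺ (lo>0 B) (lo>0 C)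
      ; closed = ≡.trans (total-++ (up B) (up C))
            (≡.trans (cong₂ _⊞_ (closed B) (closed C)) (≡.sym (total-++ (lo B) (lo C))))
      ; upper = λ u p → combine u (up B) (up C) (upper B u p) (upper C u p)
      ; lower = λ u p → combine u (lo B) (lo C) (lower B u p) (lower C u p) }
      where
      lem : ∀ a b c d → a + b + (c + d) ≡ a + c + (b + d)
      lem = solve-∀
      combine : ∀ u F G → H u ≡ dot (base B) u + zono F u → H′ u ≡ dot (base C) u + zono G u →
                H u + H′ u ≡ dot (base B ⊞ base C) u + zono (F ++ G) u
      combine u F G e e′ = ≡.trans (cong₂ _+_ e e′)
          (≡.trans (lem (dot (base B) u) (zono F u) (dot (base C) u) (zono G u))
        (cong₂ _+_ (≡.sym (dot-⊞ˡ (base B) (base C) u)) (≡.sym (zono-++ F G u))))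

    boundary-shift : ∀ {H} v → Boundary H → Boundary (λ u → dot v u + H u)
    boundary-shift {H} v B = record
      { base = v ⊞ base B ; up = up B ; lo = lo B ; up>0 = up>0 B ; lo>0 = lo>0 B ; closed = closed B
      ; upper = λ u p → shift u (up B) (upper B u p)
      ; lower = λ u p → shift u (lo B) (lower B u p) }
      where
      shift : ∀ u F → H u ≡ dot (base B) u + zono F u → dot v u + H u ≡ dot (v ⊞ base B) u + zono F u
      shift u F e = ≡.trans (cong (λ i → dot v u + i) e) (≡.trans (≡.sym (ℤₚ.+-assoc (dot v u) _ _))
        (cong (_+ zono F u) (≡.sym (dot-⊞ˡ v (base B) u))))

    boundary-⊟ : ∀ {H} → Boundary H → Boundary (H ∘ ⊟_)
    boundary-⊟ {H} B = record
      -- The leftmost vertex of -P is minus the rightmost vertex of P.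
      { base = ⊟ (base B ⊞ total (up B)) ; up = lo B ; lo = up B ; up>0 = lo>0 B ; lo>0 = up>0 B ; closed = ≡.sym
            (closed B)
      ; upper = λ u p → flip u (lo B) (≡.sym (closed B)) (lower B (⊟ u) (subst Upward (≡.sym (⊟-involutive u)) p))
      ; lower = λ u p → flip u (up B) refl (upper B (⊟ u) p) }
      where
      lem : ∀ a b z → - a + (z - b) ≡ - (a + b) + z
      lem = solve-∀
      flip : ∀ u F → total F ≡ total (up B) → H (⊟ u) ≡ dot (base B) (⊟ u) + zono F (⊟ u) →
             H (⊟ u) ≡ dot (⊟ (base B ⊞ total (up B))) u + zono F u
      flip u F eq e = ≡.trans e (≡.trans
          (cong₂ _+_ (dot-⊟ʳ (base B) u) (≡.trans (zono-⊟ F u) (cong (λ w → zono F u - dot w u) eq)))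
        (≡.trans (lem (dot (base B) u) (dot (total (up B)) u) (zono F u))
          (cong (_+ zono F u) (≡.sym (≡.trans (dot-⊟ˡ (base B ⊞ total (up B)) u)
              (cong -_ (dot-⊞ˡ (base B) (total (up B)) u)))))))

  -- The maps (x,y) ↦ (αx, γx + δy) with α, δ > 0 keep the order of edges.
  record Triangular : Set where
    field
      α γ δ : ℤ
      0<α   : 0ℤ < α
      0<δ   : 0ℤ < δ

    apply transpose : Pt → Pt
    apply     (x , y) = (α * x , γ * x + δ * y)
    transpose (a , b) = (α * a + γ * b , δ * b)

    dot-apply : ∀ z u → dot (apply z) u ≡ dot z (transpose u)
    dot-apply (x , y) (a , b) = lem α γ δ x y a b
      where
      lem : ∀ α γ δ x y a b → (α * x) * a + (γ * x + δ * y) * b ≡ x * (α * a + γ * b) + y * (δ * b)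
      lem = solve-∀

    det-apply : ∀ z w → det (apply z) (apply w) ≡ (α * δ) * det z w
    det-apply (x , y) (a , b) = lem α γ δ x y a b
      where
      lem : ∀ α γ δ x y a b → (α * x) * (γ * a + δ * b) - (γ * x + δ * y) * (α * a) ≡ (α * δ) * (x * b - y * a)
      lem = solve-∀

    apply-⊞ : ∀ z w → apply (z ⊞ w) ≡ apply z ⊞ apply w
    apply-⊞ (x , y) (a , b) = cong₂ _,_ (lem₁ α x a) (lem₂ γ δ x y a b)
      where
      lem₁ : ∀ α x a → α * (x + a) ≡ α * x + α * a
      lem₁ = solve-∀
      lem₂ : ∀ γ δ x y a b → γ * (x + a) + δ * (y + b) ≡ (γ * x + δ * y) + (γ * a + δ * b)
      lem₂ = solve-∀

    apply-LexPos : ∀ {f} → LexPos f → LexPos (apply f)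
    apply-LexPos (inj₁ 0<p) = inj₁ (0<* 0<α 0<p)
    apply-LexPos (inj₂ (refl , 0<q)) = inj₂ (ℤₚ.*-zeroʳ α , subst (0ℤ <_) (≡.sym (lem γ (δ * _))) (0<* 0<δ 0<q))
      where
      lem : ∀ γ i → γ * 0ℤ + i ≡ i
      lem = solve-∀

    transpose-Upward : ∀ {u} → Upward u → Upward (transpose u)
    transpose-Upward p = 0≤* (ℤₚ.<⇒≤ 0<δ) p

    total-apply : ∀ F → total (map apply F) ≡ apply (total F)
    total-apply [] = cong₂ _,_ (≡.sym (ℤₚ.*-zeroʳ α)) (≡.sym (≡.trans (cong₂ _+_ (ℤₚ.*-zeroʳ γ) (ℤₚ.*-zeroʳ δ)) refl))
    total-apply (f ∷ F) = ≡.trans (cong (apply f ⊞_) (total-apply F)) (≡.sym (apply-⊞ f (total F)))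

    zono-apply : ∀ F u → zono (map apply F) u ≡ zono F (transpose u)
    zono-apply []      u = refl
    zono-apply (f ∷ F) u = cong₂ _+_ (cong pos (dot-apply f u)) (zono-apply F u)

    boundary-apply : ∀ {H} → Boundary H → Boundary (H ∘ transpose)
    boundary-apply {H} B = record
      { base = apply base ; up = map apply up ; lo = map apply lo
      ; up>0 = Allₚ.map⁺ (All.map (λ {f} → apply-LexPos {f}) up>0) ; lo>0 = Allₚ.map⁺
            (All.map (λ {f} → apply-LexPos {f}) lo>0)
      ; closed = ≡.trans (total-apply up) (≡.trans (cong apply closed) (≡.sym (total-apply lo)))
      ; upper = λ u p → ≡.trans (upper (transpose u) (transpose-Upward {u} p)) (back u up)
      ; lower = λ u p → ≡.trans (lower (transpose u)
            (subst (0ℤ ≤_) (≡.sym (ℤₚ.neg-distribʳ-* δ (proj₂ u))) (transpose-Upward {⊟ u} p))) (back u lo) }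
      where
      open Boundary B
      back : ∀ u F → dot base (transpose u) + zono F (transpose u) ≡ dot (apply base) u + zono (map apply F) u
      back u F = ≡.sym (cong₂ _+_ (dot-apply base u) (zono-apply F u))

-- Lattice length, area of edge lists, and lattice points under one edge.

module Pick where
  open ℤ using (ℤ; +_; 0ℤ; 1ℤ; _+_; _*_; _-_; -_; _≤_; _<_; +≤+; ∣_∣)
  open import Data.Nat.Divisibility using (_∣_; _∣?_; divides; ∣-trans; ∣m∣n⇒∣m+n; ∣m+n∣m⇒∣n; ∣-refl; *-monoˡ-∣; *-cancelʳ-∣; m∣m*n; _∣0; ∣⇒≤)
  open import Data.Nat.GCD using (gcd; gcd[m,n]∣m; gcd[m,n]∣n; c*gcd[m,n]≡gcd[cm,cn])
  open import Data.Nat.Coprimality using (Coprime; coprime-divisor; gcd≡1⇒coprime)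
  open Plane
  open Chains
  open Support

  -- The lattice length of an edge vector.
  content : Pt → ℕ
  content (p , q) = gcd ∣ p ∣ ∣ q ∣

  perimeter : List Pt → ℕ
  perimeter []      = 0
  perimeter (f ∷ F) = content f ℕ.+ perimeter F

  -- The absolute values make `cross` and `area` invariant under permutations, so the area can be
  -- read off an unsorted edge list. In a list sorted by slope all these determinants have the same
  -- sign.
  cross : Pt → List Pt → ℕ
  cross f []      = 0
  cross f (g ∷ G) = ∣ det f g ∣ ℕ.+ cross f G

  -- Twice the area between a chain with edges F and its chord.
  area : List Pt → ℕ
  area []      = 0
  area (f ∷ F) = cross f F ℕ.+ area F

  module _ where
    open import Algebra.Properties.CommutativeSemigroup ℕₚ.+-commutativeSemigroup using (x∙yz≈y∙xz; interchange)

    cross-↭ : ∀ f {F G} → F ↭ G → cross f F ≡ cross f G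
    cross-↭ f Perm.refl         = refl
    cross-↭ f (prep g p)        = cong (∣ det f g ∣ ℕ.+_) (cross-↭ f p)
    cross-↭ f (swap {F} {G} g h p) = ≡.trans (x∙yz≈y∙xz ∣ det f g ∣ ∣ det f h ∣ (cross f F))
                                        (cong (λ i → ∣ det f h ∣ ℕ.+ (∣ det f g ∣ ℕ.+ i)) (cross-↭ f p))
    cross-↭ f (Perm.trans p q)  = ≡.trans (cross-↭ f p) (cross-↭ f q)

    perimeter-↭ : ∀ {F G} → F ↭ G → perimeter F ≡ perimeter G
    perimeter-↭ Perm.refl        = refl
    perimeter-↭ (prep g p)       = cong (content g ℕ.+_) (perimeter-↭ p)
    perimeter-↭ (swap {F} {_} g h p) = ≡.trans (x∙yz≈y∙xz (content g) (content h) (perimeter F))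
                                           (cong (λ i → content h ℕ.+ (content g ℕ.+ i)) (perimeter-↭ p))
    perimeter-↭ (Perm.trans p q) = ≡.trans (perimeter-↭ p) (perimeter-↭ q)

    area-↭ : ∀ {F G} → F ↭ G → area F ≡ area G
    area-↭ Perm.refl            = refl
    area-↭ (prep g p)           = cong₂ ℕ._+_ (cross-↭ g p) (area-↭ p)
    area-↭ (swap {F} {G} g h p) = ≡.trans
      (cong₂ (λ i j → i ℕ.+ cross g F ℕ.+ (cross h F ℕ.+ j)) (∣det∣-comm g h) (area-↭ p))
      (≡.trans (cong₂ (λ i j → ∣ det h g ∣ ℕ.+ i ℕ.+ (j ℕ.+ area G)) (cross-↭ g p) (cross-↭ h p))
        (lem (∣ det h g ∣) (cross g G) (cross h G) (area G)))
      where
      lem : ∀ d a b c → d ℕ.+ a ℕ.+ (b ℕ.+ c) ≡ d ℕ.+ b ℕ.+ (a ℕ.+ c)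
      lem d a b c = interchange d a b c
      det-lem : ∀ a b c d → - (a * d - b * c) ≡ c * b - d * a
      det-lem = solve-∀
      ∣det∣-comm : ∀ f g → ∣ det f g ∣ ≡ ∣ det g f ∣
      ∣det∣-comm (a , b) (c , d) = ≡.trans (≡.sym (ℤₚ.∣-i∣≡∣i∣ (a * d - b * c))) (cong ∣_∣ (det-lem a b c d))
    area-↭ (Perm.trans p q)     = ≡.trans (area-↭ p) (area-↭ q)

    zono-↭ : ∀ {F G} u → F ↭ G → zono F u ≡ zono G u
    zono-↭ u Perm.refl        = refl
    zono-↭ u (prep g p)       = cong (λ i → pos (dot g u) + i) (zono-↭ u p)
    zono-↭ u (swap {F} {_} g h p) = ≡.trans (lem (pos (dot g u)) (pos (dot h u)) (zono F u))
                                        (cong (λ i → pos (dot h u) + (pos (dot g u) + i)) (zono-↭ u p))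
      where
      lem : ∀ a b c → a + (b + c) ≡ b + (a + c)
      lem = solve-∀
    zono-↭ u (Perm.trans p q) = ≡.trans (zono-↭ u p) (zono-↭ u q)

    total-↭ : ∀ {F G} → F ↭ G → total F ≡ total G
    total-↭ Perm.refl        = refl
    total-↭ (prep g p)       = cong (g ⊞_) (total-↭ p)
    total-↭ (swap {F} {_} g h p) = ≡.trans (lem g h (total F)) (cong (λ w → h ⊞ (g ⊞ w)) (total-↭ p))
      where
      lem₁ : ∀ a b c → a + (b + c) ≡ b + (a + c)
      lem₁ = solve-∀
      lem : ∀ a b c → a ⊞ (b ⊞ c) ≡ b ⊞ (a ⊞ c)
      lem (a , a′) (b , b′) (c , c′) = cong₂ _,_ (lem₁ a b c) (lem₁ a′ b′ c′)
    total-↭ (Perm.trans p q) = ≡.trans (total-↭ p) (total-↭ q)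

  Steep : Pt → Pt → Set
  Steep f g = det f g ≤ 0ℤ

  Steep-total : ∀ f g → ¬ Steep f g → Steep g f
  Steep-total (a , b) (c , d) ¬fg = subst (_≤ 0ℤ) (lem a b c d) (ℤₚ.neg-mono-≤ (ℤₚ.<⇒≤ (ℤₚ.≰⇒> ¬fg)))
    where
    lem : ∀ a b c d → - (a * d - b * c) ≡ c * b - d * a
    lem = solve-∀

  insert : ∀ f F → LexPos f → All LexPos F → AllPairs Steep F → ∃[ G ] G ↭ f ∷ F × AllPairs Steep G
  insert f [] f>0 _ _ = f ∷ [] , ↭-refl , [] ∷ []
  insert f (g ∷ F) f>0 (g>0 ∷ F>0) (gF ∷ FF) with det f g ℤₚ.≤? 0ℤ
  ... | yes fg = f ∷ g ∷ F , ↭-refl ,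
        (fg ∷ All.zipWith (λ {h} (h>0 , gh) → steeper-trans f g h f>0 g>0 h>0 fg gh) (F>0 , gF)) ∷ gF ∷ FF
  ... | no ¬fg with insert f F f>0 F>0 FF
  ...   | G , G↭ , GG = g ∷ G , ↭-trans (prep g G↭) (swap g f ↭-refl) ,
          Permₚ.All-resp-↭ (↭-sym G↭) (Steep-total f g ¬fg ∷ gF) ∷ GG

  sort : ∀ F → All LexPos F → ∃[ G ] G ↭ F × AllPairs Steep G
  sort [] [] = [] , ↭-refl , []
  sort (f ∷ F) (f>0 ∷ F>0) with sort F F>0
  ... | G , G↭F , GG with insert f G f>0 (Permₚ.All-resp-↭ (↭-sym G↭F) F>0) GG
  ...   | E , E↭ , EE = E , ↭-trans E↭ (prep f G↭F) , EE

  sumTo : ℕ → (ℕ → ℤ) → ℤ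
  sumTo zero    f = 0ℤ
  sumTo (suc n) f = sumTo n f + f n

  sumTo-cong : ∀ n {f g} → (∀ i → i ℕ.< n → f i ≡ g i) → sumTo n f ≡ sumTo n g
  sumTo-cong zero    eq = refl
  sumTo-cong (suc n) eq = cong₂ _+_ (sumTo-cong n λ i i<n → eq i (ℕₚ.m<n⇒m<1+n i<n)) (eq n ℕₚ.≤-refl)

  sumTo-+ : ∀ n f g → sumTo n (λ i → f i + g i) ≡ sumTo n f + sumTo n g
  sumTo-+ zero    f g = refl
  sumTo-+ (suc n) f g = ≡.trans (cong (_+ (f n + g n)) (sumTo-+ n f g)) (lem (sumTo n f) (sumTo n g) (f n) (g n))
    where
    lem : ∀ a b c d → a + b + (c + d) ≡ a + c + (b + d)
    lem = solve-∀

  sumTo-const : ∀ n c → sumTo n (λ _ → c) ≡ + n * c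
  sumTo-const zero    c = ≡.sym (ℤₚ.*-zeroˡ c)
  sumTo-const (suc n) c = ≡.trans (cong (_+ c) (sumTo-const n c)) (lem (+ n) c)
    where
    lem : ∀ n c → n * c + c ≡ (1ℤ + n) * c
    lem = solve-∀

  sumTo-split : ∀ m n f → sumTo (m ℕ.+ n) f ≡ sumTo m f + sumTo n (λ i → f (m ℕ.+ i))
  sumTo-split m zero    f = ≡.trans (cong (λ i → sumTo i f) (ℕₚ.+-identityʳ m)) (≡.sym (ℤₚ.+-identityʳ _))
  sumTo-split m (suc n) f = ≡.trans (cong (λ i → sumTo i f) (ℕₚ.+-suc m n))
    (≡.trans (cong (_+ f (m ℕ.+ n)) (sumTo-split m n f)) (ℤₚ.+-assoc (sumTo m f) _ _))

  sumTo-reverse : ∀ n f → sumTo (suc n) (λ i → f (n ℕ.∸ i)) ≡ sumTo (suc n) f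
  sumTo-reverse zero    f = refl
  sumTo-reverse (suc n) f = ≡.trans (sumTo-split 1 (suc n) (λ i → f (suc n ℕ.∸ i)))
    (≡.trans (cong (λ i → 0ℤ + f (suc n) + i) (sumTo-reverse n f)) (lem (f (suc n)) (sumTo (suc n) f)))
    where
    lem : ∀ a b → 0ℤ + a + b ≡ b + a
    lem = solve-∀

  -- The divisor is `suc p`, so it is visibly nonzero.
  floor : ℕ → ℤ → ℤ
  floor p a = a ℤ/./ℕ suc p

  floor-≤ : ∀ p a → + suc p * floor p a ≤ a
  floor-≤ p a = ≤-by (+≤+ (z≤n {a ℤ/.%ℕ suc p})) (≡.trans (lem (+ (a ℤ/.%ℕ suc p)) (floor p a) (+ suc p))
    (cong (_- + suc p * floor p a) (≡.sym (ℤ/.a≡a%ℕn+[a/ℕn]*n a (suc p)))))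
    where
    lem : ∀ r f p → r ≡ r + f * p - p * f
    lem = solve-∀

  floor-< : ∀ p a → a < + suc p * (floor p a + 1ℤ)
  floor-< p a = subst (a <_) (lem (floor p a) (+ suc p)) (ℤ/.n<s[n/ℕd]*d a (suc p))
    where
    lem : ∀ f p → (1ℤ + f) * p ≡ p * (f + 1ℤ)
    lem = solve-∀

  below⇒≤floor : ∀ p a y → + suc p * y ≤ a → y ≤ floor p a
  below⇒≤floor p a y le with <-or-≥ (floor p a) y
  ... | inj₂ q = q
  ... | inj₁ q = ⊥-elim (ℤₚ.<⇒≱ (floor-< p a)
        (ℤₚ.≤-trans (ℤₚ.*-monoˡ-≤-nonNeg (+ suc p) (subst (_≤ y) (ℤₚ.+-comm 1ℤ (floor p a)) (ℤₚ.i<j⇒suc[i]≤j q))) le))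

  ≤floor⇒below : ∀ p a y → y ≤ floor p a → + suc p * y ≤ a
  ≤floor⇒below p a y le = ℤₚ.≤-trans (ℤₚ.*-monoˡ-≤-nonNeg (+ suc p) le) (floor-≤ p a)

  floor-unique : ∀ p a k → + suc p * k ≤ a → a < + suc p * (k + 1ℤ) → floor p a ≡ k
  floor-unique p a k lo hi = ℤₚ.≤-antisym
    (≤-by (<⇒1≤ (ℤₚ.*-cancelˡ-<-nonNeg (+ suc p) (ℤₚ.≤-<-trans (floor-≤ p a) hi))) (lem (floor p a) k))
    (below⇒≤floor p a k lo)
    where
    lem : ∀ f k → k + 1ℤ - f - 1ℤ ≡ k - f
    lem = solve-∀

  𝟙 : ∀ {P : Set} → Dec P → ℤ
  𝟙 (yes _) = 1ℤ
  𝟙 (no _)  = 0ℤ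

  𝟙-cong : ∀ {P Q : Set} (p : Dec P) (q : Dec Q) → (P → Q) → (Q → P) → 𝟙 p ≡ 𝟙 q
  𝟙-cong (yes p) (yes q) _ _ = refl
  𝟙-cong (no p)  (no q)  _ _ = refl
  𝟙-cong (yes p) (no q)  f _ = ⊥-elim (q (f p))
  𝟙-cong (no p)  (yes q) _ g = ⊥-elim (p (g q))

  𝟙-yes : ∀ {P : Set} (p : Dec P) → P → 𝟙 p ≡ 1ℤ
  𝟙-yes (yes _) _ = refl
  𝟙-yes (no ¬p) p = ⊥-elim (¬p p)

  𝟙-no : ∀ {P : Set} (p : Dec P) → ¬ P → 𝟙 p ≡ 0ℤ
  𝟙-no (no _)  _  = refl
  𝟙-no (yes p) ¬p = ⊥-elim (¬p p)

  multiples : ∀ p g → sumTo (g ℕ.* suc p) (λ i → 𝟙 (suc p ∣? i)) ≡ + g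
  multiples p zero    = refl
  multiples p (suc g) = ≡.trans (sumTo-split (suc p) (g ℕ.* suc p) (λ i → 𝟙 (suc p ∣? i)))
    (cong₂ _+_ first (≡.trans (sumTo-cong (g ℕ.* suc p) λ i _ →
        𝟙-cong (suc p ∣? suc p ℕ.+ i) (suc p ∣? i) (λ d → ∣m+n∣m⇒∣n d ∣-refl) (∣m∣n⇒∣m+n ∣-refl))
      (multiples p g)))
    where
    first : sumTo (suc p) (λ i → 𝟙 (suc p ∣? i)) ≡ 1ℤ
    first = ≡.trans (sumTo-split 1 p (λ i → 𝟙 (suc p ∣? i))) (cong₂ (λ i j → 0ℤ + i + j)
      (𝟙-yes (suc p ∣? 0) (suc p ∣0))
      (≡.trans (sumTo-cong p λ i i<p → 𝟙-no (suc p ∣? suc i) λ d → ℕₚ.<⇒≱ (s≤s i<p) (∣⇒≤ d))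
               (≡.trans (sumTo-const p 0ℤ) (ℤₚ.*-zeroʳ (+ p)))))

  -- Let g be the gcd and `suc p` = `suc p′` g. Cancelling g turns the condition into `suc p′ ∣ i`,
  -- by coprimality, and this holds once in each of the g periods.
  count≡gcd : ∀ p q → sumTo (suc p) (λ i → 𝟙 (suc p ∣? i ℕ.* q)) ≡ + gcd (suc p) q
  count≡gcd p q with gcd[m,n]∣m (suc p) q | gcd[m,n]∣n (suc p) q
  ... | divides (suc p′) e | divides q′ e′ = ≡.trans
      (cong (λ n → sumTo n (λ i → 𝟙 (suc p ∣? i ℕ.* q))) (≡.trans e (ℕₚ.*-comm (suc p′) g)))
      (≡.trans (sumTo-cong (g ℕ.* suc p′) λ i _ → 𝟙-cong (suc p ∣? i ℕ.* q) (suc p′ ∣? i) (to i) (from i))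
               (multiples p′ g))
    where
    g = gcd (suc p) q
    instance
      g≢0 : ℕ.NonZero g
      g≢0 = ℕ.≢-nonZero λ g≡0 → ℕₚ.1+n≢0 (≡.trans e (≡.trans (cong (suc p′ ℕ.*_) g≡0) (ℕₚ.*-zeroʳ (suc p′))))
    coprime : Coprime (suc p′) q′
    coprime = gcd≡1⇒coprime (ℕₚ.*-cancelˡ-≡ (gcd (suc p′) q′) 1 g (≡.trans (c*gcd[m,n]≡gcd[cm,cn] g (suc p′) q′)
      (≡.trans (cong₂ gcd (≡.trans (ℕₚ.*-comm g (suc p′)) (≡.sym e)) (≡.trans (ℕₚ.*-comm g q′) (≡.sym e′)))
          (≡.sym (ℕₚ.*-identityʳ g)))))
    iq : ∀ i → i ℕ.* q ≡ i ℕ.* q′ ℕ.* g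
    iq i = ≡.trans (cong (i ℕ.*_) e′) (≡.sym (ℕₚ.*-assoc i q′ g))
    to : ∀ i → suc p ∣ i ℕ.* q → suc p′ ∣ i
    to i d = coprime-divisor coprime (subst (suc p′ ∣_) (ℕₚ.*-comm i q′) (*-cancelʳ-∣ g (subst₂ _∣_ e (iq i) d)))
    from : ∀ i → suc p′ ∣ i → suc p ∣ i ℕ.* q
    from i d = subst₂ _∣_ (≡.sym e) (≡.sym (iq i)) (*-monoˡ-∣ g (∣-trans d (m∣m*n q′)))

  -- The floors of x and q - x add up to q if x is an integer and to q - 1 otherwise; here x = iq/(p
  -- + 1).
  floor-pair : ∀ p q i → i ℕ.≤ suc p →
               floor p (+ i * q) + floor p (+ (suc p ℕ.∸ i) * q) ≡ q - 1ℤ + 𝟙 (suc p ∣? i ℕ.* ∣ q ∣)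
  floor-pair p q i i≤p with suc p ∣? i ℕ.* ∣ q ∣
  ... | yes d = ≡.trans (cong₂ _+_ fl fl′) (lem k q)
    where
    open import Data.Integer.Divisibility.Signed using (∣ᵤ⇒∣) renaming (_∣_ to _∣ℤ_; quotient to quotientℤ)
    d′ : + suc p ∣ℤ + i * q
    d′ = ∣ᵤ⇒∣ (subst (suc p ∣_) (≡.sym (ℤₚ.abs-* (+ i) q)) d)
    k = quotientℤ d′
    eq : + i * q ≡ k * + suc p
    eq = _∣ℤ_.equality d′
    lem : ∀ k q → k + (q - k) ≡ q - 1ℤ + 1ℤ
    lem = solve-∀
    exact : ∀ a k → a ≡ + suc p * k → floor p a ≡ k
    exact a k refl = floor-unique p _ k ℤₚ.≤-refl (ℤₚ.*-monoˡ-<-pos (+ suc p) (<-by (ℤₚ.≤-refl {0ℤ}) (lem′ k)))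
      where
      lem′ : ∀ k → 0ℤ ≡ k + 1ℤ - k - 1ℤ
      lem′ = solve-∀
    fl : floor p (+ i * q) ≡ k
    fl = exact _ k (≡.trans eq (ℤₚ.*-comm k _))
    lem″ : ∀ P i q → (P - i) * q ≡ P * q - i * q
    lem″ = solve-∀
    lem‴ : ∀ P k q → P * q - k * P ≡ P * (q - k)
    lem‴ = solve-∀
    fl′ : floor p (+ (suc p ℕ.∸ i) * q) ≡ q - k
    fl′ = exact _ (q - k) (≡.trans (cong (_* q) (≡.trans (≡.sym (ℤₚ.⊖-≥ i≤p)) (≡.sym (ℤₚ.m-n≡m⊖n (suc p) i))))
      (≡.trans (lem″ (+ suc p) (+ i) q) (≡.trans (cong (λ j → + suc p * q - j) eq) (lem‴ (+ suc p) k q))))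
  ... | no ¬d = ≡.trans (cong (λ i → f + i) fl′) (lem f q)
    where
    a = + i * q
    f = floor p a
    lem : ∀ f q → f + (q - f - 1ℤ) ≡ q - 1ℤ + 0ℤ
    lem = solve-∀
    a≢ : + suc p * f ≢ a
    a≢ e = ¬d (divides ∣ f ∣ (≡.trans (≡.sym (ℤₚ.abs-* (+ i) q))
        (≡.trans (cong ∣_∣ (≡.sym e)) (≡.trans (ℤₚ.abs-* (+ suc p) f) (ℕₚ.*-comm (suc p) ∣ f ∣)))))
    f<a : + suc p * f < a
    f<a = ℤₚ.≤∧≢⇒< (floor-≤ p a) a≢
    lem₁ : ∀ P i q f → P * (f + 1ℤ) - i * q - 1ℤ + 1ℤ ≡ (P - i) * q - P * (q - f - 1ℤ)
    lem₁ = solve-∀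
    lem₂ : ∀ P i q f → i * q - P * f - 1ℤ ≡ P * (q - f - 1ℤ + 1ℤ) - (P - i) * q - 1ℤ
    lem₂ = solve-∀
    fl″ : floor p ((+ suc p - + i) * q) ≡ q - f - 1ℤ
    fl″ = floor-unique p _ _ (≤-by (0≤+ (<⇒1≤ (floor-< p a)) (+≤+ (z≤n {1}))) (lem₁ (+ suc p) (+ i) q f))
                             (<-by (<⇒1≤ f<a) (lem₂ (+ suc p) (+ i) q f))
    fl′ : floor p (+ (suc p ℕ.∸ i) * q) ≡ q - f - 1ℤ
    fl′ = ≡.trans (cong (λ j → floor p (j * q)) (≡.trans (≡.sym (ℤₚ.⊖-≥ i≤p)) (≡.sym (ℤₚ.m-n≡m⊖n (suc p) i)))) fl″

  -- Lattice points under one edge, by pairing i with p - i.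
  edge-sum : ∀ p q → + 2 * sumTo (suc p) (λ i → floor p (+ i * q)) ≡ + suc p * q - + suc p - q + + gcd (suc p) ∣ q ∣
  -- The pairing is symmetric on 0, ..., p + 1, one index more than in the statement. The additional
  -- term is `q`, and `cancel` removes it.
  edge-sum p q = cancel (≡.trans (≡.sym (sumTo-+ (suc (suc p)) fl (λ i → fl (suc p ℕ.∸ i))))
    (≡.trans (sumTo-cong (suc (suc p)) λ i i<p → floor-pair p q i (ℕₚ.≤-pred i<p))
      (≡.trans (sumTo-+ (suc (suc p)) (λ _ → q - 1ℤ) _)
        (cong₂ _+_ (sumTo-const (suc (suc p)) (q - 1ℤ))
          (cong₂ _+_ (count≡gcd p ∣ q ∣) (𝟙-yes (suc p ∣? suc p ℕ.* ∣ q ∣) (m∣m*n ∣ q ∣)))))))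
    where
    fl : ℕ → ℤ
    fl i = floor p (+ i * q)
    fl-end : fl (suc p) ≡ q
    fl-end = floor-unique p _ q ℤₚ.≤-refl (ℤₚ.*-monoˡ-<-pos (+ suc p) (<-by (ℤₚ.≤-refl {0ℤ}) (lem q)))
      where
      lem : ∀ k → 0ℤ ≡ k + 1ℤ - k - 1ℤ
      lem = solve-∀
    lem₁ : ∀ s q → + 2 * s ≡ s + q + (s + q) - q - q
    lem₁ = solve-∀
    lem₂ : ∀ P q g → (1ℤ + P) * (q - 1ℤ) + (g + 1ℤ) - q - q ≡ P * q - P - q + g
    lem₂ = solve-∀
    cancel : sumTo (suc (suc p)) fl + sumTo (suc (suc p)) (λ i → fl (suc p ℕ.∸ i)) ≡
             + suc (suc p) * (q - 1ℤ) + (+ gcd (suc p) ∣ q ∣ + 1ℤ) →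
             + 2 * sumTo (suc p) fl ≡ + suc p * q - + suc p - q + + gcd (suc p) ∣ q ∣
    cancel e = ≡.trans (lem₁ (sumTo (suc p) fl) q) (≡.trans
      (cong (λ i → i - q - q) (≡.trans (cong (λ i → sumTo (suc p) fl + i + (sumTo (suc p) fl + i)) (≡.sym fl-end))
        (≡.trans (cong (λ i → sumTo (suc (suc p)) fl + i) (≡.sym (sumTo-reverse (suc p) fl))) e)))
      (lem₂ (+ suc p) q (+ gcd (suc p) ∣ q ∣)))

-- Lattice points under a concave chain.

module Counting where
  open ℤ using (ℤ; +_; -[1+_]; 0ℤ; 1ℤ; _+_; _*_; _-_; -_; _≤_; _<_; +<+; +≤+; ∣_∣)
  open Plane
  open Chains
  open Support
  open Pick
  open import Data.Nat.GCD using (gcd-identityˡ)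

  -- The points under the concave chain from 0 with edges F.
  Below : List Pt → Pt → Set
  Below F z = ∀ u → Upward u → dot z u ≤ zono F u

  width : List Pt → ℕ
  width []      = 0
  width (f ∷ F) = ∣ proj₁ f ∣ ℕ.+ width F

  width≡ : ∀ F → All LexPos F → + width F ≡ proj₁ (total F)
  width≡ [] [] = refl
  width≡ (f ∷ F) (f>0 ∷ F>0) = cong₂ _+_ (ℤₚ.0≤i⇒+∣i∣≡i (LexNonNeg⇒0≤x (LexPos⇒LexNonNeg {f} f>0))) (width≡ F F>0)

  -- The height over x of the chain with edges F, rounded down. An edge with
  -- negative first coordinate never occurs; its clause is a dummy.
  height : List Pt → ℕ → ℤ
  height [] x = 0ℤ
  height ((+ zero   , q) ∷ F) x = q + height F x
  height ((-[1+ p ] , q) ∷ F) x = q + height F x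
  height ((+ suc p  , q) ∷ F) x with suc p ℕₚ.≤? x
  ... | yes _ = q + height F (x ℕ.∸ suc p)
  ... | no _  = floor p (+ x * q)

  -- The direction is the upper normal of `f`; later edges are less steep and do not ascend in it.
  zono-flat : ∀ f F → LexPos f → All (Steep f) F → All LexPos F → zono F (- proj₂ f , proj₁ f) ≡ 0ℤ
  zono-flat f [] _ _ _ = refl
  zono-flat f (g ∷ F) f>0 (fg ∷ fF) (g>0 ∷ F>0) = cong₂ _+_ (pos-≤ (subst (_≤ 0ℤ) (lem f g) fg))
      (zono-flat f F f>0 fF F>0)
    where
    lem₁ : ∀ a b c d → a * d - b * c ≡ c * - b + d * a
    lem₁ = solve-∀
    lem : ∀ f g → det f g ≡ dot g (- proj₂ f , proj₁ f)
    lem (a , b) (c , d) = lem₁ a b c d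

  -- `Below` is tested at the upper normal of the first edge, where the whole zonotope has support
  -- 0.
  below-first : ∀ {p q F x y} → LexPos (p , q) → All (Steep (p , q)) F → All LexPos F →
                Below ((p , q) ∷ F) (x , y) → p * y ≤ x * q
  below-first {p} {q} {F} {x} {y} f>0 fF F>0 bel = ≤-by
    (subst (0ℤ ≤_) (cong (λ i → i - dot (x , y) n) eq) (≤⇒0≤ (bel n (LexNonNeg⇒0≤x (LexPos⇒LexNonNeg {p , q} f>0)))))
    (lem₂ x y p q)
    where
    n : Pt
    n = (- q , p)
    lem₁ : ∀ p q → p * - q + q * p ≡ 0ℤ
    lem₁ = solve-∀
    lem₂ : ∀ x y p q → 0ℤ - (x * - q + y * p) ≡ x * q - p * y
    lem₂ = solve-∀
    eq : zono ((p , q) ∷ F) n ≡ 0ℤ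
    eq = cong₂ _+_ (cong pos (lem₁ p q)) (zono-flat (p , q) F f>0 fF F>0)

  -- If `f` ascends in direction `u`, its contribution cancels. If it descends, z - f has
  -- nonpositive product with `u`: it leads to the right and, by `below-first`, stays under the line
  -- of `f`.
  below-tail : ∀ f F z → LexPos f → All (Steep f) F → All LexPos F → proj₁ f ≤ proj₁ z →
               Below (f ∷ F) z → Below F (f ⇢ z)
  below-tail f@(p , q) F z@(x , y) f>0 fF F>0 p≤x bel u@(a , b) up with <-or-≥ (dot f u) 0ℤ
  ... | inj₂ 0≤fu = ≤-by (≤⇒0≤ (bel u up)) (≡.trans (cong₂ (λ i j → i + zono F u - j) (pos-≥ 0≤fu) (dot-⇢ f z u))
          (lem (dot f u) (zono F u) (dot (f ⇢ z) u)))
    where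
    lem : ∀ a b c → a + b - (a + c) ≡ b - c
    lem = solve-∀
  ... | inj₁ fu<0 = ℤₚ.≤-trans (left f>0) (0≤zono F u)
    where
    lem : ∀ p q x y a b → (x - p) * - (p * a + q * b) + b * (x * q - p * y) ≡ p * 0ℤ - p *
        ((x + - p) * a + (y + - q) * b)
    lem = solve-∀
    lem₀ : ∀ q a b → q * b ≡ 0ℤ * a + q * b
    lem₀ = solve-∀
    left : LexPos f → dot (f ⇢ z) u ≤ 0ℤ
    left (inj₁ 0<p) = *-cancel-≤ 0<p (≤-by (0≤+ (0≤* (≤⇒0≤ p≤x) (0≤-neg (ℤₚ.<⇒≤ fu<0)))
                                            (0≤* up (≤⇒0≤ (below-first {p} {q} {F} {x} {y} f>0 fF F>0 bel))))
                                                (lem p q x y a b))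
    left (inj₂ (refl , 0<q)) = ⊥-elim (ℤₚ.<⇒≱ fu<0 (subst (0ℤ ≤_) (lem₀ q a b) (0≤* (ℤₚ.<⇒≤ 0<q) up)))

  below-cons : ∀ f F z → Below F (f ⇢ z) → Below (f ∷ F) z
  below-cons f F z bel u up = subst (_≤ zono (f ∷ F) u) (≡.sym (dot-⇢ f z u))
      (ℤₚ.+-mono-≤ (≤pos (dot f u)) (bel u up))

  -- The point lies under the segment from 0 to the edge vector f. With m the positive part of f·u
  -- and b the second coordinate of `u`, P (m - z·u) = b (xq - Py) + x (m - f·u) + (P - x) m, where
  -- all terms are nonnegative.
  below-under-first : ∀ p q F x y → 0ℤ ≤ x → x ≤ + suc p → + suc p * y ≤ x * q → Below ((+ suc p , q) ∷ F) (x , y)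
  below-under-first p q F x y 0≤x x≤p le u@(a , b) up = ℤₚ.≤-trans step
      (ℤₚ.≤-trans (ℤₚ.≤-reflexive (≡.sym (ℤₚ.+-identityʳ _))) (ℤₚ.+-monoʳ-≤ (pos (dot (+ suc p , q) u)) (0≤zono F u)))
    where
    P = + suc p
    m = pos (dot (P , q) u)
    lem : ∀ P x y q a b m → b * (x * q - P * y) + x * (m - (P * a + q * b)) + (P - x) * m ≡ P * m - P *
        (x * a + y * b)
    lem = solve-∀
    step : dot (x , y) u ≤ m
    step = *-cancel-≤ {k = P} (+<+ (s≤s z≤n)) (≤-by
      (0≤+ (0≤+ (0≤* up (≤⇒0≤ le)) (0≤* 0≤x (≤⇒0≤ (≤pos (dot (P , q) u))))) (0≤* (≤⇒0≤ x≤p) (0≤pos (dot (P , q) u))))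
      (lem P x y q a b m))

  -- Both horizontal directions count as upward, and they bound the first coordinate.
  below-range : ∀ F → All LexPos F → ∀ {x y} → Below F (x , y) → 0ℤ ≤ x × x ≤ proj₁ (total F)
  below-range F F>0 {x} {y} bel =
    ≤-by (≤⇒0≤ (bel (- 1ℤ , 0ℤ) ℤₚ.≤-refl)) (≡.trans (cong (λ i → i - (x * - 1ℤ + y * 0ℤ)) (left F F>0)) (lem₁ x y)) ,
    ≤-by (≤⇒0≤ (bel (1ℤ , 0ℤ) ℤₚ.≤-refl))
        (≡.trans (cong (λ i → i - (x * 1ℤ + y * 0ℤ)) (right F F>0)) (lem₂ (proj₁ (total F)) x y))
    where
    lem₁ : ∀ x y → 0ℤ - (x * - 1ℤ + y * 0ℤ) ≡ x - 0ℤ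
    lem₁ = solve-∀
    lem₂ : ∀ w x y → w - (x * 1ℤ + y * 0ℤ) ≡ w - x
    lem₂ = solve-∀
    lem₃ : ∀ x y → x * - 1ℤ + y * 0ℤ ≡ - x
    lem₃ = solve-∀
    lem₄ : ∀ x y → x * 1ℤ + y * 0ℤ ≡ x
    lem₄ = solve-∀
    0≤p : ∀ f → LexPos f → 0ℤ ≤ proj₁ f
    0≤p f f>0 = LexNonNeg⇒0≤x (LexPos⇒LexNonNeg {f} f>0)
    left : ∀ F → All LexPos F → zono F (- 1ℤ , 0ℤ) ≡ 0ℤ
    left [] [] = refl
    left (f ∷ F) (f>0 ∷ F>0) = cong₂ _+_
        (≡.trans (cong pos (lem₃ (proj₁ f) (proj₂ f))) (pos-≤ (ℤₚ.neg-mono-≤ (0≤p f f>0)))) (left F F>0)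
    right : ∀ F → All LexPos F → zono F (1ℤ , 0ℤ) ≡ proj₁ (total F)
    right [] [] = refl
    right (f ∷ F) (f>0 ∷ F>0) = cong₂ _+_ (≡.trans (cong pos (lem₄ (proj₁ f) (proj₂ f))) (pos-≥ (0≤p f f>0)))
        (right F F>0)

  sub-nat : ∀ {m n} → m ℕ.≤ n → + n + - + m ≡ + (n ℕ.∸ m)
  sub-nat {m} {n} m≤n = ≡.trans (ℤₚ.m-n≡m⊖n n m) (ℤₚ.⊖-≥ m≤n)

  drop-edge : ∀ h y q → h - (y + - q) ≡ q + h - y
  drop-edge = solve-∀

  below⇒height : ∀ F → All LexPos F → AllPairs Steep F → ∀ n y → n ℕ.≤ width F → Below F (+ n , y) → y ≤ height F n
  below⇒height [] _ _ n y n≤ bel = subst (_≤ 0ℤ) (lem (+ n) y) (bel (0ℤ , 1ℤ) (+≤+ z≤n))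
    where
    lem : ∀ n y → n * 0ℤ + y * 1ℤ ≡ y
    lem = solve-∀
  below⇒height ((+ zero , q) ∷ F) (f>0 ∷ F>0) (fF ∷ FF) n y n≤ bel =
    ≤-by (≤⇒0≤ (below⇒height F F>0 FF n (y + - q) n≤
      (subst (λ x → Below F (x , y + - q)) (ℤₚ.+-identityʳ (+ n))
          (below-tail (0ℤ , q) F (+ n , y) f>0 fF F>0 (+≤+ z≤n) bel))))
      (drop-edge (height F n) y q)
  below⇒height ((-[1+ p ] , q) ∷ F) (inj₁ () ∷ F>0)
  below⇒height ((-[1+ p ] , q) ∷ F) (inj₂ () ∷ F>0)
  below⇒height ((+ suc p , q) ∷ F) (f>0 ∷ F>0) (fF ∷ FF) n y n≤ bel with suc p ℕₚ.≤? n
  ... | yes p≤n = ≤-by (≤⇒0≤ (below⇒height F F>0 FF (n ℕ.∸ suc p) (y + - q) (ℕₚ.m≤n+o⇒m∸n≤o n (suc p) n≤)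
      (subst (λ x → Below F (x , y + - q)) (sub-nat p≤n)
          (below-tail (+ suc p , q) F (+ n , y) f>0 fF F>0 (+≤+ p≤n) bel))))
      (drop-edge (height F (n ℕ.∸ suc p)) y q)
  ... | no p≰n = below⇒≤floor p (+ n * q) y (below-first {+ suc p} {q} {F} {+ n} {y} f>0 fF F>0 bel)

  height⇒below : ∀ F → All LexPos F → ∀ n y → n ℕ.≤ width F → y ≤ height F n → Below F (+ n , y)
  height⇒below [] _ zero y n≤ y≤ (a , b) up = ≤-by (0≤* up (≤⇒0≤ y≤)) (lem a b y)
    where
    lem : ∀ a b y → b * (0ℤ - y) ≡ 0ℤ - (0ℤ * a + y * b)
    lem = solve-∀
  height⇒below ((+ zero , q) ∷ F) (f>0 ∷ F>0) n y n≤ y≤ = below-cons (0ℤ , q) F (+ n , y)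
    (subst (λ x → Below F (x , y + - q)) (≡.sym (ℤₚ.+-identityʳ (+ n)))
      (height⇒below F F>0 n (y + - q) n≤ (≤-by (≤⇒0≤ y≤) (≡.sym (drop-edge (height F n) y q)))))
  height⇒below ((-[1+ p ] , q) ∷ F) (inj₁ () ∷ F>0)
  height⇒below ((-[1+ p ] , q) ∷ F) (inj₂ () ∷ F>0)
  height⇒below ((+ suc p , q) ∷ F) (f>0 ∷ F>0) n y n≤ y≤ with suc p ℕₚ.≤? n
  ... | yes p≤n = below-cons (+ suc p , q) F (+ n , y)
    (subst (λ x → Below F (x , y + - q)) (≡.sym (sub-nat p≤n))
      (height⇒below F F>0 (n ℕ.∸ suc p) (y + - q) (ℕₚ.m≤n+o⇒m∸n≤o n (suc p) n≤)
          (≤-by (≤⇒0≤ y≤) (≡.sym (drop-edge (height F (n ℕ.∸ suc p)) y q)))))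
  ... | no p≰n = below-under-first p q F (+ n) y (+≤+ z≤n) (+≤+ (ℕₚ.<⇒≤ (ℕₚ.≰⇒> p≰n))) (≤floor⇒below p (+ n * q) y y≤)

  -- For sorted edges the determinants share a sign, so their absolute values add up to one
  -- determinant by linearity.
  cross-det : ∀ f F → All (Steep f) F → + cross f F ≡ - det f (total F)
  cross-det (p , q) [] _ = lem p q
    where
    lem : ∀ p q → 0ℤ ≡ - (p * 0ℤ - q * 0ℤ)
    lem = solve-∀
  cross-det (p , q) ((s , t) ∷ F) (fg ∷ fF) = ≡.trans (cong₂ _+_ (nonpos-abs fg) (cross-det (p , q) F fF))
    (lem p q s t (proj₁ (total F)) (proj₂ (total F)))
    where
    nonpos-abs : ∀ {i} → i ≤ 0ℤ → + ∣ i ∣ ≡ - i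
    nonpos-abs {i} le = ≡.trans (cong +_ (≡.sym (ℤₚ.∣-i∣≡∣i∣ i))) (ℤₚ.0≤i⇒+∣i∣≡i (0≤-neg le))
    lem : ∀ p q s t w h → - (p * t - q * s) + - (p * h - q * w) ≡ - (p * (t + h) - q * (s + w))
    lem = solve-∀

  -- Pick's theorem for the region under a chain: W H is twice the signed area under the chord and
  -- `area F` twice the area between chord and chain; the other terms come from the boundary. The
  -- induction splits the columns at the end of the first edge.
  height-sum : ∀ F → All LexPos F → AllPairs Steep F →
    let W = + width F; H = proj₂ (total F) in
    + 2 * sumTo (suc (width F)) (height F) ≡ + area F + W * H + H - W + + perimeter F
  height-sum [] _ _ = refl
  height-sum ((-[1+ p ] , q) ∷ F) (inj₁ () ∷ F>0) _
  height-sum ((-[1+ p ] , q) ∷ F) (inj₂ () ∷ F>0) _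
  height-sum ((+ zero , q) ∷ F) (inj₁ (+<+ ()) ∷ F>0) _
  height-sum ((+ zero , q) ∷ F) (inj₂ (_ , 0<q) ∷ F>0) (fF ∷ FF) = begin
    + 2 * sumTo (suc (width F)) (λ x → q + height F x)
      ≡⟨ cong (+ 2 *_) (≡.trans (sumTo-+ (suc (width F)) (λ _ → q) (height F))
          (cong (_+ sumTo (suc (width F)) (height F)) (sumTo-const (suc (width F)) q))) ⟩
    + 2 * ((1ℤ + W) * q + S)
      ≡⟨ lem₁ W q S ⟩
    + 2 * ((1ℤ + W) * q) + + 2 * S
      ≡⟨ cong (λ i → + 2 * ((1ℤ + W) * q) + i) (height-sum F F>0 FF) ⟩
    + 2 * ((1ℤ + W) * q) + (+ area F + W * H + H - W + + perimeter F)
      ≡⟨ lem₂ W q H (+ area F) (+ perimeter F) ⟩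
    (- (0ℤ * H - q * W) + + area F) + W * (q + H) + (q + H) - W + (q + + perimeter F)
      ≡⟨ cong₂ (λ c g → c + + area F + W * (q + H) + (q + H) - W + (g + + perimeter F))
           (≡.trans (cong (λ w → - (0ℤ * H - q * w)) (width≡ F F>0)) (≡.sym (cross-det (0ℤ , q) F fF)))
           (≡.trans (≡.sym (ℤₚ.0≤i⇒+∣i∣≡i (ℤₚ.<⇒≤ 0<q))) (cong +_ (≡.sym (gcd-identityˡ ∣ q ∣)))) ⟩
    + cross (0ℤ , q) F + + area F + W * (q + H) + (q + H) - W + (+ content (0ℤ , q) + + perimeter F) ∎
    where
    open ≡-Reasoning
    W = + width F
    H = proj₂ (total F)
    S = sumTo (suc (width F)) (height F)
    lem₁ : ∀ W q S → + 2 * ((1ℤ + W) * q + S) ≡ + 2 * ((1ℤ + W) * q) + + 2 * S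
    lem₁ = solve-∀
    lem₂ : ∀ W q H A g → + 2 * ((1ℤ + W) * q) + (A + W * H + H - W + g) ≡ (- (0ℤ * H - q * W) + A) + W * (q + H) +
        (q + H) - W + (q + g)
    lem₂ = solve-∀
  height-sum ((+ suc p , q) ∷ F) (_ ∷ F>0) (fF ∷ FF) = begin
    + 2 * sumTo (suc (suc p ℕ.+ width F)) hf
      ≡⟨ cong (λ n → + 2 * sumTo n hf) (≡.sym (ℕₚ.+-suc (suc p) (width F))) ⟩
    + 2 * sumTo (suc p ℕ.+ suc (width F)) hf
      -- The column over the right end of the first edge is counted as column 0 of the tail, which
      -- is why `edge-sum` leaves it out.
      ≡⟨ cong (+ 2 *_) (sumTo-split (suc p) (suc (width F)) hf) ⟩
    + 2 * (sumTo (suc p) hf + sumTo (suc (width F)) (λ i → hf (suc p ℕ.+ i)))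
      ≡⟨ cong (+ 2 *_) (cong₂ _+_ (sumTo-cong (suc p) before)
           (≡.trans (sumTo-cong (suc (width F)) (λ i _ → after i))
               (≡.trans (sumTo-+ (suc (width F)) (λ _ → q) (height F))
               (cong (_+ S) (sumTo-const (suc (width F)) q))))) ⟩
    + 2 * (E + ((1ℤ + W) * q + S))
      ≡⟨ lem₁ W q S E ⟩
    + 2 * E + + 2 * ((1ℤ + W) * q) + + 2 * S
      ≡⟨ cong₂ (λ i j → i + + 2 * ((1ℤ + W) * q) + j) (edge-sum p q) (height-sum F F>0 FF) ⟩
    (P * q - P - q + g) + + 2 * ((1ℤ + W) * q) + (+ area F + W * H + H - W + + perimeter F)
      ≡⟨ lem₂ P g W q H (+ area F) (+ perimeter F) ⟩
    (- (P * H - q * W) + + area F) + (P + W) * (q + H) + (q + H) - (P + W) + (g + + perimeter F)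
      ≡⟨ cong (λ c → c + + area F + (P + W) * (q + H) + (q + H) - (P + W) + (g + + perimeter F))
           (≡.trans (cong (λ w → - (P * H - q * w)) (width≡ F F>0)) (≡.sym (cross-det (P , q) F fF))) ⟩
    + cross (P , q) F + + area F + (P + W) * (q + H) + (q + H) - (P + W) + (g + + perimeter F) ∎
    where
    open ≡-Reasoning
    P = + suc p
    W = + width F
    H = proj₂ (total F)
    hf = height ((P , q) ∷ F)
    S = sumTo (suc (width F)) (height F)
    E = sumTo (suc p) (λ i → floor p (+ i * q))
    g = + content (P , q)
    before : ∀ i → i ℕ.< suc p → hf i ≡ floor p (+ i * q)
    before i i<p with suc p ℕₚ.≤? i
    ... | yes p≤i = ⊥-elim (ℕₚ.<⇒≱ i<p p≤i)
    ... | no _    = refl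
    after : ∀ i → hf (suc p ℕ.+ i) ≡ q + height F i
    after i with suc p ℕₚ.≤? suc p ℕ.+ i
    ... | yes _ = cong (λ n → q + height F n) (ℕₚ.m+n∸m≡n (suc p) i)
    ... | no ¬p = ⊥-elim (¬p (ℕₚ.m≤m+n (suc p) i))
    lem₁ : ∀ W q S E → + 2 * (E + ((1ℤ + W) * q + S)) ≡ + 2 * E + + 2 * ((1ℤ + W) * q) + + 2 * S
    lem₁ = solve-∀
    lem₂ : ∀ P g W q H A r → (P * q - P - q + g) + + 2 * ((1ℤ + W) * q) + (A + W * H + H - W + r) ≡
           (- (P * H - q * W) + A) + (P + W) * (q + H) + (q + H) - (P + W) + (g + r)
    lem₂ = solve-∀

-- Pick's theorem for lattice polygons.

module PickTheorem where
  open ℤ using (ℤ; +_; 0ℤ; 1ℤ; _+_; _*_; _-_; -_; _≤_; _<_; +<+; +≤+; ∣_∣)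
  open Plane
  open Chains
  open Support
  open Pick
  open Counting

  -- If `H` is the support function of a lattice polygon, these are exactly its lattice points,
  -- although only integer directions are tested.
  Dominated : (Pt → ℤ) → Pt → Set
  Dominated H z = ∀ u → dot z u ≤ H u

  record Enumeration (P : Pt → Set) (n : ℕ) : Set where
    field
      list     : List Pt
      unique   : Unique list
      size     : length list ≡ n
      sound    : ∀ {z} → z ∈ list → P z
      complete : ∀ {z} → P z → z ∈ list

  lookup-injective : ∀ {A : Set} {xs : List A} → Unique xs → ∀ i j → lookup xs i ≡ lookup xs j → i ≡ j
  lookup-injective (_ ∷ _)   zero    zero    _ = refl
  lookup-injective (≢x ∷ _)  zero    (suc j) e = ⊥-elim (All.lookup ≢x (∈ₚ.∈-lookup j) e)
  lookup-injective (≢x ∷ _)  (suc i) zero    e = ⊥-elim (All.lookup ≢x (∈ₚ.∈-lookup i) (≡.sym e))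
  lookup-injective (_ ∷ uxs) (suc i) (suc j) e = cong suc (lookup-injective uxs i j e)

  enumeration-map : ∀ {P Q n} (f g : Pt → Pt) → (∀ z → g (f z) ≡ z) → (∀ z → f (g z) ≡ z) →
                    (∀ {z} → P z → Q (f z)) → (∀ {z} → Q z → P (g z)) → Enumeration P n → Enumeration Q n
  enumeration-map {Q = Q} f g gf fg to from E = record
    { list = map f list
    ; unique = Uniqueₚ.map⁺ (λ {x} {y} e → ≡.trans (≡.sym (gf x)) (≡.trans (cong g e) (gf y))) unique
    ; size = ≡.trans (Listₚ.length-map f list) size
    ; sound = λ z∈ → let w , w∈ , e = ∈ₚ.∈-map⁻ f z∈ in subst Q (≡.sym e) (to (sound w∈))
    ; complete = λ {z} q → subst (_∈ map f list) (fg z) (∈ₚ.∈-map⁺ f (complete (from q))) }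
    where open Enumeration E

  sumℕ : ℕ → (ℕ → ℕ) → ℕ
  sumℕ zero    f = 0
  sumℕ (suc n) f = sumℕ n f ℕ.+ f n

  +-sumℕ : ∀ n f → + sumℕ n f ≡ sumTo n (λ i → + f i)
  +-sumℕ zero    f = refl
  +-sumℕ (suc n) f = cong (_+ + f n) (+-sumℕ n f)

  InColumns : ℕ → (ℕ → ℤ) → (ℕ → ℕ) → Pt → Set
  InColumns m lo c z = ∃[ n ] ∃[ k ] n ℕ.< m × k ℕ.< c n × z ≡ (+ n , lo n + + k)

  columns : ∀ m lo c → Enumeration (InColumns m lo c) (sumℕ m c)
  columns zero lo c = record { list = [] ; unique = [] ; size = refl ; sound = λ () ; complete = λ
      { (_ , _ , () , _) } }
  columns (suc m) lo c = record
    { list = list ++ col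
    ; unique = Uniqueₚ.++⁺ unique (Uniqueₚ.applyUpTo⁺₁ entry (c m) distinct) disjoint
    ; size = ≡.trans (Listₚ.length-++ list) (cong₂ ℕ._+_ size (Listₚ.length-applyUpTo entry (c m)))
    ; sound = λ z∈ → [ old ∘ sound , new ]′ (∈ₚ.∈-++⁻ list z∈)
    ; complete = complete′ }
    where
    open Enumeration (columns m lo c)
    entry : ℕ → Pt
    entry k = (+ m , lo m + + k)
    col = List.applyUpTo entry (c m)
    distinct : ∀ {i j} → i ℕ.< j → j ℕ.< c m → entry i ≢ entry j
    distinct i<j _ e = ℕₚ.<⇒≢ i<j (ℤₚ.+-injective (+-cancelˡ (lo m) _ _ (cong proj₂ e)))
      where
      open import Algebra.Properties.Group (CommutativeRing.+-group ℤₚ.+-*-commutativeRing) using () renaming (∙-cancelˡ to +-cancelˡ)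
    old : ∀ {z} → InColumns m lo c z → InColumns (suc m) lo c z
    old (n , k , n<m , rest) = n , k , ℕₚ.m<n⇒m<1+n n<m , rest
    new : ∀ {z} → z ∈ col → InColumns (suc m) lo c z
    new z∈ = let k , k<c , e = ∈ₚ.∈-applyUpTo⁻ entry z∈ in m , k , ℕₚ.≤-refl , k<c , e
    disjoint : ∀ {z} → ¬ (z ∈ list × z ∈ col)
    disjoint (z∈ , z∈′) with sound z∈ | ∈ₚ.∈-applyUpTo⁻ entry z∈′
    ... | n , _ , n<m , _ , e | k , _ , e′ = ℕₚ.<⇒≢ n<m (ℤₚ.+-injective (cong proj₁ (≡.trans (≡.sym e) e′)))
    complete′ : ∀ {z} → InColumns (suc m) lo c z → z ∈ list ++ col
    complete′ (n , k , n<1+m , k<c , e) with ℕₚ.m≤n⇒m<n∨m≡n (ℕₚ.≤-pred n<1+m)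
    ... | inj₁ n<m  = ∈ₚ.∈-++⁺ˡ (complete (n , k , n<m , k<c , e))
    ... | inj₂ refl = ∈ₚ.∈-++⁺ʳ list (subst (_∈ col) (≡.sym e) (∈ₚ.∈-applyUpTo⁺ entry k<c))

  dot-total≤zono : ∀ F u → dot (total F) u ≤ zono F u
  dot-total≤zono [] u = ℤₚ.≤-reflexive (lem (proj₁ u) (proj₂ u))
    where
    lem : ∀ a b → 0ℤ * a + 0ℤ * b ≡ 0ℤ
    lem = solve-∀
  dot-total≤zono (f ∷ F) u = subst (_≤ zono (f ∷ F) u) (≡.sym (dot-⊞ˡ f (total F) u))
      (ℤₚ.+-mono-≤ (≤pos (dot f u)) (dot-total≤zono F u))

  -- The certificate of `below-under-first` with the chord in place of the first edge.
  below-chord : ∀ F n y → + n ≤ proj₁ (total F) → 0ℤ < proj₁ (total F) →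
                proj₁ (total F) * y ≤ + n * proj₂ (total F) → Below F (+ n , y)
  below-chord F n y n≤W 0<W le u@(a , b) up = *-cancel-≤ 0<W (≤-by
    (0≤+ (0≤+ (0≤* up (≤⇒0≤ le)) (0≤* (+≤+ (z≤n {n})) (≤⇒0≤ (dot-total≤zono F u)))) (0≤* (≤⇒0≤ n≤W) (0≤zono F u)))
    (lem (proj₁ (total F)) (proj₂ (total F)) (+ n) y a b (zono F u)))
    where
    lem : ∀ W H n y a b Z → b * (n * H - W * y) + n * (Z - (W * a + H * b)) + (W - n) * Z ≡ W * Z - W *
        (n * a + y * b)
    lem = solve-∀

  module _ {H : Pt → ℤ} (B : Boundary H) where
    open Boundary B

    private
      sorted-up = sort up up>0
      sorted-lo = sort lo lo>0
      F = proj₁ sorted-up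
      G = proj₁ sorted-lo
      F↭ : F ↭ up
      F↭ = proj₁ (proj₂ sorted-up)
      G↭ : G ↭ lo
      G↭ = proj₁ (proj₂ sorted-lo)
      FF = proj₂ (proj₂ sorted-up)
      GG = proj₂ (proj₂ sorted-lo)
      F>0 = Permₚ.All-resp-↭ (↭-sym F↭) up>0
      G>0 = Permₚ.All-resp-↭ (↭-sym G↭) lo>0
      T = total F
      T≡ : total G ≡ T
      T≡ = ≡.trans (total-↭ G↭) (≡.trans (≡.sym closed) (≡.sym (total-↭ F↭)))
      W = width F
      h = proj₂ T
      +W : + W ≡ proj₁ T
      +W = width≡ F F>0
      W≡ : width G ≡ W
      W≡ = ℤₚ.+-injective (≡.trans (width≡ G G>0) (≡.trans (cong proj₁ T≡) (≡.sym +W)))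

      -- The point reflection taking z to T - z exchanges the two boundaries, so the lower one
      -- becomes a concave chain from 0 with edges `G`.
      Between : Pt → Set
      Between z = Below F z × Below G (z ⇢ T)

      dominated⇒between : ∀ {z} → Dominated H z → Between (base ⇢ z)
      dominated⇒between {z} dom =
        (λ u up↑ → ≤-by (≤⇒0≤ (dom u)) (≡.trans
            (cong₂ _-_ (≡.trans (upper u up↑) (cong (λ i → dot base u + i) (zono-↭ u (↭-sym F↭)))) (dot-⇢ base z u))
            (lem₁ (dot base u) (zono F u) (dot (base ⇢ z) u)))) ,
        (λ u up↑ → ≤-by (≤⇒0≤ (dom (⊟ u))) (≡.trans
            (cong₂ _-_ (≡.trans (lower (⊟ u) (subst Upward (≡.sym (⊟-involutive u)) up↑))
                        (cong₂ _+_ (dot-⊟ʳ base u) (≡.trans (zono-⊟ lo u)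
                            (cong₂ _-_ (zono-↭ u (↭-sym G↭))
                            (cong (λ w → dot w u) (≡.trans (≡.sym (total-↭ G↭)) T≡))))))
                       (dot-⊟ʳ z u))
            (≡.trans (lem₂ (dot base u) (zono G u) (dot T u) (dot z u))
                (cong (λ i → zono G u - i) (≡.sym (dist base z T u))))))
        where
        lem₁ : ∀ b f z → b + f - (b + z) ≡ f - z
        lem₁ = solve-∀
        lem₂ : ∀ b g t z → - b + (g - t) - - z ≡ g - (t - (z - b))
        lem₂ = solve-∀
        dist-lem : ∀ a b c d e f x y → (e + - (c + - a)) * x + (f + - (d + - b)) * y ≡ (e * x + f * y) -
            ((c * x + d * y) - (a * x + b * y))
        dist-lem = solve-∀
        dist : ∀ b z t u → dot ((b ⇢ z) ⇢ t) u ≡ dot t u - (dot z u - dot b u)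
        dist (a , b) (c , d) (e , f) (x , y) = dist-lem a b c d e f x y

      between⇒dominated : ∀ {w} → Between w → Dominated H (base ⊞ w)
      between⇒dominated {w} (bF , bG) u with ℤₚ.≤-total 0ℤ (proj₂ u)
      ... | inj₁ up↑ = subst₂ _≤_ (≡.sym (dot-⊞ˡ base w u))
            (≡.sym (≡.trans (upper u up↑) (cong (λ i → dot base u + i) (zono-↭ u (↭-sym F↭)))))
                        (ℤₚ.+-monoʳ-≤ (dot base u) (bF u up↑))
      ... | inj₂ down = ≤-by (≤⇒0≤ (bG (⊟ u) (ℤₚ.neg-mono-≤ down))) (≡.trans
              (cong₂ _-_ (≡.trans (zono-⊟ G u) (cong₂ (λ i w → i - dot w u) (zono-↭ u G↭) T≡))
                  (≡.trans (dot-⊟ʳ (w ⇢ T) u) (cong -_ (expand w T u))))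
              (≡.trans (lem (zono lo u) (dot T u) (dot w u) (dot base u))
                  (cong₂ _-_ (≡.sym (lower u (ℤₚ.neg-mono-≤ down))) (≡.sym (dot-⊞ˡ base w u)))))
        where
        lem : ∀ g t w b → g - t - - (t - w) ≡ b + g - (b + w)
        lem = solve-∀
        expand-lem : ∀ a b c d x y → (c + - a) * x + (d + - b) * y ≡ c * x + d * y - (a * x + b * y)
        expand-lem = solve-∀
        expand : ∀ w t u → dot (w ⇢ t) u ≡ dot t u - dot w u
        expand (a , b) (c , d) (x , y) = expand-lem a b c d x y

      -- The point reflection moves column n to column W - n and turns rounding down into rounding
      -- up.
      lo-height : ℕ → ℤ
      lo-height n = h - height G (W ℕ.∸ n)

      gap : ℕ → ℤ
      gap n = height F n - lo-height n + 1ℤ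

      below-G : ∀ n y → n ℕ.≤ W → Below G ((+ n , y) ⇢ T) → h - y ≤ height G (W ℕ.∸ n)
      below-G n y n≤W bel = below⇒height G G>0 GG (W ℕ.∸ n) (h - y) (subst (W ℕ.∸ n ℕ.≤_) (≡.sym W≡) (ℕₚ.m∸n≤m W n))
        (subst (λ x → Below G (x , h - y)) (≡.trans (cong (_+ - + n) (≡.sym +W)) (sub-nat n≤W)) bel)

      G-below : ∀ n y → n ℕ.≤ W → h - y ≤ height G (W ℕ.∸ n) → Below G ((+ n , y) ⇢ T)
      G-below n y n≤W le = subst (λ x → Below G (x , h - y))
          (≡.sym (≡.trans (cong (_+ - + n) (≡.sym +W)) (sub-nat n≤W)))
        (height⇒below G G>0 (W ℕ.∸ n) (h - y) (subst (W ℕ.∸ n ℕ.≤_) (≡.sym W≡) (ℕₚ.m∸n≤m W n)) le)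

      -- Both chains contain the lattice points just below the chord.
      gap≥0 : ∀ n → n ℕ.≤ W → 0ℤ ≤ gap n
      gap≥0 n n≤W = on-chord W refl
        where
        -- It is enough to find points under the two chains whose heights, once the second is
        -- reflected to h - y′, overlap or are at most one apart: a column may be empty, but its
        -- count must not become negative.
        from-chord : ∀ y y′ → h ≤ y + y′ + 1ℤ → Below F (+ n , y) → Below G (+ (W ℕ.∸ n) , y′) → 0ℤ ≤ gap n
        from-chord y y′ le bF bG = subst (0ℤ ≤_) (lem (height F n) (height G (W ℕ.∸ n)) y y′ h)
          (0≤+ (0≤+ (≤⇒0≤ (below⇒height F F>0 FF n y n≤W bF))
                    (≤⇒0≤ (below⇒height G G>0 GG (W ℕ.∸ n) y′ (subst (W ℕ.∸ n ℕ.≤_) (≡.sym W≡) (ℕₚ.m∸n≤m W n)) bG)))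
                        (≤⇒0≤ le))
          where
          lem : ∀ f g y y′ h → f - y + (g - y′) + (y + y′ + 1ℤ - h) ≡ f - (h - g) + 1ℤ
          lem = solve-∀
        on-chord : ∀ w → W ≡ w → 0ℤ ≤ gap n
        -- The polygon is a vertical segment or a point, and the ends of the chord serve as the two
        -- points.
        on-chord zero e = from-chord h 0ℤ (≤-by (+≤+ (z≤n {1})) (lem h))
            (subst (λ i → Below F (i , h)) (≡.trans (≡.sym +W) (cong +_ (≡.trans e (≡.sym n≡0))))
                (λ u _ → dot-total≤zono F u))
            (subst (λ m → Below G (+ m , 0ℤ)) (≡.sym (≡.trans (cong (ℕ._∸ n) e) (ℕₚ.0∸n≡0 n)))
                (λ u _ → subst (_≤ zono G u) (≡.sym (lem₀ (proj₁ u) (proj₂ u))) (0≤zono G u)))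
          where
          n≡0 : n ≡ 0
          n≡0 = ℕₚ.n≤0⇒n≡0 (subst (n ℕ.≤_) e n≤W)
          lem : ∀ h → 1ℤ ≡ h + 0ℤ + 1ℤ - h
          lem = solve-∀
          lem₀ : ∀ a b → 0ℤ * a + 0ℤ * b ≡ 0ℤ
          lem₀ = solve-∀
        -- `y` is the height of the chord rounded down. The reflected chord is at height h minus the
        -- unrounded value, hence above h - y - 1.
        on-chord (suc w) e = from-chord y (h - y - 1ℤ) (ℤₚ.≤-reflexive (lem h y))
            (below-chord F n y (subst (+ n ≤_) +W (+≤+ n≤W)) (subst (0ℤ <_) w≡ (+<+ (s≤s z≤n)))
                (subst (λ i → i * y ≤ + n * h) w≡ (floor-≤ w (+ n * h))))
            (below-chord G (W ℕ.∸ n) (h - y - 1ℤ) (subst (+ (W ℕ.∸ n) ≤_) w≡G′ (+≤+ (ℕₚ.m∸n≤m W n)))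
              (subst (0ℤ <_) w≡G (+<+ (s≤s z≤n)))
              (subst₂ (λ i j → i * (h - y - 1ℤ) ≤ + (W ℕ.∸ n) * j) w≡G (≡.sym (cong proj₂ T≡))
                (≤-by (0≤+ (<⇒1≤ (floor-< w (+ n * h))) (+≤+ (z≤n {1})))
                    (≡.trans (lem₂ (+ suc w) (+ n) h y) (cong (λ i → i * h - + suc w * (h - y - 1ℤ)) sub)))))
          where
          y = floor w (+ n * h)
          w≡ : + suc w ≡ proj₁ T
          w≡ = ≡.trans (cong +_ (≡.sym e)) +W
          w≡G : + suc w ≡ proj₁ (total G)
          w≡G = ≡.trans w≡ (≡.sym (cong proj₁ T≡))
          w≡G′ : + W ≡ proj₁ (total G)
          w≡G′ = ≡.trans +W (≡.sym (cong proj₁ T≡))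
          sub : + suc w - + n ≡ + (W ℕ.∸ n)
          sub = ≡.trans (cong (λ i → + i - + n) (≡.sym e)) (sub-nat n≤W)
          lem : ∀ h y → h ≡ y + (h - y - 1ℤ) + 1ℤ
          lem = solve-∀
          lem₂ : ∀ P n h y → P * (y + 1ℤ) - n * h - 1ℤ + 1ℤ ≡ (P - n) * h - P * (h - y - 1ℤ)
          lem₂ = solve-∀

      count : ℕ → ℕ
      count n = ∣ gap n ∣

      in-columns⇒between : ∀ {z} → InColumns (suc W) lo-height count z → Between z
      in-columns⇒between (n , k , n<W , k<c , refl) =
        height⇒below F F>0 n _ n≤W (≤-by (<⇒1≤ k<gap) (lem (height F n) (lo-height n) (+ k))) ,
        G-below n _ n≤W (≤-by (+≤+ (z≤n {k})) (lem′ h (height G (W ℕ.∸ n)) (+ k)))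
        where
        n≤W = ℕₚ.≤-pred n<W
        k<gap : + k < gap n
        k<gap = subst (+ k <_) (ℤₚ.0≤i⇒+∣i∣≡i (gap≥0 n n≤W)) (+<+ k<c)
        lem : ∀ f l k → f - l + 1ℤ - k - 1ℤ ≡ f - (l + k)
        lem = solve-∀
        lem′ : ∀ h g k → k ≡ g - (h - (h - g + k))
        lem′ = solve-∀

      between⇒in-columns : ∀ {z} → Between z → InColumns (suc W) lo-height count z
      between⇒in-columns {x , y} (bF , bG) = n , k , s≤s n≤W , k<c , cong₂ _,_ (≡.sym n≡)
          (≡.sym (≡.trans (cong (λ i → lo-height n + i) k≡) (lem₁ (lo-height n) y)))
        where
        range = below-range F F>0 {x} {y} bF
        n = ∣ x ∣
        n≡ : + n ≡ x
        n≡ = ℤₚ.0≤i⇒+∣i∣≡i (proj₁ range)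
        n≤W : n ℕ.≤ W
        n≤W = ℤₚ.drop‿+≤+ (subst₂ _≤_ (≡.sym n≡) (≡.sym +W) (proj₂ range))
        y≤ : y ≤ height F n
        y≤ = below⇒height F F>0 FF n y n≤W (subst (λ i → Below F (i , y)) (≡.sym n≡) bF)
        ≤y : h - y ≤ height G (W ℕ.∸ n)
        ≤y = below-G n y n≤W (subst (λ i → Below G ((i , y) ⇢ T)) (≡.sym n≡) bG)
        k = ∣ y - lo-height n ∣
        lem₀ : ∀ g h y → g - (h - y) ≡ y - (h - g)
        lem₀ = solve-∀
        k≡ : + k ≡ y - lo-height n
        k≡ = ℤₚ.0≤i⇒+∣i∣≡i (subst (0ℤ ≤_) (lem₀ (height G (W ℕ.∸ n)) h y) (≤⇒0≤ ≤y))
        lem₁ : ∀ l y → l + (y - l) ≡ y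
        lem₁ = solve-∀
        lem₂ : ∀ f l y → f - y ≡ f - l + 1ℤ - (y - l) - 1ℤ
        lem₂ = solve-∀
        k<c : k ℕ.< count n
        k<c = ℤₚ.drop‿+<+ (subst₂ _<_ (≡.sym k≡) (≡.sym (ℤₚ.0≤i⇒+∣i∣≡i (gap≥0 n n≤W)))
            (<-by (≤⇒0≤ y≤) (lem₂ (height F n) (lo-height n) y)))

      lattice-count : ℕ
      lattice-count = sumℕ (suc W) count

      count-formula : + 2 * + lattice-count ≡ + area F + + area G + + perimeter F + + perimeter G + + 2
      count-formula = begin
        + 2 * + lattice-count
          ≡⟨ cong (+ 2 *_) (≡.trans (+-sumℕ (suc W) count)
              (sumTo-cong (suc W) λ i i<W → ≡.trans (ℤₚ.0≤i⇒+∣i∣≡i (gap≥0 i (ℕₚ.≤-pred i<W)))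
              (lem₁ (height F i) h (height G (W ℕ.∸ i))))) ⟩
        + 2 * sumTo (suc W) (λ i → height F i + (height G (W ℕ.∸ i) + (1ℤ - h)))
          ≡⟨ cong (+ 2 *_) (≡.trans (sumTo-+ (suc W) (height F) _) (cong (λ i → sumTo (suc W) (height F) + i)
               (≡.trans (sumTo-+ (suc W) (λ i → height G (W ℕ.∸ i)) _)
                   (cong₂ _+_ (sumTo-reverse W (height G)) (sumTo-const (suc W) (1ℤ - h)))))) ⟩
        + 2 * (SF + (SG + (1ℤ + + W) * (1ℤ - h)))
          ≡⟨ lem₂ SF SG (+ W) h ⟩
        + 2 * SF + + 2 * SG + + 2 * ((1ℤ + + W) * (1ℤ - h))
          ≡⟨ cong₂ (λ i j → i + j + + 2 * ((1ℤ + + W) * (1ℤ - h))) (height-sum F F>0 FF) G-sum ⟩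
        (+ area F + + W * h + h - + W + + perimeter F) + (+ area G + + W * h + h - + W + + perimeter G) + + 2 *
            ((1ℤ + + W) * (1ℤ - h))
          ≡⟨ lem₃ (+ area F) (+ area G) (+ perimeter F) (+ perimeter G) (+ W) h ⟩
        + area F + + area G + + perimeter F + + perimeter G + + 2 ∎
        where
        open ≡-Reasoning
        SF = sumTo (suc W) (height F)
        SG = sumTo (suc W) (height G)
        G-sum : + 2 * SG ≡ + area G + + W * h + h - + W + + perimeter G
        G-sum = subst₂ (λ w t → + 2 * sumTo (suc w) (height G) ≡ + area G + + w * t + t - + w + + perimeter G) W≡
            (cong proj₂ T≡) (height-sum G G>0 GG)
        lem₁ : ∀ f h g → f - (h - g) + 1ℤ ≡ f + (g + (1ℤ - h))
        lem₁ = solve-∀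
        lem₂ : ∀ f g w h → + 2 * (f + (g + (1ℤ + w) * (1ℤ - h))) ≡ + 2 * f + + 2 * g + + 2 * ((1ℤ + w) * (1ℤ - h))
        lem₂ = solve-∀
        lem₃ : ∀ a b p q w h → (a + w * h + h - w + p) + (b + w * h + h - w + q) + + 2 * ((1ℤ + w) * (1ℤ - h)) ≡ a +
            b + p + q + + 2
        lem₃ = solve-∀

    -- A degenerate polygon has equal upper and lower boundaries and its length is counted twice, so
    -- the formula holds for segments and points as well.
    pick : ∃[ k ] Enumeration (Dominated H) k ×
           2 ℕ.* k ≡ area up ℕ.+ area lo ℕ.+ perimeter up ℕ.+ perimeter lo ℕ.+ 2
    pick = lattice-count ,
      enumeration-map (base ⊞_) (base ⇢_) (λ z → there-back base z) (λ z → back-there base z)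
        (λ {w} c → between⇒dominated {w} (in-columns⇒between {w} c))
            (λ {z} d → between⇒in-columns {base ⇢ z} (dominated⇒between {z} d))
        (columns (suc W) lo-height count) ,
      ℤₚ.+-injective (≡.trans (ℤₚ.pos-* 2 lattice-count) (≡.trans count-formula
        (cong₂ (λ (a , b) (c , d) → + a + + b + + c + + d + + 2)
          (cong₂ _,_ (area-↭ F↭) (area-↭ G↭)) (cong₂ _,_ (perimeter-↭ F↭) (perimeter-↭ G↭)))))
      where
      lem₁ : ∀ a b → a + b + - a ≡ b
      lem₁ = solve-∀
      lem₂ : ∀ a b → a + (b + - a) ≡ b
      lem₂ = solve-∀
      there-back : ∀ b z → b ⇢ (b ⊞ z) ≡ z
      there-back (a , b) (c , d) = cong₂ _,_ (lem₁ a c) (lem₁ b d)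
      back-there : ∀ b z → b ⊞ (b ⇢ z) ≡ z
      back-there (a , b) (c , d) = cong₂ _,_ (lem₂ a c) (lem₂ b d)

-- Pick's theorem for finer lattices, by Hermite normal form.

module Matrices where
  open ℤ using (ℤ; +_; -[1+_]; 0ℤ; 1ℤ; _+_; _*_; _-_; -_; _≤_; _<_; +<+; ∣_∣)
  open import Data.Nat.GCD using (gcd; gcd[m,n]∣m; gcd[m,n]∣n; gcd-greatest; gcd-GCD; gcd[m,n]≡0⇒m≡0; gcd[m,n]≡0⇒n≡0; module Bézout)
  import Data.Nat.Divisibility as ℕ∣
  open import Data.Integer.Divisibility.Signed using (_∣_; ∣ᵤ⇒∣; ∣⇒∣ᵤ; ∣m∣n⇒∣m+n; ∣n⇒∣m*n)
  open Plane
  open Chains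
  open Support
  open Pick
  open PickTheorem

  record Matrix : Set where
    constructor matrix
    field
      a b c d : ℤ

    determinant : ℤ
    determinant = a * d - b * c

    mul mulᵀ : Pt → Pt
    mul  (x , y) = (a * x + b * y , c * x + d * y)
    mulᵀ (x , y) = (a * x + c * y , b * x + d * y)

    dot-mul : ∀ z u → dot (mul z) u ≡ dot z (mulᵀ u)
    dot-mul (x , y) (s , t) = lem a b c d x y s t
      where
      lem : ∀ a b c d x y s t → (a * x + b * y) * s + (c * x + d * y) * t ≡ x * (a * s + c * t) + y * (b * s + d * t)
      lem = solve-∀

    -- Applied to a matrix and to its inverse, this shows that a unimodular change of basis
    -- preserves lattice lengths.
    content-∣ : ∀ z → content z ℕ∣.∣ content (mul z)
    content-∣ (x , y) = gcd-greatest (∣⇒∣ᵤ (combination a b)) (∣⇒∣ᵤ (combination c d))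
      where
      g = + content (x , y)
      combination : ∀ r s → g ∣ r * x + s * y
      combination r s = ∣m∣n⇒∣m+n (∣n⇒∣m*n r (∣ᵤ⇒∣ (gcd[m,n]∣m ∣ x ∣ ∣ y ∣)))
          (∣n⇒∣m*n s (∣ᵤ⇒∣ (gcd[m,n]∣n ∣ x ∣ ∣ y ∣)))

  open Matrix

  bézout : ∀ x y → ∃[ s ] ∃[ t ] s * x + t * y ≡ + gcd ∣ x ∣ ∣ y ∣
  bézout x y with signed x | signed y
    where
    signed : ∀ i → ∃[ ε ] + ∣ i ∣ ≡ ε * i
    signed (+ n)    = 1ℤ , ≡.sym (ℤₚ.*-identityˡ (+ n))
    signed -[1+ n ] = - 1ℤ , lem (+ suc n)
      where
      lem : ∀ i → i ≡ - 1ℤ * - i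
      lem = solve-∀
  ... | ε , e | ε′ , e′ with Bézout.identity (gcd-GCD ∣ x ∣ ∣ y ∣)
  ...   | Bézout.+- m n eq = + m * ε , - (+ n * ε′) , ≡.trans (lem (+ m) ε x (+ n) ε′ y)
            (≡.trans (cong₂ (λ i j → + m * i - + n * j) (≡.sym e) (≡.sym e′))
                (solved (+ m * + ∣ x ∣) (+ n * + ∣ y ∣) _
                (≡.trans (cong (λ i → + gcd ∣ x ∣ ∣ y ∣ + i) (≡.sym (ℤₚ.pos-* n ∣ y ∣)))
                (≡.trans (cong +_ eq) (ℤₚ.pos-* m ∣ x ∣)))))
    where
    lem : ∀ m ε x n ε′ y → m * ε * x + - (n * ε′) * y ≡ m * (ε * x) - n * (ε′ * y)
    lem = solve-∀
    lem₂ : ∀ g q → g + q - q ≡ g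
    lem₂ = solve-∀
    solved : ∀ p q g → g + q ≡ p → p - q ≡ g
    solved p q g refl = lem₂ g q
  ...   | Bézout.-+ m n eq = - (+ m * ε) , + n * ε′ , ≡.trans (lem (+ m) ε x (+ n) ε′ y)
            (≡.trans (cong₂ (λ i j → + n * j - + m * i) (≡.sym e) (≡.sym e′))
                (solved (+ n * + ∣ y ∣) (+ m * + ∣ x ∣) _
                (≡.trans (cong (λ i → + gcd ∣ x ∣ ∣ y ∣ + i) (≡.sym (ℤₚ.pos-* m ∣ x ∣)))
                (≡.trans (cong +_ eq) (ℤₚ.pos-* n ∣ y ∣)))))
    where
    lem : ∀ m ε x n ε′ y → - (m * ε) * x + n * ε′ * y ≡ n * (ε′ * y) - m * (ε * x)
    lem = solve-∀
    lem₂ : ∀ g q → g + q - q ≡ g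
    lem₂ = solve-∀
    solved : ∀ p q g → g + q ≡ p → p - q ≡ g
    solved p q g refl = lem₂ g q

  -- Hermite normal form: every lattice has a basis in which the given matrix is
  -- triangular, so that the order of edge vectors is preserved.
  record Hermite (M : Matrix) : Set where
    field
      W V      : Matrix
      VW       : ∀ z → mul V (mul W z) ≡ z
      WV       : ∀ z → mul W (mul V z) ≡ z
      T        : Triangular
      factor   : ∀ z → mul W (mul M z) ≡ Triangular.apply T z
      factorᵀ  : ∀ u → mulᵀ M (mulᵀ W u) ≡ Triangular.transpose T u
      VWᵀ      : ∀ u → mulᵀ W (mulᵀ V u) ≡ u
      index    : Triangular.α T * Triangular.δ T ≡ + ∣ determinant M ∣

  sign-of : ∀ k → k ≢ 0ℤ → ∃[ ε ] ε * ε ≡ 1ℤ × ε * k ≡ + ∣ k ∣ × 0ℤ < ε * k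
  sign-of (+ zero)    k≢0 = ⊥-elim (k≢0 refl)
  sign-of (+ (suc n)) k≢0 = 1ℤ , refl , ℤₚ.*-identityˡ _ , subst (0ℤ <_) (≡.sym (ℤₚ.*-identityˡ _)) (+<+ (s≤s z≤n))
  sign-of -[1+ n ]    k≢0 = - 1ℤ , refl , lem (+ suc n) , subst (0ℤ <_) (≡.sym (lem (+ suc n))) (+<+ (s≤s z≤n))
    where
    lem : ∀ i → - 1ℤ * - i ≡ i
    lem = solve-∀

  -- The second column is g times the primitive vector (b, d), which the matrix `W` with rows ε(d,
  -- -b) and (s, t) sends to (0, 1). The sign ε makes the other diagonal entry positive.
  reduced : ∀ a b c d s t g → s * b + t * d ≡ 1ℤ → 0ℤ < g → a * d - b * c ≢ 0ℤ → Hermite (matrix a (b * g) c (d * g))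
  reduced a b c d s t g bez 0<g k≢0 with sign-of (a * d - b * c) k≢0
  ... | ε , εε , εk , 0<εk = record
    { W = matrix (ε * d) (- (ε * b)) s t
    ; V = matrix (ε * t) b (- (ε * s)) d
    ; VW = λ (x , y) → cong₂ _,_
        (modulo (t * d * x - t * b * y) x (vw₁ ε b d s t x y)) (modulo (s * b * y - s * d * x) y (vw₂ ε b d s t x y))
    ; WV = λ (x , y) → cong₂ _,_
        (modulo (d * t * x + b * s * x) x (wv₁ ε b d s t x y)) (modulo 0ℤ y (wv₂ ε b d s t x y))
    ; T = record { α = ε * (a * d - b * c) ; γ = s * a + t * c ; δ = g ; 0<α = 0<εk ; 0<δ = 0<g }
    ; factor = λ (x , y) → cong₂ _,_ (f₁ ε a b c d g x y) (modulo 0ℤ (g * y) (f₂ ε a b c d s t g x y))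
    ; factorᵀ = λ (x , y) → cong₂ _,_ (f₃ ε a b c d s t x y) (modulo 0ℤ (g * y) (f₄ ε b d s t g x y))
    ; VWᵀ = λ (x , y) → cong₂ _,_
        (modulo (t * d * x - s * d * y) x (vwᵀ₁ ε b d s t x y))
            (modulo (s * b * y - b * t * x) y (vwᵀ₂ ε b d s t x y))
    ; index = ≡.trans (cong₂ _*_ εk (≡.sym (ℤₚ.0≤i⇒+∣i∣≡i (ℤₚ.<⇒≤ 0<g))))
        (≡.trans (≡.sym (ℤₚ.pos-* ∣ a * d - b * c ∣ ∣ g ∣))
            (cong +_ (≡.trans (≡.sym (ℤₚ.abs-* (a * d - b * c) g)) (cong ∣_∣ (detₗ a b c d g))))) }
    where
    -- Identities hold modulo the relations ε² = 1 and s b + t d = 1.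
    modulo : ∀ {i j} p q → i ≡ j + p * (ε * ε - 1ℤ) + q * (s * b + t * d - 1ℤ) → i ≡ j
    modulo {i} {j} p q e = ≡.trans e (≡.trans (cong₂ (λ x y → j + p * (x - 1ℤ) + q * (y - 1ℤ)) εε bez) (vanish j p q))
      where
      vanish : ∀ j p q → j + p * (1ℤ - 1ℤ) + q * (1ℤ - 1ℤ) ≡ j
      vanish = solve-∀
    vw₁ : ∀ ε b d s t x y → ε * t * (ε * d * x + - (ε * b) * y) + b * (s * x + t * y) ≡
          x + (t * d * x - t * b * y) * (ε * ε - 1ℤ) + x * (s * b + t * d - 1ℤ)
    vw₁ = solve-∀
    vw₂ : ∀ ε b d s t x y → - (ε * s) * (ε * d * x + - (ε * b) * y) + d * (s * x + t * y) ≡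
          y + (s * b * y - s * d * x) * (ε * ε - 1ℤ) + y * (s * b + t * d - 1ℤ)
    vw₂ = solve-∀
    wv₁ : ∀ ε b d s t x y → ε * d * (ε * t * x + b * y) + - (ε * b) * (- (ε * s) * x + d * y) ≡
          x + (d * t * x + b * s * x) * (ε * ε - 1ℤ) + x * (s * b + t * d - 1ℤ)
    wv₁ = solve-∀
    wv₂ : ∀ ε b d s t x y → s * (ε * t * x + b * y) + t * (- (ε * s) * x + d * y) ≡
          y + 0ℤ * (ε * ε - 1ℤ) + y * (s * b + t * d - 1ℤ)
    wv₂ = solve-∀
    f₁ : ∀ ε a b c d g x y → ε * d * (a * x + b * g * y) + - (ε * b) * (c * x + d * g * y) ≡ ε * (a * d - b * c) * x
    f₁ = solve-∀
    f₂ : ∀ ε a b c d s t g x y → s * (a * x + b * g * y) + t * (c * x + d * g * y) ≡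
         (s * a + t * c) * x + g * y + 0ℤ * (ε * ε - 1ℤ) + g * y * (s * b + t * d - 1ℤ)
    f₂ = solve-∀
    f₃ : ∀ ε a b c d s t x y → a * (ε * d * x + s * y) + c * (- (ε * b) * x + t * y) ≡ ε * (a * d - b * c) * x +
        (s * a + t * c) * y
    f₃ = solve-∀
    f₄ : ∀ ε b d s t g x y → b * g * (ε * d * x + s * y) + d * g * (- (ε * b) * x + t * y) ≡
         g * y + 0ℤ * (ε * ε - 1ℤ) + g * y * (s * b + t * d - 1ℤ)
    f₄ = solve-∀
    vwᵀ₁ : ∀ ε b d s t x y → ε * d * (ε * t * x + - (ε * s) * y) + s * (b * x + d * y) ≡
           x + (t * d * x - s * d * y) * (ε * ε - 1ℤ) + x * (s * b + t * d - 1ℤ)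
    vwᵀ₁ = solve-∀
    vwᵀ₂ : ∀ ε b d s t x y → - (ε * b) * (ε * t * x + - (ε * s) * y) + t * (b * x + d * y) ≡
           y + (s * b * y - b * t * x) * (ε * ε - 1ℤ) + y * (s * b + t * d - 1ℤ)
    vwᵀ₂ = solve-∀
    detₗ : ∀ a b c d g → (a * d - b * c) * g ≡ a * (d * g) - b * g * c
    detₗ = solve-∀

  hermite : ∀ M → determinant M ≢ 0ℤ → Hermite M
  hermite (matrix a b c d) det≢0 = subst₂ (λ i j → Hermite (matrix a i c j)) (≡.sym eb) (≡.sym ed)
      (reduced a b′ c d′ s t (+ g) bez′ (ℤₚ.positive⁻¹ (+ g)) k≢0)
    where
    g = gcd ∣ b ∣ ∣ d ∣
    divides-b = ∣ᵤ⇒∣ {+ g} {b} (gcd[m,n]∣m ∣ b ∣ ∣ d ∣)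
    divides-d = ∣ᵤ⇒∣ {+ g} {d} (gcd[m,n]∣n ∣ b ∣ ∣ d ∣)
    b′ = _∣_.quotient divides-b
    d′ = _∣_.quotient divides-d
    eb : b ≡ b′ * + g
    eb = _∣_.equality divides-b
    ed : d ≡ d′ * + g
    ed = _∣_.equality divides-d
    s = proj₁ (bézout b d)
    t = proj₁ (proj₂ (bézout b d))
    bez = proj₂ (proj₂ (bézout b d))
    instance
      g≢0 : ℕ.NonZero g
      g≢0 = ℕ.≢-nonZero λ g≡0 → det≢0 (≡.trans
        (cong₂ (λ i j → a * j - i * c) (ℤₚ.∣i∣≡0⇒i≡0 {b} (gcd[m,n]≡0⇒m≡0 {∣ b ∣} {∣ d ∣} g≡0))
            (ℤₚ.∣i∣≡0⇒i≡0 {d} (gcd[m,n]≡0⇒n≡0 ∣ b ∣ {∣ d ∣} g≡0))) (lem a c))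
        where
        lem : ∀ a c → a * 0ℤ - 0ℤ * c ≡ 0ℤ
        lem = solve-∀
      +g>0 : ℤ.Positive (+ g)
      +g>0 = ℤ.positive (+<+ (ℕ.>-nonZero⁻¹ g))
      +g≢0 : ℤ.NonZero (+ g)
      +g≢0 = g≢0
    bez′ : s * b′ + t * d′ ≡ 1ℤ
    bez′ = ℤₚ.*-cancelʳ-≡ _ 1ℤ (+ g)
        (≡.trans (lem s b′ t d′ (+ g))
        (≡.trans (cong₂ (λ i j → s * i + t * j) (≡.sym eb) (≡.sym ed)) (≡.trans bez (≡.sym (ℤₚ.*-identityˡ (+ g))))))
      where
      lem : ∀ s b t d g → (s * b + t * d) * g ≡ s * (b * g) + t * (d * g)
      lem = solve-∀
    k≢0 : a * d′ - b′ * c ≢ 0ℤ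
    k≢0 e = det≢0 (≡.trans (cong₂ (λ i j → a * j - i * c) eb ed)
        (≡.trans (lem a b′ c d′ (+ g)) (≡.trans (cong (_* + g) e) (ℤₚ.*-zeroˡ (+ g)))))
      where
      lem : ∀ a b c d g → a * (d * g) - b * g * c ≡ (a * d - b * c) * g
      lem = solve-∀

  cross-apply : ∀ T f F → cross (Triangular.apply T f) (map (Triangular.apply T) F) ≡ ∣ Triangular.α T *
      Triangular.δ T ∣ ℕ.* cross f F
  cross-apply T f [] = ≡.sym (ℕₚ.*-zeroʳ ∣ Triangular.α T * Triangular.δ T ∣)
  cross-apply T f (g ∷ F) = ≡.trans
      (cong₂ ℕ._+_ (≡.trans (cong ∣_∣ (Triangular.det-apply T f g)) (ℤₚ.abs-* (α * δ) (det f g))) (cross-apply T f F))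
      (≡.sym (ℕₚ.*-distribˡ-+ ∣ α * δ ∣ ∣ det f g ∣ (cross f F)))
    where open Triangular T

  area-apply : ∀ T F → area (map (Triangular.apply T) F) ≡ ∣ Triangular.α T * Triangular.δ T ∣ ℕ.* area F
  area-apply T [] = ≡.sym (ℕₚ.*-zeroʳ ∣ Triangular.α T * Triangular.δ T ∣)
  area-apply T (f ∷ F) = ≡.trans (cong₂ ℕ._+_ (cross-apply T f F) (area-apply T F))
      (≡.sym (ℕₚ.*-distribˡ-+ ∣ Triangular.α T * Triangular.δ T ∣ (cross f F) (area F)))

  perimeter-cong : ∀ F {f g : Pt → Pt} → (∀ z → content (f z) ≡ content (g z)) → perimeter (map f F) ≡ perimeter
      (map g F)
  perimeter-cong []      eq = refl
  perimeter-cong (x ∷ F) eq = cong₂ ℕ._+_ (eq x) (perimeter-cong F eq)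

  module _ {H : Pt → ℤ} (B : Boundary H) (M : Matrix) (N : Hermite M) where
    open Boundary B
    open Hermite N
    private module T = Triangular T

    same-content : ∀ z → content (T.apply z) ≡ content (mul M z)
    same-content z = ≡.trans (cong content (≡.sym (factor z)))
      (ℕ∣.∣-antisym (subst (λ w → content (mul W (mul M z)) ℕ∣.∣ content w) (VW (mul M z))
          (content-∣ V (mul W (mul M z))))
                    (content-∣ W (mul M z)))

    dominated-W : ∀ z → Dominated (H ∘ mulᵀ M) z → Dominated (H ∘ T.transpose) (mul W z)
    dominated-W z dom u = subst₂ _≤_ (≡.sym (dot-mul W z u)) (cong H (factorᵀ u)) (dom (mulᵀ W u))

    dominated-V : ∀ z → Dominated (H ∘ T.transpose) z → Dominated (H ∘ mulᵀ M) (mul V z)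
    dominated-V z dom u = subst₂ _≤_ (≡.sym (dot-mul V z u))
        (≡.trans (cong H (≡.sym (factorᵀ (mulᵀ V u)))) (cong (λ w → H (mulᵀ M w)) (VWᵀ u))) (dom (mulᵀ V u))

    count-transfer : ∀ {k} n a b p q → n ≡ ∣ determinant M ∣ →
      area (map T.apply up) ≡ n ℕ.* a → area (map T.apply lo) ≡ n ℕ.* b →
      perimeter (map T.apply up) ≡ p → perimeter (map T.apply lo) ≡ q →
      2 ℕ.* k ≡ area (map T.apply up) ℕ.+ area (map T.apply lo) ℕ.+ perimeter (map T.apply up) ℕ.+ perimeter
          (map T.apply lo) ℕ.+ 2 →
      2 ℕ.* k ≡ ∣ determinant M ∣ ℕ.* (a ℕ.+ b) ℕ.+ (p ℕ.+ q) ℕ.+ 2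
    count-transfer n a b p q refl e₁ e₂ e₃ e₄ e rewrite e₁ | e₂ | e₃ | e₄ = ≡.trans e
      (cong (ℕ._+ 2) (≡.trans (ℕₚ.+-assoc (n ℕ.* a ℕ.+ n ℕ.* b) p q)
          (cong (ℕ._+ (p ℕ.+ q)) (≡.sym (ℕₚ.*-distribˡ-+ n a b)))))

    pick-hermite : ∃[ k ] Enumeration (Dominated (H ∘ mulᵀ M)) k ×
      2 ℕ.* k ≡ ∣ determinant M ∣ ℕ.* (area up ℕ.+ area lo) ℕ.+
          (perimeter (map (mul M) up) ℕ.+ perimeter (map (mul M) lo)) ℕ.+ 2
    pick-hermite = let k , E , e = pick (T.boundary-apply B) in k ,
      enumeration-map (mul V) (mul W) WV VW (λ {z} → dominated-V z) (λ {z} → dominated-W z) E ,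
      count-transfer {k} ∣ T.α * T.δ ∣ (area up) (area lo) _ _ (cong ∣_∣ index) (area-apply T up) (area-apply T lo)
        (perimeter-cong up same-content) (perimeter-cong lo same-content) e

  abstract
    -- If `M` expresses L in L′, the points of L′ in P are the integer points of MP, whose support
    -- function is `H ∘ mulᵀ M`. They are counted for the triangular form and carried back by `V`.
    -- The area is multiplied by the determinant, while lattice lengths have to be taken after
    -- applying `M`.
    pick-matrix : ∀ {H} (B : Boundary H) M → determinant M ≢ 0ℤ → let open Boundary B in
      ∃[ k ] Enumeration (Dominated (H ∘ mulᵀ M)) k ×
             2 ℕ.* k ≡ ∣ determinant M ∣ ℕ.* (area up ℕ.+ area lo) ℕ.+
                 (perimeter (map (mul M) up) ℕ.+ perimeter (map (mul M) lo)) ℕ.+ 2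
    pick-matrix B M det≢0 = pick-hermite B M (hermite M det≢0)

-- Recovering the multiset of primitive edges from boundary lengths.

module Decomposition where
  open ℤ using (ℤ; +_; -[1+_]; 0ℤ; 1ℤ; _+_; _*_; _-_; -_; _≤_; _<_; +<+; +≤+; ∣_∣)
  open import Data.Nat.GCD using (gcd; gcd[m,n]∣m; gcd[m,n]∣n; gcd-greatest; gcd-identityˡ; gcd-identityʳ; gcd[m,n]≡0⇒m≡0; gcd[m,n]≡0⇒n≡0; c*gcd[m,n]≡gcd[cm,cn])
  open import Data.Nat.Coprimality using (Coprime; coprime-divisor; gcd≡1⇒coprime) renaming (sym to Coprime-sym)
  import Data.Nat.Divisibility as ℕ∣
  open import Data.Integer.Divisibility.Signed using (_∣_; ∣ᵤ⇒∣)
  open Plane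
  open Chains
  open Support
  open Pick
  open PickTheorem
  open Matrices hiding (reduced)
  open Matrix

  Primitive : Pt → Set
  Primitive f = content f ≡ 1

  primitive-part : ∀ f → LexPos f → ∃[ f′ ] LexPos f′ × Primitive f′ × f ≡ + content f ⊡ f′
  primitive-part f@(p , q) f>0 = (p′ , q′) , positive f>0 , prim , cong₂ _,_ ep eq
    where
    g = content f
    div-p = ∣ᵤ⇒∣ {+ g} {p} (gcd[m,n]∣m ∣ p ∣ ∣ q ∣)
    div-q = ∣ᵤ⇒∣ {+ g} {q} (gcd[m,n]∣n ∣ p ∣ ∣ q ∣)
    p′ = _∣_.quotient div-p
    q′ = _∣_.quotient div-q
    ep : p ≡ + g * p′
    ep = ≡.trans (_∣_.equality div-p) (ℤₚ.*-comm p′ (+ g))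
    eq : q ≡ + g * q′
    eq = ≡.trans (_∣_.equality div-q) (ℤₚ.*-comm q′ (+ g))
    g≢0 : g ≢ 0
    g≢0 g≡0 = nonzero f>0 (ℤₚ.∣i∣≡0⇒i≡0 {p} (gcd[m,n]≡0⇒m≡0 {∣ p ∣} {∣ q ∣} g≡0))
        (ℤₚ.∣i∣≡0⇒i≡0 {q} (gcd[m,n]≡0⇒n≡0 ∣ p ∣ {∣ q ∣} g≡0))
      where
      nonzero : LexPos (p , q) → p ≡ 0ℤ → q ≢ 0ℤ
      nonzero (inj₁ 0<p)       refl _    = ℤₚ.<-irrefl refl 0<p
      nonzero (inj₂ (_ , 0<q)) _    refl = ℤₚ.<-irrefl refl 0<q
    instance
      g-nonZero : ℕ.NonZero g
      g-nonZero = ℕ.≢-nonZero g≢0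
    0<g : 0ℤ < + g
    0<g = +<+ (ℕ.>-nonZero⁻¹ g)
    cancel-< : ∀ {i j} → i ≡ + g * j → 0ℤ < i → 0ℤ < j
    cancel-< {i} {j} e 0<i = ℤₚ.*-cancelˡ-<-nonNeg (+ g) (subst₂ _<_ (≡.sym (ℤₚ.*-zeroʳ (+ g))) e 0<i)
    positive : LexPos (p , q) → LexPos (p′ , q′)
    positive (inj₁ 0<p)         = inj₁ (cancel-< ep 0<p)
    positive (inj₂ (p≡0 , 0<q)) = inj₂
        (ℤₚ.*-cancelˡ-≡ (+ g) p′ 0ℤ {{g-nonZero}} (≡.trans (≡.sym ep) (≡.trans p≡0 (≡.sym (ℤₚ.*-zeroʳ (+ g))))) ,
        cancel-< eq 0<q)
    prim : gcd ∣ p′ ∣ ∣ q′ ∣ ≡ 1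
    prim = ℕₚ.*-cancelˡ-≡ (gcd ∣ p′ ∣ ∣ q′ ∣) 1 g (≡.trans (c*gcd[m,n]≡gcd[cm,cn] g ∣ p′ ∣ ∣ q′ ∣)
      (≡.trans (cong₂ gcd (≡.trans (≡.sym (ℤₚ.abs-* (+ g) p′)) (cong ∣_∣ (≡.sym ep)))
          (≡.trans (≡.sym (ℤₚ.abs-* (+ g) q′)) (cong ∣_∣ (≡.sym eq)))) (≡.sym (ℕₚ.*-identityʳ g))))

  pos-* : ∀ n i → pos (+ n * i) ≡ + n * pos i
  pos-* n i = ≡.trans (cong (ℤ._⊔ (+ n * i)) (≡.sym (ℤₚ.*-zeroʳ (+ n)))) (≡.sym (ℤₚ.*-distribˡ-⊔-nonNeg (+ n) 0ℤ i))

  dot-⊡ : ∀ n f u → dot (n ⊡ f) u ≡ n * dot f u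
  dot-⊡ n (p , q) (a , b) = lem n p q a b
    where
    lem : ∀ n p q a b → n * p * a + n * q * b ≡ n * (p * a + q * b)
    lem = solve-∀

  replicate-total : ∀ n f → total (List.replicate n f) ≡ + n ⊡ f
  replicate-total zero    f       = refl
  replicate-total (suc n) (p , q) = ≡.trans (cong ((p , q) ⊞_) (replicate-total n (p , q)))
      (cong₂ _,_ (lem (+ n) p) (lem (+ n) q))
    where
    lem : ∀ n p → p + n * p ≡ (1ℤ + n) * p
    lem = solve-∀

  replicate-zono : ∀ n f u → zono (List.replicate n f) u ≡ pos (dot (+ n ⊡ f) u)
  replicate-zono n f u = ≡.trans (times n) (≡.trans (≡.sym (pos-* n (dot f u))) (cong pos (≡.sym (dot-⊡ (+ n) f u))))
    where
    lem : ∀ n p → p + n * p ≡ (1ℤ + n) * p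
    lem = solve-∀
    times : ∀ n → zono (List.replicate n f) u ≡ + n * pos (dot f u)
    times zero    = refl
    times (suc n) = ≡.trans (cong (λ i → pos (dot f u) + i) (times n)) (lem (+ n) (pos (dot f u)))

  record Refined (F : List Pt) : Set where
    field
      list      : List Pt
      positive  : All LexPos list
      reduced   : All Primitive list
      total≡    : total list ≡ total F
      zono≡     : ∀ u → zono list u ≡ zono F u

  -- Parallel copies of an edge have products of the same sign with `u`, so cutting an edge into
  -- equal pieces does not change the zonotope.
  refine : ∀ F → All LexPos F → Refined F
  refine [] [] = record { list = [] ; positive = [] ; reduced = [] ; total≡ = refl ; zono≡ = λ _ → refl }
  refine (f ∷ F) (f>0 ∷ F>0) with primitive-part f f>0 | refine F F>0
  ... | f′ , f′>0 , prim , e | R = record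
    { list = List.replicate (content f) f′ ++ R.list
    ; positive = Allₚ.++⁺ (Allₚ.replicate⁺ (content f) f′>0) R.positive
    ; reduced = Allₚ.++⁺ (Allₚ.replicate⁺ (content f) prim) R.reduced
    ; total≡ = ≡.trans (total-++ (List.replicate (content f) f′) R.list)
          (cong₂ _⊞_ (≡.trans (replicate-total (content f) f′) (≡.sym e)) R.total≡)
    ; zono≡ = λ u → ≡.trans (zono-++ (List.replicate (content f) f′) R.list u)
        (cong₂ _+_ (≡.trans (replicate-zono (content f) f′ u) (cong (λ w → pos (dot w u)) (≡.sym e))) (R.zono≡ u)) }
    where module R = Refined R

  -- A primitive vector directed to the right is determined by its line. Once all edges are
  -- primitive, the total length in one direction is a multiplicity.
  record PrimitiveBoundary (H : Pt → ℤ) : Set where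
    field
      boundary′ : Boundary H
    open Boundary boundary′ public
    field
      up-primitive : All Primitive up
      lo-primitive : All Primitive lo

  primitive-boundary : ∀ {H} → Boundary H → PrimitiveBoundary H
  primitive-boundary B = record
    { boundary′ = record
      { base = base ; up = U.list ; lo = L.list ; up>0 = U.positive ; lo>0 = L.positive
      ; closed = ≡.trans U.total≡ (≡.trans closed (≡.sym L.total≡))
      ; upper = λ u p → ≡.trans (upper u p) (cong (λ i → dot base u + i) (≡.sym (U.zono≡ u)))
      ; lower = λ u p → ≡.trans (lower u p) (cong (λ i → dot base u + i) (≡.sym (L.zono≡ u))) }
    ; up-primitive = U.reduced ; lo-primitive = L.reduced }
    where
    open Boundary B
    module U = Refined (refine up up>0)
    module L = Refined (refine lo lo>0)

  perimeter-++ : ∀ F G → perimeter (F ++ G) ≡ perimeter F ℕ.+ perimeter G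
  perimeter-++ []      G = refl
  perimeter-++ (f ∷ F) G = ≡.trans (cong (content f ℕ.+_) (perimeter-++ F G)) (≡.sym (ℕₚ.+-assoc (content f) _ _))

  -- Stretching by k along e multiplies the lattice length of the edges parallel
  -- to e by k and, for suitable k, leaves that of all others unchanged.
  stretch : ℕ → Pt → Matrix
  stretch k (r , s) = matrix (+ k * r) (+ k * s) (- s) r

  stretch-mul : ∀ k e f → mul (stretch k e) f ≡ (+ k * dot f e , det e f)
  stretch-mul k (r , s) (x , y) = cong₂ _,_ (lem₁ (+ k) r s x y) (lem₂ r s x y)
    where
    lem₁ : ∀ k r s x y → k * r * x + k * s * y ≡ k * (x * r + y * s)
    lem₁ = solve-∀
    lem₂ : ∀ r s x y → - s * x + r * y ≡ r * y - s * x
    lem₂ = solve-∀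

  stretch-det : ∀ k e → determinant (stretch k e) ≡ + k * dot e e
  stretch-det k (r , s) = lem (+ k) r s
    where
    lem : ∀ k r s → k * r * r - k * s * - s ≡ k * (r * r + s * s)
    lem = solve-∀

  dot-self>0 : ∀ e → LexPos e → 0ℤ < dot e e
  dot-self>0 (+ zero  , q) (inj₁ (+<+ ()))
  dot-self>0 (+ suc p , q) (inj₁ 0<p) = ℤₚ.+-mono-<-≤ (0<* 0<p 0<p) (0≤square q)
  dot-self>0 (p , q) (inj₂ (refl , 0<q)) = subst (0ℤ <_) (≡.sym (ℤₚ.+-identityˡ (q * q))) (0<* 0<q 0<q)

  -- For admissible k the boundary length after stretching is an affine function of k, with slope
  -- `parallel` and intercept `transverse`: a parallel edge f becomes (k f·e, 0), and the gcd
  -- belonging to any other edge ignores the factor k.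
  parallel transverse : Pt → List Pt → ℕ
  parallel e [] = 0
  parallel e (f ∷ F) with det e f ℤₚ.≟ 0ℤ
  ... | yes _ = ∣ dot f e ∣ ℕ.+ parallel e F
  ... | no _  = parallel e F
  transverse e [] = 0
  transverse e (f ∷ F) with det e f ℤₚ.≟ 0ℤ
  ... | yes _ = transverse e F
  ... | no _  = gcd ∣ dot f e ∣ ∣ det e f ∣ ℕ.+ transverse e F

  coprime-gcd : ∀ k d t → Coprime k t → gcd (k ℕ.* d) t ≡ gcd d t
  coprime-gcd k d t cop = ℕ∣.∣-antisym
    (gcd-greatest (coprime-divisor (λ (x , y) → cop (y , ℕ∣.∣-trans x (gcd[m,n]∣n (k ℕ.* d) t)))
        (gcd[m,n]∣m (k ℕ.* d) t)) (gcd[m,n]∣n (k ℕ.* d) t))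
    (gcd-greatest (ℕ∣.∣n⇒∣m*n k (gcd[m,n]∣m d t)) (gcd[m,n]∣n d t))

  CoprimeTo : ℕ → Pt → List Pt → Set
  CoprimeTo k e F = All (λ f → det e f ≢ 0ℤ → Coprime k ∣ det e f ∣) F

  perimeter-stretch : ∀ k e F → CoprimeTo k e F → perimeter (map (mul (stretch k e)) F) ≡ k ℕ.* parallel e F ℕ.+
      transverse e F
  perimeter-stretch k e [] [] = ≡.sym (≡.trans (ℕₚ.+-identityʳ _) (ℕₚ.*-zeroʳ k))
  perimeter-stretch k e (f ∷ F) (cop ∷ cops) with det e f ℤₚ.≟ 0ℤ
  ... | yes det≡0 = ≡.trans (cong₂ ℕ._+_
          (≡.trans (cong content (≡.trans (stretch-mul k e f) (cong (+ k * dot f e ,_) det≡0)))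
            (≡.trans (gcd-identityʳ _) (ℤₚ.abs-* (+ k) (dot f e))))
          (perimeter-stretch k e F cops))
        (≡.trans (≡.sym (ℕₚ.+-assoc (k ℕ.* ∣ dot f e ∣) _ _))
            (cong (ℕ._+ transverse e F) (≡.sym (ℕₚ.*-distribˡ-+ k ∣ dot f e ∣ (parallel e F)))))
  ... | no det≢0 = ≡.trans (cong₂ ℕ._+_
          (≡.trans (cong content (stretch-mul k e f))
              (≡.trans (cong (λ i → gcd i ∣ det e f ∣) (ℤₚ.abs-* (+ k) (dot f e)))
              (coprime-gcd k ∣ dot f e ∣ ∣ det e f ∣ (cop det≢0))))
          (perimeter-stretch k e F cops))
        (x∙yz≈y∙xz (gcd ∣ dot f e ∣ ∣ det e f ∣) (k ℕ.* parallel e F) (transverse e F))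
    where open import Algebra.Properties.CommutativeSemigroup ℕₚ.+-commutativeSemigroup using (x∙yz≈y∙xz)

  -- One more than the product of the nonzero determinants is coprime to each.
  dets : Pt → List Pt → ℕ
  dets e [] = 1
  dets e (f ∷ F) with det e f ℤₚ.≟ 0ℤ
  ... | yes _ = dets e F
  ... | no _  = ∣ det e f ∣ ℕ.* dets e F

  dets≢0 : ∀ e F → ℕ.NonZero (dets e F)
  dets≢0 e [] = _
  dets≢0 e (f ∷ F) with det e f ℤₚ.≟ 0ℤ
  ... | yes _    = dets≢0 e F
  ... | no det≢0 = ℕₚ.m*n≢0 ∣ det e f ∣ (dets e F) {{ℕ.≢-nonZero (λ z → det≢0 (ℤₚ.∣i∣≡0⇒i≡0 z))}} {{dets≢0 e F}}

  divides-dets : ∀ e F → All (λ f → det e f ≢ 0ℤ → ∣ det e f ∣ ℕ∣.∣ dets e F) F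
  divides-dets e [] = []
  divides-dets e (f ∷ F) with det e f ℤₚ.≟ 0ℤ
  ... | yes det≡0 = (λ ≢0 → ⊥-elim (≢0 det≡0)) ∷ divides-dets e F
  ... | no det≢0  = (λ _ → ℕ∣.m∣m*n (dets e F)) ∷ All.map (λ d ≢0 → ℕ∣.∣n⇒∣m*n ∣ det e f ∣ (d ≢0)) (divides-dets e F)

  coprime-dets : ∀ e F → CoprimeTo (suc (dets e F)) e F
  coprime-dets e F = All.map (λ {f} → widen {f}) (divides-dets e F)
    where
    coprime-suc : ∀ {m n} → m ℕ∣.∣ n → Coprime (suc n) m
    coprime-suc {n = n} m∣n {i} (x , y) = ℕ∣.∣1⇒≡1
        (ℕ∣.∣m+n∣m⇒∣n (subst (i ℕ∣.∣_) (ℕₚ.+-comm 1 n) x) (ℕ∣.∣-trans y m∣n))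
    widen : ∀ {f} → (det e f ≢ 0ℤ → ∣ det e f ∣ ℕ∣.∣ dets e F) → det e f ≢ 0ℤ → Coprime (suc (dets e F)) ∣ det e f ∣
    widen d ≢0 = coprime-suc (d ≢0)

  coprime-one : ∀ e F → CoprimeTo 1 e F
  coprime-one e F = All.universal one′ F
    where
    one : ∀ n → Coprime 1 n
    one n (x , _) = ℕ∣.∣1⇒≡1 x
    one′ : ∀ f → det e f ≢ 0ℤ → Coprime 1 ∣ det e f ∣
    one′ f _ = one ∣ det e f ∣

  -- Two stretching factors, 1 and D + 1, determine the slope: the difference of the two lengths is
  -- D times `parallel`.
  parallel-equal : ∀ e F G → LexPos e →
    (∀ M → determinant M ≢ 0ℤ → perimeter (map (mul M) F) ≡ perimeter (map (mul M) G)) → parallel e F ≡ parallel e G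
  parallel-equal e F G e>0 same = ℕₚ.*-cancelˡ-≡ _ _ D {{dets≢0 e (F ++ G)}} (cancel
      (at (suc D) (Allₚ.++⁻ F (coprime-dets e (F ++ G)))) (at 1 (coprime-one e F , coprime-one e G)))
    where
    D = dets e (F ++ G)
    at : ∀ k → {{ℕ.NonZero k}} → CoprimeTo k e F × CoprimeTo k e G → k ℕ.* parallel e F ℕ.+ transverse e F ≡ k ℕ.*
        parallel e G ℕ.+ transverse e G
    at k@(suc _) (cF , cG) = ≡.trans (≡.sym (perimeter-stretch k e F cF))
        (≡.trans (same (stretch k e) nonsingular) (perimeter-stretch k e G cG))
      where
      nonsingular : determinant (stretch k e) ≢ 0ℤ
      nonsingular z = ℤₚ.<-irrefl (≡.sym (≡.trans (≡.sym (stretch-det k e)) z))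
          (0<* {+ k} (+<+ (s≤s z≤n)) (dot-self>0 e e>0))
    cancel : ∀ {p q p′ q′} → suc D ℕ.* p ℕ.+ q ≡ suc D ℕ.* p′ ℕ.+ q′ → 1 ℕ.* p ℕ.+ q ≡ 1 ℕ.* p′ ℕ.+ q′ → D ℕ.* p ≡ D
        ℕ.* p′
    cancel {p} {q} {p′} {q′} e₁ e₂ = ℕₚ.+-cancelʳ-≡ (p ℕ.+ q) _ _
        (≡.trans (split p q) (≡.trans e₁ (≡.trans (≡.sym (split p′ q′)) (cong (D ℕ.* p′ ℕ.+_) (≡.sym e₂′)))))
      where
      e₂′ : p ℕ.+ q ≡ p′ ℕ.+ q′
      e₂′ = subst₂ (λ i j → i ℕ.+ q ≡ j ℕ.+ q′) (ℕₚ.*-identityˡ p) (ℕₚ.*-identityˡ p′) e₂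
      split : ∀ p q → D ℕ.* p ℕ.+ (p ℕ.+ q) ≡ suc D ℕ.* p ℕ.+ q
      split p q = ≡.trans (≡.sym (ℕₚ.+-assoc (D ℕ.* p) p q)) (cong (ℕ._+ q) (ℕₚ.+-comm (D ℕ.* p) p))

  bump : ∀ {P : Set} → Dec P → ℕ → ℕ
  bump (yes _) n = suc n
  bump (no _)  n = n

  multiplicity : Pt → List Pt → ℕ
  multiplicity e []      = 0
  multiplicity e (f ∷ F) = bump (e ≟ f) (multiplicity e F)

  -- By rq = sp and coprimality the first coordinates divide each other; lexicographic positivity
  -- excludes opposite vectors.
  parallel⇒≡ : ∀ e f → LexPos e → LexPos f → Primitive e → Primitive f → det e f ≡ 0ℤ → e ≡ f
  parallel⇒≡ e@(r , s) f@(p , q) e>0 f>0 pe pf det≡0 = same e>0 f>0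
    where
    prod : r * q ≡ s * p
    prod = ℤₚ.i-j≡0⇒i≡j (r * q) (s * p) det≡0
    abs-prod : ∣ r ∣ ℕ.* ∣ q ∣ ≡ ∣ s ∣ ℕ.* ∣ p ∣
    abs-prod = ≡.trans (≡.sym (ℤₚ.abs-* r q)) (≡.trans (cong ∣_∣ prod) (ℤₚ.abs-* s p))
    r∣p : ∣ r ∣ ℕ∣.∣ ∣ p ∣
    r∣p = coprime-divisor (gcd≡1⇒coprime pe) (ℕ∣.divides ∣ q ∣ (≡.trans (≡.sym abs-prod) (ℕₚ.*-comm ∣ r ∣ ∣ q ∣)))
    p∣r : ∣ p ∣ ℕ∣.∣ ∣ r ∣
    p∣r = coprime-divisor (gcd≡1⇒coprime pf) (ℕ∣.divides ∣ s ∣ (≡.trans (ℕₚ.*-comm ∣ q ∣ ∣ r ∣) abs-prod))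
    r≡p : r ≡ p
    r≡p = ≡.trans (≡.sym (ℤₚ.0≤i⇒+∣i∣≡i (LexNonNeg⇒0≤x (LexPos⇒LexNonNeg {e} e>0))))
        (≡.trans (cong +_ (ℕ∣.∣-antisym r∣p p∣r)) (ℤₚ.0≤i⇒+∣i∣≡i (LexNonNeg⇒0≤x (LexPos⇒LexNonNeg {f} f>0))))
    unit : ∀ {i j} → i ≡ 0ℤ → 0ℤ < j → gcd ∣ i ∣ ∣ j ∣ ≡ 1 → j ≡ 1ℤ
    unit {j = j} refl 0<j g≡1 = ≡.trans (≡.sym (ℤₚ.0≤i⇒+∣i∣≡i (ℤₚ.<⇒≤ 0<j)))
        (cong +_ (≡.trans (≡.sym (gcd-identityˡ ∣ j ∣)) g≡1))
    same : LexPos (r , s) → LexPos (p , q) → (r , s) ≡ (p , q)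
    same (inj₁ 0<r) _ = cong₂ _,_ r≡p
        (≡.sym (ℤₚ.*-cancelˡ-≡ r q s {{ℤ.>-nonZero 0<r}}
        (≡.trans prod (≡.trans (cong (s *_) (≡.sym r≡p)) (ℤₚ.*-comm s r)))))
    same (inj₂ (r≡0 , 0<s)) (inj₁ 0<p) = ⊥-elim (ℤₚ.<-irrefl (≡.trans (≡.sym r≡0) r≡p) 0<p)
    same (inj₂ (r≡0 , 0<s)) (inj₂ (p≡0 , 0<q)) = cong₂ _,_ r≡p (≡.trans (unit r≡0 0<s pe) (≡.sym (unit p≡0 0<q pf)))

  Good : Pt → Set
  Good f = LexPos f × Primitive f

  -- Every primitive edge parallel to `e` is `e` itself and contributes e·e to the slope.
  parallel-multiplicity : ∀ e F → Good e → All Good F → parallel e F ≡ multiplicity e F ℕ.* ∣ dot e e ∣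
  parallel-multiplicity e [] _ _ = refl
  parallel-multiplicity e (f ∷ F) ge@(e>0 , pe) ((f>0 , pf) ∷ gF) with det e f ℤₚ.≟ 0ℤ | e ≟ f
  ... | yes _ | yes refl = cong (∣ dot e e ∣ ℕ.+_) (parallel-multiplicity e F ge gF)
  ... | no _  | no _     = parallel-multiplicity e F ge gF
  ... | yes z | no e≢f   = ⊥-elim (e≢f (parallel⇒≡ e f e>0 f>0 pe pf z))
  ... | no z  | yes refl = ⊥-elim (z (det-self e))

  multiplicity-↭ : ∀ e {F G} → F ↭ G → multiplicity e F ≡ multiplicity e G
  multiplicity-↭ e Perm.refl = refl
  multiplicity-↭ e (prep f p) = cong (bump (e ≟ f)) (multiplicity-↭ e p)
  multiplicity-↭ e (swap {F} f g p) = ≡.trans (bump-comm (e ≟ f) (e ≟ g) (multiplicity e F))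
      (cong (bump (e ≟ g) ∘ bump (e ≟ f)) (multiplicity-↭ e p))
    where
    bump-comm : ∀ {P Q : Set} (p : Dec P) (q : Dec Q) n → bump p (bump q n) ≡ bump q (bump p n)
    bump-comm (yes _) (yes _) n = refl
    bump-comm (yes _) (no _)  n = refl
    bump-comm (no _)  (yes _) n = refl
    bump-comm (no _)  (no _)  n = refl
  multiplicity-↭ e (Perm.trans p q) = ≡.trans (multiplicity-↭ e p) (multiplicity-↭ e q)

  multiplicity-here : ∀ e F → multiplicity e (e ∷ F) ≡ suc (multiplicity e F)
  multiplicity-here e F with e ≟ e
  ... | yes _   = refl
  ... | no e≢e = ⊥-elim (e≢e refl)

  multiplicity>0 : ∀ e F → multiplicity e F ≢ 0 → e ∈ F
  multiplicity>0 e [] ≢0 = ⊥-elim (≢0 refl)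
  multiplicity>0 e (f ∷ F) ≢0 with e ≟ f
  ... | yes e≡f = here e≡f
  ... | no _    = there (multiplicity>0 e F ≢0)

  extract : ∀ {x : Pt} {xs} → x ∈ xs → ∃[ ys ] xs ↭ x ∷ ys
  extract {x} x∈ with ∈ₚ.∈-∃++ x∈
  ... | ys , zs , refl = ys ++ zs , Permₚ.shift x ys zs

  multiplicities⇒↭ : ∀ F G → All Good F → All Good G → (∀ e → Good e → multiplicity e F ≡ multiplicity e G) → F ↭ G
  multiplicities⇒↭ [] [] _ _ _ = ↭-refl
  multiplicities⇒↭ [] (g ∷ G) _ (gg ∷ _) eq = ⊥-elim (ℕₚ.0≢1+n (≡.trans (eq g gg) (multiplicity-here g G)))
  multiplicities⇒↭ (f ∷ F) G (gf ∷ gF) gG eq with extract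
      (multiplicity>0 f G (λ z → ℕₚ.0≢1+n (≡.trans (≡.sym z) (≡.trans (≡.sym (eq f gf)) (multiplicity-here f F)))))
  ... | G′ , p = ↭-trans (prep f (multiplicities⇒↭ F G′ gF (All.tail (Permₚ.All-resp-↭ p gG)) smaller)) (↭-sym p)
    where
    smaller : ∀ e → Good e → multiplicity e F ≡ multiplicity e G′
    smaller e ge with e ≟ f | ≡.trans (eq e ge) (multiplicity-↭ e p)
    ... | yes refl | q = ℕₚ.suc-injective q
    ... | no _     | q = q

  -- Riesz decomposition for multisets.
  record Common (A B C D : List Pt) : Set where
    field
      W X Y Z : List Pt
      A↭ : A ↭ W ++ X
      B↭ : B ↭ Y ++ Z
      C↭ : C ↭ W ++ Y
      D↭ : D ↭ X ++ Z

  common : ∀ A {B C D} → A ++ B ↭ C ++ D → Common A B C D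
  common [] {B} {C} {D} p = record
      { W = [] ; X = [] ; Y = C ; Z = D ; A↭ = ↭-refl ; B↭ = p ; C↭ = ↭-refl ; D↭ = ↭-refl }
  common (a ∷ A) {B} {C} {D} p with ∈ₚ.∈-++⁻ C (Permₚ.∈-resp-↭ p (here refl))
  ... | inj₁ a∈C with extract a∈C
  ...   | C′ , q = record { W = a ∷ W ; X = X ; Y = Y ; Z = Z ; A↭ = prep a A↭ ; B↭ = B↭ ; C↭ = ↭-trans q
        (prep a C↭) ; D↭ = D↭ }
    where open Common (common A {B} {C′} {D} (Permₚ.drop-∷ (↭-trans p (Permₚ.++⁺ʳ D q))))
  common (a ∷ A) {B} {C} {D} p | inj₂ a∈D with extract a∈D
  ...   | D′ , q = record { W = W ; X = a ∷ X ; Y = Y ; Z = Z ; A↭ = ↭-trans (prep a A↭) (↭-sym (Permₚ.shift a W X))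
        ; B↭ = B↭ ; C↭ = C↭ ; D↭ = ↭-trans q (prep a D↭) }
    where open Common (common A {B} {C} {D′} (Permₚ.drop-∷ (↭-trans p (↭-trans (Permₚ.++⁺ˡ C q) (Permₚ.shift a C D′)))))

-- Polygons with prescribed edges, and the summands X and Y.

module Summands where
  open ℤ using (ℤ; +_; -[1+_]; 0ℤ; _+_; _*_; _-_; -_; _≤_; _<_; ∣_∣)
  open import Data.Nat.GCD using (c*gcd[m,n]≡gcd[cm,cn])
  open Plane
  open Chains
  open Support
  open Pick
  open PickTheorem
  open Matrices hiding (reduced)
  open Matrix using (determinant; mul)
  open Decomposition

  -- The split into two functions makes the list of vertices visibly nonempty, as `support`
  -- requires.
  prefixes later-prefixes : List Pt → List Pt
  prefixes F = 𝟎 ∷ later-prefixes F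
  later-prefixes []      = []
  later-prefixes (f ∷ F) = map (f ⊞_) (prefixes F)

  prefix-split : ∀ {f F s} → s ∈ prefixes (f ∷ F) → s ≡ 𝟎 ⊎ (∃[ t ] t ∈ prefixes F × s ≡ f ⊞ t)
  prefix-split (here e)   = inj₁ e
  prefix-split (there s∈) = inj₂ (∈ₚ.∈-map⁻ _ s∈)

  dot-𝟎 : ∀ u → dot 𝟎 u ≡ 0ℤ
  dot-𝟎 (a , b) = lem a b
    where
    lem : ∀ a b → 0ℤ * a + 0ℤ * b ≡ 0ℤ
    lem = solve-∀

  prefix≤zono : ∀ F u {s} → s ∈ prefixes F → dot s u ≤ zono F u
  prefix≤zono F u (here refl) = subst (_≤ zono F u) (≡.sym (dot-𝟎 u)) (0≤zono F u)
  prefix≤zono (f ∷ F) u (there s∈) with ∈ₚ.∈-map⁻ (f ⊞_) s∈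
  ... | t , t∈ , refl = subst (_≤ zono (f ∷ F) u) (≡.sym (dot-⊞ˡ f t u))
        (ℤₚ.+-mono-≤ (≤pos (dot f u)) (prefix≤zono F u t∈))

  descending : ∀ f F u → LexPos f → All LexPos F → All (Steep f) F → Upward u → dot f u < 0ℤ → zono F u ≡ 0ℤ
  descending f [] u _ _ _ _ _ = refl
  descending f (g ∷ F) u f>0 (g>0 ∷ F>0) (fg ∷ fF) up neg =
    cong₂ _+_ (pos-≤ (steeper f g u f>0 (LexNonNeg⇒0≤x (LexPos⇒LexNonNeg {g} g>0)) fg up neg))
        (descending f F u f>0 F>0 fF up neg)

  -- In a sorted chain the edges that ascend in direction `u` come before those that descend, so the
  -- maximum is at the vertex between them.
  prefix-attains : ∀ F u → All LexPos F → AllPairs Steep F → Upward u → ∃[ s ] s ∈ prefixes F × dot s u ≡ zono F u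
  prefix-attains [] u _ _ _ = 𝟎 , here refl , dot-𝟎 u
  prefix-attains (f ∷ F) u (f>0 ∷ F>0) (fF ∷ FF) up with <-or-≥ (dot f u) 0ℤ
  ... | inj₁ neg = 𝟎 , here refl , ≡.trans (dot-𝟎 u)
        (≡.sym (cong₂ _+_ (pos-≤ (ℤₚ.<⇒≤ neg)) (descending f F u f>0 F>0 fF up neg)))
  ... | inj₂ p with prefix-attains F u F>0 FF up
  ...   | t , t∈ , e = f ⊞ t , there (∈ₚ.∈-map⁺ (f ⊞_) t∈) , ≡.trans (dot-⊞ˡ f t u) (cong₂ _+_ (≡.sym (pos-≥ p)) e)

  pos-mono : ∀ {i j} → i ≤ j → pos i ≤ pos j
  pos-mono {i} {j} i≤j = ℤₚ.⊔-lub (0≤pos j) (ℤₚ.≤-trans i≤j (≤pos j))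

  -- A concave chain lies above its chord.
  suffix≤chord : ∀ F u {s} → All LexPos F → AllPairs Steep F → Upward u → s ∈ prefixes F →
                 dot (s ⇢ total F) u ≤ pos (dot (total F) u)
  suffix≤chord F u {s} _ _ _ (here refl) = subst (λ w → dot w u ≤ pos (dot (total F) u)) (≡.sym (lem (total F)))
      (≤pos (dot (total F) u))
    where
    lem : ∀ w → 𝟎 ⇢ w ≡ w
    lem (a , b) = cong₂ _,_ (ℤₚ.+-identityʳ a) (ℤₚ.+-identityʳ b)
  suffix≤chord (f ∷ F) u (f>0 ∷ F>0) (fF ∷ FF) up (there s∈) with ∈ₚ.∈-map⁻ (f ⊞_) s∈
  ... | t , t∈ , refl = subst (λ w → dot w u ≤ pos (dot (f ⊞ total F) u)) (≡.sym (lem f t (total F)))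
          (ℤₚ.≤-trans (suffix≤chord F u F>0 FF up t∈) step)
    where
    lem₁ : ∀ a b c → a + c + - (a + b) ≡ c + - b
    lem₁ = solve-∀
    lem : ∀ f t T → (f ⊞ t) ⇢ (f ⊞ T) ≡ t ⇢ T
    lem (a , a′) (b , b′) (c , c′) = cong₂ _,_ (lem₁ a b c) (lem₁ a′ b′ c′)
    step : pos (dot (total F) u) ≤ pos (dot (f ⊞ total F) u)
    step with <-or-≥ (dot f u) 0ℤ
    ... | inj₁ neg = subst (_≤ pos (dot (f ⊞ total F) u))
          (≡.sym (pos-≤ (ℤₚ.≤-trans (dot-total≤zono F u) (ℤₚ.≤-reflexive (descending f F u f>0 F>0 fF up neg)))))
          (0≤pos (dot (f ⊞ total F) u))
    ... | inj₂ p = pos-mono (subst₂ _≤_ (ℤₚ.+-identityˡ (dot (total F) u)) (≡.sym (dot-⊞ˡ f (total F) u))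
          (ℤₚ.+-monoˡ-≤ (dot (total F) u) p))

  record Realization (F G : List Pt) : Set where
    field
      {size}   : ℕ
      vertices : Fin (suc size) → Pt
      upper    : ∀ u → Upward u → support vertices u ≡ zono F u
      lower    : ∀ u → Upward (⊟ u) → support vertices u ≡ zono G u

  -- The vertices are the partial sums of the edges in order of slope.
  realize-sorted : ∀ F G → All LexPos F → All LexPos G → AllPairs Steep F → AllPairs Steep G → total F ≡ total G →
      Realization F G
  realize-sorted F G F>0 G>0 FF GG closed = record
    { vertices = lookup vs
    ; upper = λ u up → let s , s∈ , e = prefix-attains F u F>0 FF up in
        support-list u (λ t∈ → [ prefix≤zono F u , below-up u up ]′ (∈ₚ.∈-++⁻ (prefixes F) t∈)) (∈ₚ.∈-++⁺ˡ s∈) e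
    ; lower = λ u down → let s , s∈ , e = prefix-attains G (⊟ u) G>0 GG down in
        support-list u (λ t∈ → [ above-lo u down , lo≤zono u ]′ (∈ₚ.∈-++⁻ (prefixes F) t∈))
            (∈ₚ.∈-++⁺ʳ (prefixes F) (∈ₚ.∈-map⁺ (_⇢ T) s∈))
          (≡.trans (suffix-dot s u) (≡.trans (cong (λ i → dot T u + i) (≡.trans e (zono-⊟ G u)))
              (lem (dot T u) (zono G u)))) }
    where
    T = total G
    -- The slopes of the lower boundary increase from left to right. Traversed backwards from its
    -- right end `T`, it meets the steepest edges first, hence the differences of `T` and the
    -- prefixes of `G`.
    vs = prefixes F ++ map (_⇢ T) (prefixes G)
    lem : ∀ t z → t + (z - t) ≡ z
    lem = solve-∀
    support-list : ∀ u {m} → (∀ {t} → t ∈ vs → dot t u ≤ m) → ∀ {s} → s ∈ vs → dot s u ≡ m → support (lookup vs) u ≡ m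
    support-list u ub s∈ e = support-unique (lookup vs) u (λ i → ub (∈ₚ.∈-lookup i))
        (Any.index s∈ , ≡.trans (cong (λ w → dot w u) (≡.sym (Anyₚ.lookup-index s∈))) e)
    suffix-dot : ∀ s u → dot (s ⇢ T) u ≡ dot T u + dot s (⊟ u)
    suffix-dot s u = ≡.trans (dot-⊞ˡ T (⊟ s) u) (cong (λ i → dot T u + i) (≡.trans (dot-⊟ˡ s u) (≡.sym (dot-⊟ʳ s u))))
    chord≤ : ∀ F u → pos (dot (total F) u) ≤ zono F u
    chord≤ F u = ℤₚ.⊔-lub (0≤zono F u) (dot-total≤zono F u)
    below-up : ∀ u → Upward u → ∀ {t} → t ∈ map (_⇢ T) (prefixes G) → dot t u ≤ zono F u
    below-up u up t∈ with ∈ₚ.∈-map⁻ (_⇢ T) t∈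
    ... | s , s∈ , refl = ℤₚ.≤-trans (suffix≤chord G u G>0 GG up s∈)
          (subst (λ w → pos (dot w u) ≤ zono F u) closed (chord≤ F u))
    lo≤zono : ∀ u {t} → t ∈ map (_⇢ T) (prefixes G) → dot t u ≤ zono G u
    lo≤zono u t∈ with ∈ₚ.∈-map⁻ (_⇢ T) t∈
    ... | s , s∈ , refl = subst₂ _≤_ (≡.sym (suffix-dot s u))
          (≡.trans (cong (λ i → dot T u + i) (zono-⊟ G u)) (lem (dot T u) (zono G u)))
            (ℤₚ.+-monoʳ-≤ (dot T u) (prefix≤zono G (⊟ u) s∈))
    above-lo : ∀ u → Upward (⊟ u) → ∀ {t} → t ∈ prefixes F → dot t u ≤ zono G u
    above-lo u down {t} t∈ = ℤₚ.≤-trans (≤-by (≤⇒0≤ (suffix≤chord F (⊟ u) F>0 FF down t∈)) (≡.trans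
        (cong (λ i → pos i - dot (t ⇢ total F) (⊟ u)) (dot-⊟ʳ (total F) u))
        (≡.trans (cong₂ (λ i j → i - j) (pos-neg (dot (total F) u))
            (≡.trans (dot-⊟ʳ (t ⇢ total F) u)
            (cong -_ (≡.trans (dot-⊞ˡ (total F) (⊟ t) u) (cong (λ i → dot (total F) u + i) (dot-⊟ˡ t u))))))
          (lem₂ (pos (dot (total F) u)) (dot (total F) u) (dot t u)))))
        (subst (λ w → pos (dot w u) ≤ zono G u) (≡.sym closed) (chord≤ G u))
      where
      lem₂ : ∀ p t s → p - t - - (t + - s) ≡ p - s
      lem₂ = solve-∀

  realize : ∀ F G → All LexPos F → All LexPos G → total F ≡ total G → Realization F G
  realize F G F>0 G>0 closed with sort F F>0 | sort G G>0
  ... | F′ , F↭ , FF | G′ , G↭ , GG = record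
    { vertices = vertices
    ; upper = λ u up → ≡.trans (upper u up) (zono-↭ u F↭)
    ; lower = λ u down → ≡.trans (lower u down) (zono-↭ u G↭) }
    where
    open Realization (realize-sorted F′ G′ (Permₚ.All-resp-↭ (↭-sym F↭) F>0) (Permₚ.All-resp-↭ (↭-sym G↭) G>0) FF GG
      (≡.trans (total-↭ F↭) (≡.trans closed (≡.sym (total-↭ G↭)))))

  realization-boundary : ∀ {F G} → All LexPos F → All LexPos G → total F ≡ total G → (R : Realization F G) →
      Boundary (support (Realization.vertices R))
  realization-boundary {F} {G} F>0 G>0 closed R = record
    { base = 𝟎 ; up = F ; lo = G ; up>0 = F>0 ; lo>0 = G>0 ; closed = closed
    ; upper = λ u up → ≡.trans (R.upper u up) (≡.sym (≡.trans (cong (_+ zono F u) (dot-𝟎 u)) (ℤₚ.+-identityˡ _)))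
    ; lower = λ u down → ≡.trans (R.lower u down)
          (≡.sym (≡.trans (cong (_+ zono G u) (dot-𝟎 u)) (ℤₚ.+-identityˡ _))) }
    where module R = Realization R

  boundaries-agree : ∀ {H H′} (B : Boundary H) (C : Boundary H′) → Boundary.up B ↭ Boundary.up C → Boundary.lo B ↭
      Boundary.lo C →
                     ∀ u → H u ≡ dot (Boundary.base C ⇢ Boundary.base B) u + H′ u
  boundaries-agree {H} {H′} B C up↭ lo↭ u with ℤₚ.≤-total 0ℤ (proj₂ u)
  ... | inj₁ up↑ = agree (zono-↭ u up↭) (B.upper u up↑) (C.upper u up↑)
    where
    module B = Boundary B
    module C = Boundary C
    lem : ∀ b c z → c + b + z ≡ b + (c + z)
    lem = solve-∀
    agree : ∀ {z z′} → z ≡ z′ → H u ≡ dot B.base u + z → H′ u ≡ dot C.base u + z′ → H u ≡ dot (C.base ⇢ B.base) u +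
        H′ u
    agree {z} refl e e′ = ≡.trans e
        (≡.trans (cong (_+ z) (dot-⇢ C.base B.base u))
        (≡.trans (lem (dot (C.base ⇢ B.base) u) (dot C.base u) z)
        (cong (λ i → dot (C.base ⇢ B.base) u + i) (≡.sym e′))))
  ... | inj₂ down = agree (zono-↭ u lo↭) (B.lower u (ℤₚ.neg-mono-≤ down)) (C.lower u (ℤₚ.neg-mono-≤ down))
    where
    module B = Boundary B
    module C = Boundary C
    lem : ∀ b c z → c + b + z ≡ b + (c + z)
    lem = solve-∀
    agree : ∀ {z z′} → z ≡ z′ → H u ≡ dot B.base u + z → H′ u ≡ dot C.base u + z′ → H u ≡ dot (C.base ⇢ B.base) u +
        H′ u
    agree {z} refl e e′ = ≡.trans e
        (≡.trans (cong (_+ z) (dot-⇢ C.base B.base u))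
        (≡.trans (lem (dot (C.base ⇢ B.base) u) (dot C.base u) z)
        (cong (λ i → dot (C.base ⇢ B.base) u + i) (≡.sym e′))))

  module _ {H : Pt → ℤ} (B : Boundary H) where
    open Boundary B

    doubled-area : ℕ
    doubled-area = area up ℕ.+ area lo

    boundary-length : Matrix → ℕ
    boundary-length M = perimeter (map (mul M) up) ℕ.+ perimeter (map (mul M) lo)

  -- The matrix belonging to the refinement of L to L/n.
  scalar : ℕ → Matrix
  scalar n = matrix (+ n) 0ℤ 0ℤ (+ n)

  perimeter-scalar : ∀ n F → perimeter (map (mul (scalar n)) F) ≡ n ℕ.* perimeter F
  perimeter-scalar n [] = ≡.sym (ℕₚ.*-zeroʳ n)
  perimeter-scalar n ((p , q) ∷ F) = ≡.trans
      (cong₂ ℕ._+_ (≡.trans (cong content (cong₂ _,_ (lem₁ (+ n) p q) (lem₂ (+ n) p q)))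
      (≡.trans (cong₂ gcd (ℤₚ.abs-* (+ n) p) (ℤₚ.abs-* (+ n) q)) (≡.sym (c*gcd[m,n]≡gcd[cm,cn] n ∣ p ∣ ∣ q ∣))))
      (perimeter-scalar n F)) (≡.sym (ℕₚ.*-distribˡ-+ n (content (p , q)) (perimeter F)))
    where
    open import Data.Nat.GCD using (gcd)
    lem₁ : ∀ n p q → n * p + 0ℤ * q ≡ n * p
    lem₁ = solve-∀
    lem₂ : ∀ n p q → 0ℤ * p + n * q ≡ n * q
    lem₂ = solve-∀

  boundary-length-scalar : ∀ {H} (B : Boundary H) n → boundary-length B (scalar n) ≡ n ℕ.* boundary-length B
      (scalar 1)
  boundary-length-scalar B n = ≡.trans (cong₂ ℕ._+_ (perimeter-scalar n up) (perimeter-scalar n lo))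
    (≡.trans (≡.sym (ℕₚ.*-distribˡ-+ n (perimeter up) (perimeter lo)))
      (cong (n ℕ.*_) (≡.sym (cong₂ ℕ._+_ (≡.trans (perimeter-scalar 1 up) (ℕₚ.*-identityˡ _))
          (≡.trans (perimeter-scalar 1 lo) (ℕₚ.*-identityˡ _))))))
    where open Boundary B

  -- Equal counting functions as Pick's theorem renders them, with matrices in place of finer
  -- lattices.
  SameCounts : ∀ {H H′} → Boundary H → Boundary H′ → Set
  SameCounts B C = ∀ M → determinant M ≢ 0ℤ →
    ∣ determinant M ∣ ℕ.* doubled-area B ℕ.+ boundary-length B M ≡ ∣ determinant M ∣ ℕ.* doubled-area C ℕ.+
        boundary-length C M

  -- With a the doubled area and b the boundary length, L gives a + b and L/2 gives 4a + 2b. Twice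
  -- the first subtracted from the second leaves 2a.
  same-area : ∀ {H H′} (B : Boundary H) (C : Boundary H′) → SameCounts B C → doubled-area B ≡ doubled-area C
  same-area B C same = ℕₚ.*-cancelˡ-≡ (doubled-area B) (doubled-area C) 2
      (ℕₚ.+-cancelʳ-≡ (2 ℕ.* (a ℕ.+ b)) (2 ℕ.* a) (2 ℕ.* c)
      (≡.trans (lem a b) (≡.trans (subst₂ (λ i j → 4 ℕ.* a ℕ.+ i ≡ 4 ℕ.* c ℕ.+ j) (boundary-length-scalar B 2)
          (boundary-length-scalar C 2) (same (scalar 2) (λ ())))
        (≡.trans (≡.sym (lem c d)) (cong (λ i → 2 ℕ.* c ℕ.+ 2 ℕ.* i) (≡.sym e))))))
    where
    open import Data.Nat.Tactic.RingSolver renaming (solve-∀ to solveℕ-∀)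
    a = doubled-area B
    b = boundary-length B (scalar 1)
    c = doubled-area C
    d = boundary-length C (scalar 1)
    e : a ℕ.+ b ≡ c ℕ.+ d
    e = subst₂ (λ i j → i ℕ.+ b ≡ j ℕ.+ d) (ℕₚ.*-identityˡ a) (ℕₚ.*-identityˡ c) (same (scalar 1) (λ ()))
    lem : ∀ a b → 2 ℕ.* a ℕ.+ 2 ℕ.* (a ℕ.+ b) ≡ 4 ℕ.* a ℕ.+ 2 ℕ.* b
    lem = solveℕ-∀

  record Summand (H H′ : Pt → ℤ) : Set where
    field
      {m n} : ℕ
      X     : Fin (suc m) → Pt
      Y     : Fin (suc n) → Pt
      v w   : Pt
      sum        : ∀ u → H u  ≡ dot v u + (support X u + support Y u)
      difference : ∀ u → H′ u ≡ dot w u + (support X u + support Y (⊟ u))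

  decompose : ∀ {H H′} (P : PrimitiveBoundary H) (Q : PrimitiveBoundary H′) →
              SameCounts (PrimitiveBoundary.boundary′ P) (PrimitiveBoundary.boundary′ Q) → Summand H H′
  decompose {H} {H′} P Q same = record
    { X = Realization.vertices RX ; Y = Realization.vertices RY
    ; v = Boundary.base (boundary-+ BX BY) ⇢ P.base ; w = Boundary.base (boundary-+ BX (boundary-⊟ BY)) ⇢ Q.base
    ; sum = boundaries-agree P.boundary′ (boundary-+ BX BY) A↭ (↭-trans B↭ (Permₚ.++-comm Y Z))
    ; difference = boundaries-agree Q.boundary′ (boundary-+ BX (boundary-⊟ BY)) C↭ (↭-trans D↭ (Permₚ.++-comm X Z)) }
    where
    module P = PrimitiveBoundary P
    module Q = PrimitiveBoundary Q
    equal-area = same-area P.boundary′ Q.boundary′ same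
    equal-length : ∀ M → determinant M ≢ 0ℤ → perimeter (map (mul M) (P.up ++ P.lo)) ≡ perimeter
        (map (mul M) (Q.up ++ Q.lo))
    equal-length M det≢0 = ≡.trans (split P.up P.lo)
        (≡.trans (ℕₚ.+-cancelˡ-≡ (∣ determinant M ∣ ℕ.* doubled-area P.boundary′) _ _
        (≡.trans (same M det≢0) (cong (λ a → ∣ determinant M ∣ ℕ.* a ℕ.+ boundary-length Q.boundary′ M)
            (≡.sym equal-area)))) (≡.sym (split Q.up Q.lo)))
      where
      split : ∀ F G → perimeter (map (mul M) (F ++ G)) ≡ perimeter (map (mul M) F) ℕ.+ perimeter (map (mul M) G)
      split F G = ≡.trans (cong perimeter (Listₚ.map-++ (mul M) F G)) (perimeter-++ (map (mul M) F) (map (mul M) G))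
    goodP : All Good (P.up ++ P.lo)
    goodP = All.zipWith id (Allₚ.++⁺ P.up>0 P.lo>0 , Allₚ.++⁺ P.up-primitive P.lo-primitive)
    goodQ : All Good (Q.up ++ Q.lo)
    goodQ = All.zipWith id (Allₚ.++⁺ Q.up>0 Q.lo>0 , Allₚ.++⁺ Q.up-primitive Q.lo-primitive)
    edges↭ : P.up ++ P.lo ↭ Q.up ++ Q.lo
    edges↭ = multiplicities⇒↭ _ _ goodP goodQ equal
      where
      equal : ∀ e → Good e → multiplicity e (P.up ++ P.lo) ≡ multiplicity e (Q.up ++ Q.lo)
      equal e ge@(e>0 , _) = ℕₚ.*-cancelʳ-≡ _ _ ∣ dot e e ∣
          {{ℕ.≢-nonZero λ z → ℤₚ.<-irrefl (≡.sym (ℤₚ.∣i∣≡0⇒i≡0 {dot e e} z)) (dot-self>0 e e>0)}}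
        (≡.trans (≡.sym (parallel-multiplicity e _ ge goodP))
            (≡.trans (parallel-equal e (P.up ++ P.lo) (Q.up ++ Q.lo) e>0 equal-length)
            (parallel-multiplicity e _ ge goodQ)))
    -- Here `W`, `X`, `Y`, `Z` are edge lists: `W` is upper in both polygons, `Z` lower in both, `X`
    -- upper in P and lower in Q, `Y` the reverse. The summand X of the theorem has upper edges `W`
    -- and lower edges `Z`; the summand Y has upper edges `X` and lower edges `Y`.
    open Common (common P.up {P.lo} {Q.up} {Q.lo} edges↭)
    X>0 = Allₚ.++⁻ʳ W (Permₚ.All-resp-↭ A↭ P.up>0)
    W>0 = Allₚ.++⁻ˡ W (Permₚ.All-resp-↭ A↭ P.up>0)
    Y>0 = Allₚ.++⁻ˡ Y (Permₚ.All-resp-↭ B↭ P.lo>0)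
    Z>0 = Allₚ.++⁻ʳ Y (Permₚ.All-resp-↭ B↭ P.lo>0)
    -- Closure of P and of Q reads w + x = y + z and w + y = x + z. The sum of the two gives 2w =
    -- 2z, the difference x - y = -(x - y).
    totals : ∀ {A B C D} (W X Y Z : List Pt) → A ↭ W ++ X → B ↭ Y ++ Z → C ↭ W ++ Y → D ↭ X ++ Z → total A ≡ total B
        → total C ≡ total D →
             total W ≡ total Z × total X ≡ total Y
    totals W X Y Z p q r s e f =
      cong₂ _,_ (half₁ {proj₁ (total W)} {proj₁ (total X)} (cong proj₁ e′) (cong proj₁ f′))
          (half₁ {proj₂ (total W)} {proj₂ (total X)} (cong proj₂ e′) (cong proj₂ f′)) ,
      cong₂ _,_ (half₂ {proj₁ (total W)} (cong proj₁ e′) (cong proj₁ f′))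
          (half₂ {proj₂ (total W)} (cong proj₂ e′) (cong proj₂ f′))
      where
      e′ : total W ⊞ total X ≡ total Y ⊞ total Z
      e′ = ≡.trans (≡.sym (≡.trans (total-↭ p) (total-++ W X))) (≡.trans e (≡.trans (total-↭ q) (total-++ Y Z)))
      f′ : total W ⊞ total Y ≡ total X ⊞ total Z
      f′ = ≡.trans (≡.sym (≡.trans (total-↭ r) (total-++ W Y))) (≡.trans f (≡.trans (total-↭ s) (total-++ X Z)))
      lem₁ : ∀ w x y → + 2 * w ≡ w + x + (w + y) - x - y
      lem₁ = solve-∀
      lem₂ : ∀ x y z → y + z + (x + z) - x - y ≡ + 2 * z
      lem₂ = solve-∀
      half₁ : ∀ {w x y z : ℤ} → w + x ≡ y + z → w + y ≡ x + z → w ≡ z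
      half₁ {w} {x} {y} {z} e f = ℤₚ.*-cancelˡ-≡ (+ 2) w z
          (≡.trans (lem₁ w x y) (≡.trans (cong₂ (λ i j → i + j - x - y) e f) (lem₂ x y z)))
      lem₃ : ∀ w x y → w + x - (w + y) ≡ x - y
      lem₃ = solve-∀
      lem₄ : ∀ x y z → y + z - (x + z) ≡ - (x - y)
      lem₄ = solve-∀
      self-neg : ∀ i → i ≡ - i → i ≡ 0ℤ
      self-neg (+ zero) _ = refl
      self-neg (+ suc n) ()
      self-neg -[1+ n ] ()
      half₂ : ∀ {w x y z} → w + x ≡ y + z → w + y ≡ x + z → x ≡ y
      half₂ {w} {x} {y} {z} e f = ℤₚ.i-j≡0⇒i≡j x y
          (self-neg (x - y) (≡.trans (≡.sym (lem₃ w x y)) (≡.trans (cong₂ _-_ e f) (lem₄ x y z))))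
    closures = totals W X Y Z A↭ B↭ C↭ D↭ P.closed Q.closed
    RX = realize W Z W>0 Z>0 (proj₁ closures)
    RY = realize X Y X>0 Y>0 (proj₂ closures)
    BX = realization-boundary W>0 Z>0 (proj₁ closures) RX
    BY = realization-boundary X>0 Y>0 (proj₂ closures) RY

-- Order and integer multiples in the real field.

module RealFacts {c ℓ₁ ℓ₂ : Level} (ℝ : RealField c ℓ₁ ℓ₂) where
  open RealField ℝ hiding (zero; refl; sym; trans; isEquivalence; complete)
  module R = RealField ℝ
  private
    module C = CommutativeRing R.commutativeRing
    module O = IsStrictPartialOrder R.isStrictPartialOrder
  open import Algebra.Properties.Ring C.ring using (-‿involutive; -‿distribˡ-*; -‿distribʳ-*; -0#≈0#; -‿+-comm)
  open import Algebra.Properties.Semiring.Mult C.semiring using (×-homo-+; ×1-homo-*)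
  open import Relation.Binary.Reasoning.Setoid C.setoid

  ℕ⇒ℝ : ℕ → Carrier
  ℕ⇒ℝ n = n · 1#

  fromℤ-⊖ : ∀ m n → fromℤ (m ℤ.⊖ n) ≈ ℕ⇒ℝ m + - ℕ⇒ℝ n
  fromℤ-⊖ zero    zero    = R.sym (R.trans (+-congˡ -0#≈0#) (+-identityʳ _))
  fromℤ-⊖ zero    (suc n) = R.sym (+-identityˡ _)
  fromℤ-⊖ (suc m) zero    = R.sym (R.trans (+-congˡ -0#≈0#) (+-identityʳ _))
  fromℤ-⊖ (suc m) (suc n) = begin
    fromℤ (suc m ℤ.⊖ suc n)               ≡⟨ cong fromℤ (ℤₚ.[1+m]⊖[1+n]≡m⊖n m n) ⟩
    fromℤ (m ℤ.⊖ n)                       ≈⟨ fromℤ-⊖ m n ⟩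
    M + - N                               ≈⟨ +-congʳ (R.sym (+-identityʳ M)) ⟩
    M + 0# + - N                          ≈⟨ +-congʳ (+-congˡ (R.sym (-‿inverseʳ 1#))) ⟩
    M + (1# + - 1#) + - N                 ≈⟨ +-congʳ (R.sym (+-assoc M 1# (- 1#))) ⟩
    M + 1# + - 1# + - N                   ≈⟨ +-congʳ (+-congʳ (+-comm M 1#)) ⟩
    1# + M + - 1# + - N                   ≈⟨ +-assoc (1# + M) (- 1#) (- N) ⟩
    1# + M + (- 1# + - N)                 ≈⟨ +-congˡ (-‿+-comm 1# N) ⟩
    1# + M + - (1# + N)                   ∎
    where
    M = ℕ⇒ℝ m
    N = ℕ⇒ℝ n

  fromℤ-neg : ∀ i → fromℤ (ℤ.- i) ≈ - fromℤ i
  fromℤ-neg ℤ.+0       = R.sym -0#≈0#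
  fromℤ-neg ℤ.+[1+ n ] = R.refl
  fromℤ-neg ℤ.-[1+ n ] = R.sym (-‿involutive _)

  fromℤ-+ : ∀ i j → fromℤ (i ℤ.+ j) ≈ fromℤ i + fromℤ j
  fromℤ-+ (ℤ.+ m)    (ℤ.+ n)    = ×-homo-+ 1# m n
  fromℤ-+ (ℤ.+ m)    ℤ.-[1+ n ] = fromℤ-⊖ m (suc n)
  fromℤ-+ ℤ.-[1+ m ] (ℤ.+ n)    = R.trans (fromℤ-⊖ n (suc m)) (+-comm _ _)
  fromℤ-+ ℤ.-[1+ m ] ℤ.-[1+ n ] = begin
    - ℕ⇒ℝ (suc (suc (m ℕ.+ n)))             ≡⟨ cong (λ k → - ℕ⇒ℝ (suc k)) (≡.sym (ℕₚ.+-suc m n)) ⟩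
    - ℕ⇒ℝ (suc m ℕ.+ suc n)                 ≈⟨ -‿cong (×-homo-+ 1# (suc m) (suc n)) ⟩
    - (ℕ⇒ℝ (suc m) + ℕ⇒ℝ (suc n))           ≈⟨ R.sym (-‿+-comm _ _) ⟩
    - ℕ⇒ℝ (suc m) + - ℕ⇒ℝ (suc n)           ∎

  fromℤ-*-pos : ∀ m j → fromℤ (ℤ.+ m ℤ.* j) ≈ ℕ⇒ℝ m * fromℤ j
  fromℤ-*-pos m (ℤ.+ n) = R.trans (R.reflexive (cong fromℤ (≡.sym (ℤₚ.pos-* m n)))) (×1-homo-* m n)
  fromℤ-*-pos m ℤ.-[1+ n ] = begin
    fromℤ (ℤ.+ m ℤ.* ℤ.- (ℤ.+ suc n))       ≡⟨ cong fromℤ (≡.sym (ℤₚ.neg-distribʳ-* (ℤ.+ m) (ℤ.+ suc n))) ⟩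
    fromℤ (ℤ.- (ℤ.+ m ℤ.* ℤ.+ suc n))       ≈⟨ fromℤ-neg (ℤ.+ m ℤ.* ℤ.+ suc n) ⟩
    - fromℤ (ℤ.+ m ℤ.* ℤ.+ suc n)           ≈⟨ -‿cong (fromℤ-*-pos m (ℤ.+ suc n)) ⟩
    - (ℕ⇒ℝ m * ℕ⇒ℝ (suc n))                 ≈⟨ -‿distribʳ-* (ℕ⇒ℝ m) (ℕ⇒ℝ (suc n)) ⟩
    ℕ⇒ℝ m * - ℕ⇒ℝ (suc n)                   ∎

  fromℤ-* : ∀ i j → fromℤ (i ℤ.* j) ≈ fromℤ i * fromℤ j
  fromℤ-* (ℤ.+ m)    j = fromℤ-*-pos m j
  fromℤ-* ℤ.-[1+ m ] j = begin
    fromℤ (ℤ.- (ℤ.+ suc m) ℤ.* j)           ≡⟨ cong fromℤ (≡.sym (ℤₚ.neg-distribˡ-* (ℤ.+ suc m) j)) ⟩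
    fromℤ (ℤ.- (ℤ.+ suc m ℤ.* j))           ≈⟨ fromℤ-neg (ℤ.+ suc m ℤ.* j) ⟩
    - fromℤ (ℤ.+ suc m ℤ.* j)               ≈⟨ -‿cong (fromℤ-*-pos (suc m) j) ⟩
    - (ℕ⇒ℝ (suc m) * fromℤ j)               ≈⟨ -‿distribˡ-* _ _ ⟩
    - ℕ⇒ℝ (suc m) * fromℤ j                 ∎

  fromℤ-1 : fromℤ ℤ.1ℤ ≈ 1#
  fromℤ-1 = +-identityʳ 1#

  fromℤ-- : ∀ i j → fromℤ (i ℤ.- j) ≈ fromℤ i - fromℤ j
  fromℤ-- i j = R.trans (fromℤ-+ i (ℤ.- j)) (+-congˡ (fromℤ-neg j))

  open import Algebra.Solver.Ring.AlmostCommutativeRing using (fromCommutativeRing; _-Raw-AlmostCommutative⟶_)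
  private
    ℤ-rawRing : RawRing _ _
    ℤ-rawRing = CommutativeRing.rawRing ℤₚ.+-*-commutativeRing
    -- Polynomials are normalised with integer coefficients, whose equality is decidable, while that
    -- of reals is not assumed to be.
    ℤ⇒ℝ : ℤ-rawRing -Raw-AlmostCommutative⟶ fromCommutativeRing R.commutativeRing
    ℤ⇒ℝ = record { ⟦_⟧ = fromℤ ; +-homo = fromℤ-+ ; *-homo = fromℤ-* ; -‿homo = fromℤ-neg ; 0-homo = R.refl ; 1-homo
        = fromℤ-1 }
    same? : ∀ i j → Maybe (fromℤ i ≈ fromℤ j)
    same? i j with i ℤₚ.≟ j
    ... | yes refl = just R.refl
    ... | no _     = nothing

  open import Algebra.Solver.Ring ℤ-rawRing (fromCommutativeRing R.commutativeRing) ℤ⇒ℝ same? public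
    using (solve; _:=_; con; _:+_; _:*_; _:-_; :-_)

  <-irrefl : ∀ {x y} → x ≈ y → ¬ (x < y)
  <-irrefl = O.irrefl

  <-trans : ∀ {x y z} → x < y → y < z → x < z
  <-trans = O.trans

  <-resp : ∀ {x x′ y y′} → x ≈ x′ → y ≈ y′ → x < y → x′ < y′
  <-resp e f p = O.<-respˡ-≈ e (O.<-respʳ-≈ f p)

  ≤-resp : ∀ {x x′ y y′} → x ≈ x′ → y ≈ y′ → x ≤ y → x′ ≤ y′
  ≤-resp e f p q = p (<-resp (R.sym f) (R.sym e) q)

  -- The substitute for comparing two reals: a third number is compared with an interval instead. It
  -- is inherited from the apartness.
  <-cotrans : ∀ {x y} → x < y → ∀ z → x < z ⊎ z < y
  <-cotrans {x} {y} x<y z with #-cotrans (Equivalence.from #⇔<⊎> (inj₁ x<y)) z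
  ... | inj₁ x#z with Equivalence.to #⇔<⊎> x#z
  ...   | inj₁ x<z = inj₁ x<z
  ...   | inj₂ z<x = inj₂ (<-trans z<x x<y)
  <-cotrans {x} {y} x<y z | inj₂ z#y with Equivalence.to #⇔<⊎> z#y
  ...   | inj₁ z<y = inj₂ z<y
  ...   | inj₂ y<z = inj₁ (<-trans x<y y<z)

  <⇒≤ : ∀ {x y} → x < y → x ≤ y
  <⇒≤ p q = <-irrefl R.refl (<-trans p q)

  ≤-refl : ∀ {x} → x ≤ x
  ≤-refl = <-irrefl R.refl

  ≤-reflexive : ∀ {x y} → x ≈ y → x ≤ y
  ≤-reflexive e = ≤-resp R.refl e ≤-refl

  <-≤-trans : ∀ {x y z} → x < y → y ≤ z → x < z
  <-≤-trans {x} {y} {z} x<y y≤z with <-cotrans x<y z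
  ... | inj₁ x<z = x<z
  ... | inj₂ z<y = ⊥-elim (y≤z z<y)

  ≤-<-trans : ∀ {x y z} → x ≤ y → y < z → x < z
  ≤-<-trans {x} {y} {z} x≤y y<z with <-cotrans y<z x
  ... | inj₁ y<x = ⊥-elim (x≤y y<x)
  ... | inj₂ x<z = x<z

  ≤-trans : ∀ {x y z} → x ≤ y → y ≤ z → x ≤ z
  ≤-trans x≤y y≤z z<x = y≤z (<-≤-trans z<x x≤y)

  ≤-antisym : ∀ {x y} → x ≤ y → y ≤ x → x ≈ y
  ≤-antisym {x} {y} x≤y y≤x = proj₁ (tight x y) λ x#y → [ y≤x , x≤y ]′ (Equivalence.to #⇔<⊎> x#y)

  +-monoʳ-< : ∀ z {x y} → x < y → z + x < z + y
  +-monoʳ-< z p = <-resp (+-comm _ z) (+-comm _ z) (+-monoˡ-< z p)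

  +-mono-< : ∀ {x y z w} → x < y → z < w → x + z < y + w
  +-mono-< {y = y} {z} p q = <-trans (+-monoˡ-< z p) (+-monoʳ-< y q)

  +-mono-≤ : ∀ {x y z w} → x ≤ y → z ≤ w → x + z ≤ y + w
  +-mono-≤ {x} {y} {z} {w} x≤y z≤w p with <-cotrans p (x + w)
  ... | inj₁ q = x≤y (<-resp (lem y w) (lem x w) (+-monoˡ-< (- w) q))
    where
    lem : ∀ a b → a + b + - b ≈ a
    lem = solve 2 (λ a b → a :+ b :+ :- b := a) R.refl
  ... | inj₂ q = z≤w (<-resp (lem x w) (lem x z) (+-monoʳ-< (- x) q))
    where
    lem : ∀ a b → - a + (a + b) ≈ b
    lem = solve 2 (λ a b → :- a :+ (a :+ b) := b) R.refl

  <⇒0< : ∀ {x y} → x < y → 0# < y - x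
  <⇒0< {x} {y} p = <-resp (-‿inverseʳ x) R.refl (+-monoˡ-< (- x) p)

  0<⇒< : ∀ {x y} → 0# < y - x → x < y
  0<⇒< {x} {y} p = <-resp (+-identityˡ x) (lem y x) (+-monoˡ-< x p)
    where
    lem : ∀ a b → a - b + b ≈ a
    lem = solve 2 (λ a b → a :- b :+ b := a) R.refl

  ≤⇒0≤ : ∀ {x y} → x ≤ y → 0# ≤ y - x
  ≤⇒0≤ {x} {y} p q = p (<-resp (lem y x) (+-identityˡ x) (+-monoˡ-< x q))
    where
    lem : ∀ a b → a - b + b ≈ a
    lem = solve 2 (λ a b → a :- b :+ b := a) R.refl

  0≤⇒≤ : ∀ {x y} → 0# ≤ y - x → x ≤ y
  0≤⇒≤ {x} {y} p q = p (<-resp R.refl (-‿inverseʳ x) (+-monoˡ-< (- x) q))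

  ≤-by : ∀ {x y d} → 0# ≤ d → d ≈ y - x → x ≤ y
  ≤-by p e = 0≤⇒≤ (≤-resp R.refl e p)

  <-by : ∀ {x y d} → 0# < d → d ≈ y - x → x < y
  <-by p e = 0<⇒< (<-resp R.refl e p)

  0≤+ : ∀ {x y} → 0# ≤ x → 0# ≤ y → 0# ≤ x + y
  0≤+ p q = ≤-resp (+-identityˡ 0#) R.refl (+-mono-≤ p q)

  0<+ : ∀ {x y} → 0# < x → 0# ≤ y → 0# < x + y
  0<+ {x} {y} p q = <-≤-trans p (≤-resp (+-identityʳ x) R.refl (+-mono-≤ (≤-refl {x}) q))

  private
    heyting = HeytingField.heytingCommutativeRing R.heytingField
  open import Algebra.Apartness.Properties.HeytingCommutativeRing heyting using (1#0; invertibleˡ⇒#)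

  0<1 : 0# < 1#
  0<1 with Equivalence.to #⇔<⊎> 1#0
  ... | inj₂ p = p
  ... | inj₁ 1<0 = <-resp R.refl (lem 1#) (*-pos neg neg)
    where
    neg : 0# < - 1#
    neg = <-resp R.refl (+-identityˡ (- 1#)) (<⇒0< 1<0)
    lem : ∀ a → - 1# * - 1# ≈ 1#
    lem _ = R.trans (R.sym (-‿distribˡ-* 1# (- 1#))) (R.trans (-‿cong (*-identityˡ (- 1#))) (-‿involutive 1#))

  -- x < 0 would make x apart from 0, and then both factors are.
  factor-# : ∀ {x y} → x * y < 0# → x # 0# × y # 0#
  factor-# {x} {y} p with #⇒invertible (Equivalence.from #⇔<⊎> (inj₁ p))
  ... | i , left , right =
    invertibleˡ⇒# (i * y , R.trans (lem i x y) left) , invertibleˡ⇒# (i * x , R.trans (lem′ i x y) left)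
    where
    lem : ∀ i x y → i * y * (x - 0#) ≈ i * (x * y - 0#)
    lem = solve 3 (λ i x y → i :* y :* (x :- con ℤ.0ℤ) := i :* (x :* y :- con ℤ.0ℤ)) R.refl
    lem′ : ∀ i x y → i * x * (y - 0#) ≈ i * (x * y - 0#)
    lem′ = solve 3 (λ i x y → i :* x :* (y :- con ℤ.0ℤ) := i :* (x :* y :- con ℤ.0ℤ)) R.refl

  0≤* : ∀ {x y} → 0# ≤ x → 0# ≤ y → 0# ≤ x * y
  0≤* {x} {y} 0≤x 0≤y p with factor-# p
  ... | x# , y# with Equivalence.to #⇔<⊎> x# | Equivalence.to #⇔<⊎> y#
  ...   | inj₁ q | _      = 0≤x q
  ...   | _      | inj₁ q = 0≤y q
  ...   | inj₂ q | inj₂ r = <-irrefl R.refl (<-trans p (*-pos q r))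

  inverse : ∀ {x} → 0# < x → ∃[ i ] i * x ≈ 1# × 0# < i
  inverse {x} 0<x with #⇒invertible (Equivalence.from #⇔<⊎> (inj₂ 0<x))
  ... | i , left , right = i , e , positive (Equivalence.to #⇔<⊎> i#0)
    where
    lem : ∀ i x → i * x ≈ i * (x - 0#)
    lem = solve 2 (λ i x → i :* x := i :* (x :- con ℤ.0ℤ)) R.refl
    e : i * x ≈ 1#
    e = R.trans (lem i x) left
    i#0 : i # 0#
    i#0 = invertibleˡ⇒# (x , R.trans (lem′ x i) e)
      where
      lem′ : ∀ x i → x * (i - 0#) ≈ i * x
      lem′ = solve 2 (λ x i → x :* (i :- con ℤ.0ℤ) := i :* x) R.refl
    positive : i < 0# ⊎ 0# < i → 0# < i
    positive (inj₂ p) = p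
    positive (inj₁ p) = ⊥-elim (<-irrefl R.refl (<-trans (<-resp R.refl (lem″ i x) (*-pos (<⇒0< p) 0<x))
      (<-resp (-‿cong (R.sym e)) R.refl (<-by 0<1 (lem‴ 1#)))))
      where
      lem″ : ∀ i x → (0# - i) * x ≈ - (i * x)
      lem″ = solve 2 (λ i x → (con ℤ.0ℤ :- i) :* x := :- (i :* x)) R.refl
      lem‴ : ∀ o → o ≈ 0# - - o
      lem‴ = solve 1 (λ o → o := con ℤ.0ℤ :- (:- o)) R.refl

  0≤ℕ : ∀ n → 0# ≤ ℕ⇒ℝ n
  0≤ℕ zero    = ≤-refl
  0≤ℕ (suc n) = 0≤+ (<⇒≤ 0<1) (0≤ℕ n)

  0<suc : ∀ n → 0# < ℕ⇒ℝ (suc n)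
  0<suc n = 0<+ 0<1 (0≤ℕ n)

  fromℤ-0≤ : ∀ {i} → ℤ.0ℤ ℤ.≤ i → 0# ≤ fromℤ i
  fromℤ-0≤ {ℤ.+ n} _ = 0≤ℕ n

  fromℤ-0< : ∀ {i} → ℤ.0ℤ ℤ.< i → 0# < fromℤ i
  fromℤ-0< {ℤ.+[1+ n ]} _ = 0<suc n
  fromℤ-0< {ℤ.+0} (ℤ.+<+ ())

  fromℤ-≤ : ∀ {i j} → i ℤ.≤ j → fromℤ i ≤ fromℤ j
  fromℤ-≤ {i} {j} p = ≤-by (fromℤ-0≤ (Plane.≤⇒0≤ p)) (fromℤ-- j i)

  fromℤ-< : ∀ {i j} → i ℤ.< j → fromℤ i < fromℤ j
  fromℤ-< {i} {j} p = <-by (fromℤ-0< (Plane.<⇒0< p)) (fromℤ-- j i)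

  -- The order of ℤ is decidable, so the negative statement `≤` about reals still yields an integer
  -- inequality. This is how facts about convex hulls return to ℤ².
  fromℤ-cancel-≤ : ∀ {i j} → fromℤ i ≤ fromℤ j → i ℤ.≤ j
  fromℤ-cancel-≤ {i} {j} p with Plane.<-or-≥ j i
  ... | inj₁ j<i = ⊥-elim (p (fromℤ-< j<i))
  ... | inj₂ i≤j = i≤j

  fromℤ-injective : ∀ {i j} → fromℤ i ≈ fromℤ j → i ≡ j
  fromℤ-injective e = ℤₚ.≤-antisym (fromℤ-cancel-≤ (≤-reflexive e)) (fromℤ-cancel-≤ (≤-reflexive (R.sym e)))

-- Dominated points as means of three vertices.

module Carathéodory where
  open ℤ using (ℤ; +_; 0ℤ; _+_; _*_; _-_; -_; _≤_; _<_)
  open Plane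
  open Chains
  open Support
  open PickTheorem using (Dominated)

  record WeightedMean {n} (S : Fin n → Pt) (z : Pt) : Set where
    field
      i j k : Fin n
      a b c : ℤ
      0≤a : 0ℤ ≤ a
      0≤b : 0ℤ ≤ b
      0≤c : 0ℤ ≤ c
      positive : 0ℤ < a + b + c
      mean : a ⊡ S i ⊞ b ⊡ S j ⊞ c ⊡ S k ≡ (a + b + c) ⊡ z

  -- Gordan's alternative for the vectors from z to the vertices. A direction `u` positive on all of
  -- them would make z exceed the support function at -u.
  weighted-mean : ∀ {n} (S : Fin (suc n) → Pt) {z} → Dominated (support S) z → WeightedMean S z
  weighted-mean S {z} dom with gordan (λ i → z ⇢ S i)
  ... | inj₁ (balanced i j k a b c 0≤a 0≤b 0≤c pos e) = record
        { i = i ; j = j ; k = k ; a = a ; b = b ; c = c ; 0≤a = 0≤a ; 0≤b = 0≤b ; 0≤c = 0≤c ; positive = pos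
        ; mean = cong₂ _,_ (recentre (proj₁ (S i)) (proj₁ (S j)) (proj₁ (S k)) (proj₁ z) (cong proj₁ e))
                           (recentre (proj₂ (S i)) (proj₂ (S j)) (proj₂ (S k)) (proj₂ z) (cong proj₂ e)) }
    where
    lem : ∀ a b c x y t z → a * x + b * y + c * t ≡ a * (x + - z) + b * (y + - z) + c * (t + - z) + (a + b + c) * z
    lem = solve-∀
    recentre : ∀ x y t z → a * (x + - z) + b * (y + - z) + c * (t + - z) ≡ 0ℤ → a * x + b * y + c * t ≡ (a + b + c)
        * z
    recentre x y t z e = ≡.trans (lem a b c x y t z) (≡.trans (cong (_+ (a + b + c) * z) e) (ℤₚ.+-identityˡ _))
  ... | inj₂ (u , sep) with support-attained S (⊟ u)
  ...   | i , e = ⊥-elim (ℤₚ.<⇒≱ (sep i) (≤-by (≤⇒0≤ (subst (dot z (⊟ u) ≤_) e (dom (⊟ u)))) (≡.trans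
            (cong₂ _-_ (dot-⊟ʳ (S i) u) (dot-⊟ʳ z u))
                (≡.trans (lem (dot z u) (dot (S i) u)) (cong (λ t → 0ℤ - t) (≡.sym (shift (S i) z u)))))))
    where
    lem : ∀ z s → - s - - z ≡ 0ℤ - (s - z)
    lem = solve-∀
    shift : ∀ s z u → dot (z ⇢ s) u ≡ dot s u - dot z u
    shift s z u = ≡.trans (dot-⊞ˡ s (⊟ z) u) (cong (λ t → dot s u + t) (dot-⊟ˡ z u))

-- Convex hulls over the reals and their integer coordinates.

module ConvexCombinations
  {c ℓ₁ ℓ₂ m ℓm : Level}
  (ℝ : RealField c ℓ₁ ℓ₂)
  (V : Module (RealField.commutativeRing ℝ) m ℓm)
  where
  open RealField ℝ hiding (zero; refl; sym; trans; isEquivalence; complete)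
  open RealFacts ℝ
  open Geometry ℝ V
  open Module V using (Carrierᴹ; _≈ᴹ_; _+ᴹ_; -ᴹ_; 0ᴹ; _*ₗ_; ≈ᴹ-setoid; ≈ᴹ-refl; ≈ᴹ-sym; ≈ᴹ-trans; +ᴹ-cong; +ᴹ-congˡ; +ᴹ-congʳ; +ᴹ-assoc; +ᴹ-identityˡ; +ᴹ-identityʳ; *ₗ-cong; *ₗ-distribʳ; *ₗ-distribˡ; *ₗ-assoc; *ₗ-identityˡ; *ₗ-zeroˡ; *ₗ-zeroʳ; +ᴹ-commutativeMonoid; -ᴹ‿inverseʳ)
  open import Relation.Binary.Reasoning.Setoid ≈ᴹ-setoid
  open import Algebra.Properties.CommutativeSemigroup (CommutativeMonoid.commutativeSemigroup (Module.+ᴹ-commutativeMonoid V)) using (interchange)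
  open Plane using (Pt; dot; _⊞_; ⊟_)
  open Support using (support; support-upper)
  open PickTheorem using (Dominated)
  open Carathéodory

  Vec : ℕ → Set c
  Vec n = Fin n → Carrier

  Vecᴹ : ℕ → Set m
  Vecᴹ n = Fin n → Carrierᴹ

  linComb-cong : ∀ {n} {a b : Vec n} {v w : Vecᴹ n} → (∀ i → a i ≈ b i) → (∀ i → v i ≈ᴹ w i) → linComb a v ≈ᴹ
      linComb b w
  linComb-cong {zero}  e f = ≈ᴹ-refl
  linComb-cong {suc n} e f = +ᴹ-cong (*ₗ-cong (e zero) (f zero)) (linComb-cong (e ∘ suc) (f ∘ suc))

  linComb-congˡ : ∀ {n} {a b : Vec n} {v : Vecᴹ n} → (∀ i → a i ≈ b i) → linComb a v ≈ᴹ linComb b v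
  linComb-congˡ {n} {a} {b} {v} e = linComb-cong {n} {a} {b} {v} {v} e λ _ → ≈ᴹ-refl

  linComb-congʳ : ∀ {n} {a : Vec n} {v w : Vecᴹ n} → (∀ i → v i ≈ᴹ w i) → linComb a v ≈ᴹ linComb a w
  linComb-congʳ {n} {a} {v} {w} f = linComb-cong {n} {a} {a} {v} {w} (λ _ → R.refl) f

  linComb-0 : ∀ {n} (v : Vecᴹ n) → linComb (λ _ → 0#) v ≈ᴹ 0ᴹ
  linComb-0 {zero}  v = ≈ᴹ-refl
  linComb-0 {suc n} v = ≈ᴹ-trans (+ᴹ-cong (*ₗ-zeroˡ (v zero)) (linComb-0 (v ∘ suc))) (+ᴹ-identityˡ 0ᴹ)

  linComb-+ : ∀ {n} (a b : Vec n) (v : Vecᴹ n) → linComb (λ i → a i + b i) v ≈ᴹ linComb a v +ᴹ linComb b v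
  linComb-+ {zero}  a b v = ≈ᴹ-sym (+ᴹ-identityˡ 0ᴹ)
  linComb-+ {suc n} a b v = ≈ᴹ-trans
      (+ᴹ-cong (*ₗ-distribʳ (v zero) (a zero) (b zero)) (linComb-+ (a ∘ suc) (b ∘ suc) (v ∘ suc)))
      (interchange _ _ _ _)

  linComb-* : ∀ {n} k (a : Vec n) (v : Vecᴹ n) → linComb (λ i → k * a i) v ≈ᴹ k *ₗ linComb a v
  linComb-* {zero}  k a v = ≈ᴹ-sym (*ₗ-zeroʳ k)
  linComb-* {suc n} k a v = ≈ᴹ-trans (+ᴹ-cong (*ₗ-assoc k (a zero) (v zero)) (linComb-* k (a ∘ suc) (v ∘ suc)))
      (≈ᴹ-sym (*ₗ-distribˡ k _ _))

  linComb-+ʳ : ∀ {n} (w : Vec n) (g h : Vecᴹ n) → linComb w (λ i → g i +ᴹ h i) ≈ᴹ linComb w g +ᴹ linComb w h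
  linComb-+ʳ {zero}  w g h = ≈ᴹ-sym (+ᴹ-identityˡ 0ᴹ)
  linComb-+ʳ {suc n} w g h = ≈ᴹ-trans
      (+ᴹ-cong (*ₗ-distribˡ (w zero) (g zero) (h zero)) (linComb-+ʳ (w ∘ suc) (g ∘ suc) (h ∘ suc)))
      (interchange _ _ _ _)

  linComb-const : ∀ {n} (w : Vec n) x → linComb w (λ _ → x) ≈ᴹ sum w *ₗ x
  linComb-const {zero}  w x = ≈ᴹ-sym (*ₗ-zeroˡ x)
  linComb-const {suc n} w x = ≈ᴹ-trans (+ᴹ-congˡ (linComb-const (w ∘ suc) x))
      (≈ᴹ-sym (*ₗ-distribʳ x (w zero) (sum (w ∘ suc))))

  linComb-linComb : ∀ {k n} (w : Vec k) (α : Fin k → Vec n) (v : Vecᴹ n) →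
                    linComb w (λ i → linComb (α i) v) ≈ᴹ linComb (λ j → sum (λ i → w i * α i j)) v
  linComb-linComb {zero}  w α v = ≈ᴹ-sym (linComb-0 v)
  linComb-linComb {suc k} w α v = ≈ᴹ-trans
    (+ᴹ-cong (≈ᴹ-sym (linComb-* (w zero) (α zero) v)) (linComb-linComb (w ∘ suc) (α ∘ suc) v))
    (≈ᴹ-sym (linComb-+ (λ j → w zero * α zero j) (λ j → sum (λ i → w (suc i) * α (suc i) j)) v))

  sum-cong : ∀ {n} {a b : Vec n} → (∀ i → a i ≈ b i) → sum a ≈ sum b
  sum-cong {zero}  e = R.refl
  sum-cong {suc n} e = +-cong (e zero) (sum-cong (e ∘ suc))

  sum-0≤ : ∀ {n} (a : Vec n) → (∀ i → 0# ≤ a i) → 0# ≤ sum a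
  sum-0≤ {zero}  a p = ≤-refl
  sum-0≤ {suc n} a p = 0≤+ (p zero) (sum-0≤ (a ∘ suc) (p ∘ suc))

  sum-+ : ∀ {n} (a b : Vec n) → sum (λ i → a i + b i) ≈ sum a + sum b
  sum-+ {zero}  a b = R.sym (+-identityˡ 0#)
  sum-+ {suc n} a b = R.trans (+-congˡ (sum-+ (a ∘ suc) (b ∘ suc)))
      (lem (a zero) (b zero) (sum (a ∘ suc)) (sum (b ∘ suc)))
    where
    lem : ∀ a b c d → a + b + (c + d) ≈ a + c + (b + d)
    lem = solve 4 (λ a b c d → a :+ b :+ (c :+ d) := a :+ c :+ (b :+ d)) R.refl

  sum-*ˡ : ∀ {n} k (a : Vec n) → sum (λ i → k * a i) ≈ k * sum a
  sum-*ˡ {zero}  k a = R.sym (zeroʳ k)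
  sum-*ˡ {suc n} k a = R.trans (+-congˡ (sum-*ˡ k (a ∘ suc))) (R.sym (distribˡ k _ _))

  sum-0 : ∀ n → sum {n} (λ _ → 0#) ≈ 0#
  sum-0 zero    = R.refl
  sum-0 (suc n) = R.trans (+-identityˡ _) (sum-0 n)

  sum-swap : ∀ {k n} (α : Fin k → Vec n) → sum (λ j → sum (λ i → α i j)) ≈ sum (λ i → sum (α i))
  sum-swap {zero} {n} α = sum-0 n
  sum-swap {suc k} α = R.trans (sum-+ (α zero) (λ j → sum (λ i → α (suc i) j))) (+-congˡ (sum-swap (α ∘ suc)))

  sum-*ʳ : ∀ {n} k (a : Vec n) → sum (λ i → a i * k) ≈ sum a * k
  sum-*ʳ k a = R.trans (sum-cong (λ i → *-comm (a i) k)) (R.trans (sum-*ˡ k a) (*-comm k _))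

  weighted-≤ : ∀ {n} (w t : Vec n) {b} → (∀ i → 0# ≤ w i) → (∀ i → t i ≤ b) → sum (λ i → w i * t i) ≤ sum w * b
  weighted-≤ {n} w t {b} 0≤w t≤b = ≤-resp R.refl (sum-*ʳ b w)
      (termwise {n} (λ i → ≤-by (0≤* (0≤w i) (≤⇒0≤ (t≤b i))) (lem (w i) (t i) b)))
    where
    lem : ∀ w t b → w * (b - t) ≈ w * b - w * t
    lem = solve 3 (λ w t b → w :* (b :- t) := w :* b :- w :* t) R.refl
    termwise : ∀ {n} {p q : Vec n} → (∀ i → p i ≤ q i) → sum p ≤ sum q
    termwise {zero}  _ = ≤-refl
    termwise {suc n} e = +-mono-≤ (e zero) (termwise (e ∘ suc))

  unit : ∀ {n} → Fin n → Vec n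
  unit zero    zero    = 1#
  unit zero    (suc _) = 0#
  unit (suc _) zero    = 0#
  unit (suc i) (suc l) = unit i l

  0≤unit : ∀ {n} (i l : Fin n) → 0# ≤ unit i l
  0≤unit zero    zero    = <⇒≤ 0<1
  0≤unit zero    (suc _) = ≤-refl
  0≤unit (suc _) zero    = ≤-refl
  0≤unit (suc i) (suc l) = 0≤unit i l

  sum-unit : ∀ {n} (i : Fin n) → sum (unit i) ≈ 1#
  sum-unit {suc n} zero    = R.trans (+-congˡ (sum-0 n)) (+-identityʳ 1#)
  sum-unit {suc n} (suc i) = R.trans (+-identityˡ _) (sum-unit i)

  linComb-unit : ∀ {n} (i : Fin n) (v : Vecᴹ n) → linComb (unit i) v ≈ᴹ v i
  linComb-unit zero    v = ≈ᴹ-trans (+ᴹ-cong (*ₗ-identityˡ (v zero)) (linComb-0 (v ∘ suc))) (+ᴹ-identityʳ (v zero))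
  linComb-unit (suc i) v = ≈ᴹ-trans (+ᴹ-cong (*ₗ-zeroˡ (v zero)) (linComb-unit i (v ∘ suc)))
      (+ᴹ-identityˡ (v (suc i)))

  conv-resp : ∀ {n} {g : Vecᴹ n} {x y} → x ≈ᴹ y → conv g x → conv g y
  conv-resp x≈y (w , 0≤w , sum≈1 , e) = w , 0≤w , sum≈1 , ≈ᴹ-trans (≈ᴹ-sym x≈y) e

  vertex∈conv : ∀ {n} (g : Vecᴹ n) i → conv g (g i)
  vertex∈conv g i = unit i , 0≤unit i , sum-unit i , ≈ᴹ-sym (linComb-unit i g)

  conv-convex : ∀ {k n} {p : Vecᴹ k} {g : Vecᴹ n} → (∀ l → conv g (p l)) → ∀ {x} → conv p x → conv g x
  conv-convex {k} {n} {p} {g} p∈ {x} (w , 0≤w , sum≈1 , e) =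
    (λ i → sum (λ l → w l * ω l i)) ,
    (λ i → sum-0≤ _ λ l → 0≤* (0≤w l) (proj₁ (proj₂ (p∈ l)) i)) ,
    R.trans (sum-swap (λ l i → w l * ω l i))
        (R.trans (sum-cong λ l → R.trans (sum-*ˡ (w l) (ω l))
        (R.trans (*-congˡ (proj₁ (proj₂ (proj₂ (p∈ l))))) (*-identityʳ (w l)))) sum≈1) ,
    ≈ᴹ-trans e (≈ᴹ-trans (linComb-congʳ {k} {w} {p} λ l → proj₂ (proj₂ (proj₂ (p∈ l)))) (linComb-linComb w ω g))
    where
    ω : Fin k → Vec n
    ω l = proj₁ (p∈ l)

  vec : Pt → Fin 2 → ℤ.ℤ
  vec (x , y) 0F = x
  vec (x , y) 1F = y

  pt : (Fin 2 → ℤ.ℤ) → Pt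
  pt z = z 0F , z 1F

  ι : Pt → Vec 2
  ι z i = fromℤ (vec z i)

  -- The point with integer coordinates z in the basis v.
  φ : Vecᴹ 2 → Pt → Carrierᴹ
  φ v z = linComb (ι z) v

  each : ∀ {ℓ} {P : Fin 2 → Set ℓ} → P 0F → P 1F → ∀ i → P i
  each p q 0F = p
  each p q 1F = q

  φ-⊞ : ∀ v z w → φ v (z ⊞ w) ≈ᴹ φ v z +ᴹ φ v w
  φ-⊞ v z w = ≈ᴹ-trans (linComb-congˡ {2} {ι (z ⊞ w)} {λ i → ι z i + ι w i} {v}
      (each (fromℤ-+ (proj₁ z) (proj₁ w)) (fromℤ-+ (proj₂ z) (proj₂ w)))) (linComb-+ (ι z) (ι w) v)

  linComb-neg : ∀ {n} (a : Vec n) (v : Vecᴹ n) → linComb (λ i → - a i) v ≈ᴹ -ᴹ linComb a v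
  linComb-neg {n} a v = begin
    linComb (λ i → - a i) v                                       ≈⟨ +ᴹ-identityʳ _ ⟨
    linComb (λ i → - a i) v +ᴹ 0ᴹ                                 ≈⟨ +ᴹ-congˡ (-ᴹ‿inverseʳ (linComb a v)) ⟨
    linComb (λ i → - a i) v +ᴹ (linComb a v +ᴹ -ᴹ linComb a v)    ≈⟨ +ᴹ-assoc _ _ _ ⟨
    (linComb (λ i → - a i) v +ᴹ linComb a v) +ᴹ -ᴹ linComb a v    ≈⟨ +ᴹ-congʳ (linComb-+ (λ i → - a i) a v) ⟨
    linComb (λ i → - a i + a i) v +ᴹ -ᴹ linComb a v               ≈⟨ +ᴹ-congʳ
        (linComb-congˡ {n} {_} {λ _ → 0#} {v} λ i → -‿inverseˡ (a i)) ⟩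
    linComb (λ _ → 0#) v +ᴹ -ᴹ linComb a v                        ≈⟨ +ᴹ-congʳ (linComb-0 v) ⟩
    0ᴹ +ᴹ -ᴹ linComb a v                                          ≈⟨ +ᴹ-identityˡ _ ⟩
    -ᴹ linComb a v                                                ∎

  φ-⊟ : ∀ v z → φ v (⊟ z) ≈ᴹ -ᴹ φ v z
  φ-⊟ v z = ≈ᴹ-trans (linComb-congˡ {2} {ι (⊟ z)} {λ i → - ι z i} {v}
      (each (fromℤ-neg (proj₁ z)) (fromℤ-neg (proj₂ z)))) (linComb-neg (ι z) v)

  independent-≈ : ∀ {n} (v : Vecᴹ n) → LinearlyIndependent v → ∀ (a b : Vec n) → linComb a v ≈ᴹ linComb b v → ∀ i →
      a i ≈ b i
  independent-≈ {n} v ind a b e i = difference (ind (λ i → a i + - b i) vanishing i)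
    where
    difference : ∀ {x y} → x + - y ≈ 0# → x ≈ y
    difference {x} {y} e = R.trans (lem x y) (R.trans (+-congʳ e) (+-identityˡ y))
      where
      lem : ∀ x y → x ≈ x + - y + y
      lem = solve 2 (λ x y → x := x :+ :- y :+ y) R.refl
    vanishing : linComb (λ i → a i + - b i) v ≈ᴹ 0ᴹ
    vanishing = ≈ᴹ-trans (linComb-+ a (λ i → - b i) v)
        (≈ᴹ-trans (+ᴹ-cong e (linComb-neg b v)) (-ᴹ‿inverseʳ (linComb b v)))

  φ-injective : ∀ v → LinearlyIndependent v → ∀ z w → φ v z ≈ᴹ φ v w → z ≡ w
  φ-injective v ind z w e = cong₂ _,_ (fromℤ-injective (independent-≈ v ind (ι z) (ι w) e 0F))
      (fromℤ-injective (independent-≈ v ind (ι z) (ι w) e 1F))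

  dotᴿ : Vec 2 → Pt → Carrier
  dotᴿ t (a , b) = t 0F * fromℤ a + t 1F * fromℤ b

  dotᴿ-ι : ∀ z u → dotᴿ (ι z) u ≈ fromℤ (dot z u)
  dotᴿ-ι (x , y) (a , b) = R.sym (R.trans (fromℤ-+ (x ℤ.* a) (y ℤ.* b)) (+-cong (fromℤ-* x a) (fromℤ-* y b)))

  dotᴿ-cong : ∀ {s t} → (∀ i → s i ≈ t i) → ∀ u → dotᴿ s u ≈ dotᴿ t u
  dotᴿ-cong e u = +-cong (*-congʳ (e 0F)) (*-congʳ (e 1F))

  dotᴿ-sum : ∀ {n} (w : Vec n) (α : Fin n → Vec 2) u → dotᴿ (λ j → sum (λ i → w i * α i j)) u ≈ sum
      (λ i → w i * dotᴿ (α i) u)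
  dotᴿ-sum {zero} w α (a , b) = lem (fromℤ a) (fromℤ b)
    where
    lem : ∀ a b → 0# * a + 0# * b ≈ 0#
    lem a b = R.trans (+-cong (zeroˡ a) (zeroˡ b)) (+-identityˡ 0#)
  dotᴿ-sum {suc n} w α (a , b) = R.trans
    (lem (w zero) (α zero 0F) (α zero 1F) (sum (λ i → w (suc i) * α (suc i) 0F))
        (sum (λ i → w (suc i) * α (suc i) 1F)) (fromℤ a) (fromℤ b))
    (+-congˡ (dotᴿ-sum (w ∘ suc) (α ∘ suc) (a , b)))
    where
    lem : ∀ w x y s t a b → (w * x + s) * a + (w * y + t) * b ≈ w * (x * a + y * b) + (s * a + t * b)
    lem = solve 7 (λ w x y s t a b → (w :* x :+ s) :* a :+ (w :* y :+ t) :* b := w :* (x :* a :+ y :* b) :+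
        (s :* a :+ t :* b)) R.refl

  module _ {n} {v : Vecᴹ 2} {g : Vecᴹ (suc n)} {S : Fin (suc n) → Pt} (g≈ : ∀ i → g i ≈ᴹ φ v (S i)) where

    conv⇒≤support : LinearlyIndependent v → ∀ {x t} → conv g x → x ≈ᴹ linComb t v → ∀ u → dotᴿ t u ≤ fromℤ
        (support S u)
    conv⇒≤support ind {x} {t} (w , 0≤w , sum≈1 , e) x≈ u = ≤-resp (R.sym dot≈)
        (R.trans (*-congʳ sum≈1) (*-identityˡ _))
        (weighted-≤ w (λ i → dotᴿ (ι (S i)) u) 0≤w λ i → ≤-resp (R.sym (dotᴿ-ι (S i) u)) R.refl
            (fromℤ-≤ (support-upper S u i)))
      where
      dot≈ : dotᴿ t u ≈ sum (λ i → w i * dotᴿ (ι (S i)) u)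
      dot≈ = R.trans (dotᴿ-cong (independent-≈ v ind t (λ j → sum (λ i → w i * ι (S i) j))
          (≈ᴹ-trans (≈ᴹ-sym x≈) (≈ᴹ-trans e
          (≈ᴹ-trans (linComb-congʳ {suc n} {w} {g} g≈) (linComb-linComb w (ι ∘ S) v))))) u)
        (dotᴿ-sum w (ι ∘ S) u)

    conv⇒dominated : LinearlyIndependent v → ∀ {z} → conv g (φ v z) → Dominated (support S) z
    conv⇒dominated ind {z} z∈ u = fromℤ-cancel-≤
        (≤-resp (dotᴿ-ι z u) R.refl (conv⇒≤support ind {t = ι z} z∈ ≈ᴹ-refl u))

  module Weights {a b c : ℤ.ℤ} (0≤a : ℤ.0ℤ ℤ.≤ a) (0≤b : ℤ.0ℤ ℤ.≤ b) (0≤c : ℤ.0ℤ ℤ.≤ c) (positive : ℤ.0ℤ ℤ.< a ℤ.+ b ℤ.+ c) where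
    private
      recip = inverse (fromℤ-0< positive)
      N⁻¹ = proj₁ recip

    weights : Vec 3
    weights 0F            = N⁻¹ * fromℤ a
    weights 1F            = N⁻¹ * fromℤ b
    weights (suc (suc _)) = N⁻¹ * fromℤ c

    0≤weights : ∀ l → 0# ≤ weights l
    0≤weights 0F            = 0≤* (<⇒≤ (proj₂ (proj₂ recip))) (fromℤ-0≤ 0≤a)
    0≤weights 1F            = 0≤* (<⇒≤ (proj₂ (proj₂ recip))) (fromℤ-0≤ 0≤b)
    0≤weights (suc (suc _)) = 0≤* (<⇒≤ (proj₂ (proj₂ recip))) (fromℤ-0≤ 0≤c)

    weights-mean : ∀ x y t z → a ℤ.* x ℤ.+ b ℤ.* y ℤ.+ c ℤ.* t ≡ (a ℤ.+ b ℤ.+ c) ℤ.* z →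
                   weights 0F * fromℤ x + (weights 1F * fromℤ y + (weights (suc (suc zero)) * fromℤ t + 0#)) ≈ fromℤ z
    weights-mean x y t z e = R.trans (lem N⁻¹ (fromℤ a) (fromℤ x) (fromℤ b) (fromℤ y) (fromℤ c) (fromℤ t))
      (R.trans (*-congˡ (R.trans (R.sym expand) (R.trans (R.reflexive (cong fromℤ e)) (fromℤ-* (a ℤ.+ b ℤ.+ c) z))))
        (R.trans (R.sym (*-assoc N⁻¹ _ _)) (R.trans (*-congʳ (proj₁ (proj₂ recip))) (*-identityˡ _))))
      where
      lem : ∀ i a x b y c t → i * a * x + (i * b * y + (i * c * t + 0#)) ≈ i * (a * x + b * y + c * t)
      lem = solve 7 (λ i a x b y c t → i :* a :* x :+ (i :* b :* y :+ (i :* c :* t :+ con ℤ.0ℤ)) := i :*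
          (a :* x :+ b :* y :+ c :* t)) R.refl
      expand : fromℤ (a ℤ.* x ℤ.+ b ℤ.* y ℤ.+ c ℤ.* t) ≈ fromℤ a * fromℤ x + fromℤ b * fromℤ y + fromℤ c * fromℤ t
      expand = R.trans (fromℤ-+ (a ℤ.* x ℤ.+ b ℤ.* y) (c ℤ.* t))
          (+-cong (R.trans (fromℤ-+ (a ℤ.* x) (b ℤ.* y)) (+-cong (fromℤ-* a x) (fromℤ-* b y))) (fromℤ-* c t))

    -- The case of `weights-mean` in which all coordinates are 1.
    sum-weights : sum weights ≈ 1#
    sum-weights = R.trans (R.sym (+-cong (unit-* _) (+-cong (unit-* _) (+-congʳ (unit-* _)))))
        (R.trans (weights-mean ℤ.1ℤ ℤ.1ℤ ℤ.1ℤ ℤ.1ℤ (lem a b c)) fromℤ-1)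
      where
      unit-* : ∀ x → x * fromℤ ℤ.1ℤ ≈ x
      unit-* x = R.trans (*-congˡ fromℤ-1) (*-identityʳ x)
      lem : ∀ a b c → a ℤ.* ℤ.1ℤ ℤ.+ b ℤ.* ℤ.1ℤ ℤ.+ c ℤ.* ℤ.1ℤ ≡ (a ℤ.+ b ℤ.+ c) ℤ.* ℤ.1ℤ
      lem = solve-∀

  choose : ∀ {ℓ} {A : Set ℓ} → A → A → A → Fin 3 → A
  choose x y z 0F            = x
  choose x y z 1F            = y
  choose x y z (suc (suc _)) = z

  module Mean {n} {S : Fin n → Pt} {z} (W : WeightedMean S z) where
    open WeightedMean W
    open Weights 0≤a 0≤b 0≤c positive public

    selected : Fin 3 → Fin n
    selected = choose i j k

    -- The index map `f` lets the weights found for a family of sums act on each summand separately.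
    mean∈conv : ∀ {k} (g : Vecᴹ k) (f : Fin n → Fin k) → conv g (linComb weights (λ l → g (f (selected l))))
    mean∈conv g f = conv-convex {p = λ l → g (f (selected l))} (λ l → vertex∈conv g (f (selected l)))
        (weights , 0≤weights , sum-weights , ≈ᴹ-refl)

    φ-mean : ∀ v → φ v z ≈ᴹ linComb weights (λ l → φ v (S (selected l)))
    φ-mean v = ≈ᴹ-sym (≈ᴹ-trans (linComb-linComb weights (λ l → ι (S (selected l))) v)
        (linComb-congˡ {2} {λ j′ → sum (λ l → weights l * ι (S (selected l)) j′)} {ι z} {v} (each
      (weights-mean (proj₁ (S i)) (proj₁ (S j)) (proj₁ (S k)) (proj₁ z) (cong proj₁ mean))
      (weights-mean (proj₂ (S i)) (proj₂ (S j)) (proj₂ (S k)) (proj₂ z) (cong proj₂ mean)))))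

  -- Together with `conv⇒dominated` this identifies the lattice points of a polygon with the integer
  -- points under its support function, so counting them involves no reals.
  dominated⇒conv : ∀ {n} {v : Vecᴹ 2} {g : Vecᴹ (suc n)} {S : Fin (suc n) → Pt} → (∀ i → g i ≈ᴹ φ v (S i)) →
                   ∀ {z} → Dominated (support S) z → conv g (φ v z)
  dominated⇒conv {v = v} {g} {S} g≈ {z} dom = conv-resp {g = g}
      (≈ᴹ-sym (≈ᴹ-trans (φ-mean v) (linComb-congʳ {3} {weights} λ l → ≈ᴹ-sym (g≈ (selected l))))) (mean∈conv g id)
    where open Mean (weighted-mean S {z} dom)

-- Finer lattices as nonsingular integer matrices, and their counts.

module Lattices
  {c ℓ₁ ℓ₂ m ℓm : Level}
  (ℝ : RealField c ℓ₁ ℓ₂)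
  (V : Module (RealField.commutativeRing ℝ) m ℓm)
  where
  open RealField ℝ hiding (zero; refl; sym; trans; isEquivalence; complete)
  open RealFacts ℝ
  open Geometry ℝ V
  open Module V using (Carrierᴹ; _≈ᴹ_; 0ᴹ; ≈ᴹ-setoid; ≈ᴹ-refl; ≈ᴹ-sym; ≈ᴹ-trans)
  open import Relation.Unary using (_⊆_; _∩_)
  open Plane using (Pt; dot; 𝟎)
  open Support using (support; support-upper; support-attained; support-unique)
  open PickTheorem using (Dominated; Enumeration; lookup-injective)
  open Matrices using (Matrix; matrix)
  open Matrix using (determinant; mul; mulᵀ; dot-mul)
  open ConvexCombinations ℝ V
  open Lattice using (vectors; independent; spanning; latticePoints)

  family : ∀ {L : Lattice 2} (P : Polytope L) → Fin (suc (Polytope.size P)) → Pt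
  family P i = pt (proj₁ (Polytope.inLattice P i))

  generator≈ : ∀ {L : Lattice 2} (P : Polytope L) i → Polytope.generators P i ≈ᴹ φ (vectors L) (family P i)
  generator≈ P i = proj₂ (Polytope.inLattice P i)

  -- M expresses the basis of L in that of L′.
  record Refines (L L′ : Lattice 2) (M : Matrix) : Set (c ⊔ ℓm) where
    field
      nonsingular : determinant M ≢ ℤ.0ℤ
      change      : ∀ z → φ (vectors L) z ≈ᴹ φ (vectors L′) (mul M z)

  support-mul : ∀ {n} (S : Fin (suc n) → Pt) M u → support (mul M ∘ S) u ≡ support S (mulᵀ M u)
  support-mul S M u with support-attained S (mulᵀ M u)
  ... | i , e = support-unique (mul M ∘ S) u
        (λ i → subst (ℤ._≤ support S (mulᵀ M u)) (≡.sym (dot-mul M (S i) u)) (support-upper S (mulᵀ M u) i))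
        (i , ≡.trans (dot-mul M (S i) u) (≡.sym e))

  module _ {L L′ : Lattice 2} {M : Matrix} (ref : Refines L L′ M) (P : Polytope L) where
    private
      v′ = vectors L′
      S = family P
      H = λ u → support S (mulᵀ M u)
      open Refines ref

      transported : ∀ i → Polytope.generators P i ≈ᴹ φ v′ (mul M (S i))
      transported i = ≈ᴹ-trans (generator≈ P i) (change (S i))

      member⇒dominated : ∀ {x} ((ζ , e) : latticePoints L′ x) → Polytope.points P x → Dominated H (pt ζ)
      member⇒dominated {x} (ζ , e) x∈P u = subst (dot (pt ζ) u ℤ.≤_) (support-mul S M u)
        (conv⇒dominated {v = v′} {Polytope.generators P} {mul M ∘ S} transported (independent L′) {pt ζ}
            (conv-resp {g = Polytope.generators P} e x∈P) u)

    dominated⇒member : ∀ {z} → Dominated H z → Polytope.points P (φ v′ z)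
    dominated⇒member {z} dom = dominated⇒conv {v = v′} {Polytope.generators P} {mul M ∘ S} transported {z} λ u →
        subst (dot z u ℤ.≤_) (≡.sym (support-mul S M u)) (dom u)

    enumeration⇒cardinality : ∀ {k} → Enumeration (Dominated H) k → CountingFunction P L′ k
    enumeration⇒cardinality E = build (Enumeration.size E)
      where
      open Enumeration E hiding (size)
      build : ∀ {k} → length list ≡ k → CountingFunction P L′ k
      build refl = record
        { to = λ i → φ v′ (lookup list i) , dominated⇒member {lookup list i} (sound (∈ₚ.∈-lookup i)) , vec
              (lookup list i) , ≈ᴹ-refl
        ; from = position
        ; to-cong = λ { refl → ≈ᴹ-refl }
        ; from-cong = λ {x} {y} x≈y → same-position {x} {y} x≈y
        ; inverse = (λ { {x} refl → ≈ᴹ-trans (at-position x) ≈ᴹ-refl }) ,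
                    (λ {i} {y} e → lookup-injective unique (position y) i
                        (≡.trans (coordinates y) (φ-injective v′ (independent L′) _ _
                        (≈ᴹ-trans (≈ᴹ-sym (proj₂ (proj₂ (proj₂ y)))) e)))) }
        where
        Member = Σ Carrierᴹ (Polytope.points P ∩ latticePoints L′)
        position : Member → Fin (length list)
        position (x , x∈P , x∈L′) = Any.index (complete (member⇒dominated x∈L′ x∈P))
        coordinates : ∀ ((x , x∈P , ζ , e) : Member) → lookup list (position (x , x∈P , ζ , e)) ≡ pt ζ
        coordinates (x , x∈P , ζ , e) = ≡.sym (Anyₚ.lookup-index (complete (member⇒dominated (ζ , e) x∈P)))
        at-position : ∀ (y : Member) → φ v′ (lookup list (position y)) ≈ᴹ proj₁ y
        at-position y@(x , x∈P , ζ , e) = ≈ᴹ-trans (Setoid.reflexive ≈ᴹ-setoid (cong (φ v′) (coordinates y)))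
            (≈ᴹ-sym e)
        same-position : ∀ {x y : Member} → proj₁ x ≈ᴹ proj₁ y → position x ≡ position y
        same-position {x} {y} x≈y = lookup-injective unique (position x) (position y)
          (φ-injective v′ (independent L′) _ _ (≈ᴹ-trans (at-position x) (≈ᴹ-trans x≈y (≈ᴹ-sym (at-position y)))))

  cardinality-unique : ∀ {ℓ} {S : Carrierᴹ → Set ℓ} {k l} → HasCardinality S k → HasCardinality S l → k ≡ l
  cardinality-unique A B = ℕₚ.≤-antisym (embed A B) (embed B A)
    where
    embed : ∀ {ℓ} {S : Carrierᴹ → Set ℓ} {k l} → HasCardinality S k → HasCardinality S l → k ℕ.≤ l
    embed A B = Finₚ.injective⇒≤ {f = λ i → B.from (A.to i)} λ {i} {j} e →
      ≡.trans (≡.sym (A.strictlyInverseʳ i))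
          (≡.trans (A.from-cong (≈ᴹ-trans (≈ᴹ-sym (B.strictlyInverseˡ (A.to i)))
          (≈ᴹ-trans (B.to-cong e) (B.strictlyInverseˡ (A.to j))))) (A.strictlyInverseʳ j))
      where
      module A = Inverse A
      module B = Inverse B

  φ-𝟎 : ∀ v → φ v 𝟎 ≈ᴹ 0ᴹ
  φ-𝟎 v = ≈ᴹ-trans (linComb-congˡ {2} {ι 𝟎} {λ _ → 0#} {v} (each R.refl R.refl)) (linComb-0 v)

  inclusion⇒refines : ∀ (L L′ : Lattice 2) → latticePoints L ⊆ latticePoints L′ → ∃[ M ] Refines L L′ M
  inclusion⇒refines L L′ L⊆L′ = M , record { nonsingular = nonsingular ; change = change }
    where
    v = vectors L
    v′ = vectors L′
    e₁ e₂ : Pt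
    e₁ = ℤ.1ℤ , ℤ.0ℤ
    e₂ = ℤ.0ℤ , ℤ.1ℤ
    v₁ : φ v e₁ ≈ᴹ v 0F
    v₁ = ≈ᴹ-trans (linComb-congˡ {2} {ι e₁} {unit 0F} {v} (each fromℤ-1 R.refl)) (linComb-unit 0F v)
    v₂ : φ v e₂ ≈ᴹ v 1F
    v₂ = ≈ᴹ-trans (linComb-congˡ {2} {ι e₂} {unit 1F} {v} (each R.refl fromℤ-1)) (linComb-unit 1F v)
    first  = L⊆L′ (vec e₁ , ≈ᴹ-refl)
    second = L⊆L′ (vec e₂ , ≈ᴹ-refl)
    p = pt (proj₁ first)
    q = pt (proj₁ second)
    M = matrix (proj₁ p) (proj₁ q) (proj₂ p) (proj₂ q)
    images : Fin 2 → Pt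
    images 0F = p
    images 1F = q
    basis≈ : ∀ i → v i ≈ᴹ linComb (ι (images i)) v′
    basis≈ = each (≈ᴹ-trans (≈ᴹ-sym v₁) (proj₂ first)) (≈ᴹ-trans (≈ᴹ-sym v₂) (proj₂ second))
    coordinate : ∀ x y a b → fromℤ x * fromℤ a + (fromℤ y * fromℤ b + 0#) ≈ fromℤ (a ℤ.* x ℤ.+ b ℤ.* y)
    coordinate x y a b = R.trans (+-cong (*-comm _ _) (R.trans (+-identityʳ _) (*-comm _ _)))
      (R.sym (R.trans (fromℤ-+ (a ℤ.* x) (b ℤ.* y)) (+-cong (fromℤ-* a x) (fromℤ-* b y))))
    change : ∀ z → φ v z ≈ᴹ φ v′ (mul M z)
    change z@(x , y) = ≈ᴹ-trans (linComb-congʳ {2} {ι z} {v} {λ i → linComb (ι (images i)) v′} basis≈)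
      (≈ᴹ-trans (linComb-linComb (ι z) (ι ∘ images) v′)
        (linComb-congˡ {2} {λ j → sum (λ i → ι z i * ι (images i) j)} {ι (mul M z)} {v′}
          (each (coordinate x y (proj₁ p) (proj₁ q)) (coordinate x y (proj₂ p) (proj₂ q)))))
    kernel : ∀ z → mul M z ≡ 𝟎 → z ≡ 𝟎
    kernel z e = φ-injective v (independent L) z 𝟎
        (≈ᴹ-trans (change z) (≈ᴹ-trans (Setoid.reflexive ≈ᴹ-setoid (cong (φ v′) e))
        (≈ᴹ-trans (φ-𝟎 v′) (≈ᴹ-sym (φ-𝟎 v)))))
    nonsingular : determinant M ≢ ℤ.0ℤ
    -- If the determinant vanishes, the adjugate columns (d, -c) and (-b, a) are in the kernel of
    -- `M`, which is trivial. So a = c = 0, and then `e₁` is in the kernel too.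
    nonsingular det≡0 = contradiction (kernel e₁ image) λ ()
      where
      a = proj₁ p
      b = proj₁ q
      c′ = proj₂ p
      d = proj₂ q
      lem₁ : ∀ a b c d → a ℤ.* d ℤ.+ b ℤ.* (ℤ.- c) ≡ a ℤ.* d ℤ.- b ℤ.* c
      lem₁ = solve-∀
      lem₂ : ∀ c d → c ℤ.* d ℤ.+ d ℤ.* (ℤ.- c) ≡ ℤ.0ℤ
      lem₂ = solve-∀
      lem₃ : ∀ a b → a ℤ.* (ℤ.- b) ℤ.+ b ℤ.* a ≡ ℤ.0ℤ
      lem₃ = solve-∀
      lem₄ : ∀ a b c d → c ℤ.* (ℤ.- b) ℤ.+ d ℤ.* a ≡ a ℤ.* d ℤ.- b ℤ.* c
      lem₄ = solve-∀
      lem₅ : ∀ b → ℤ.0ℤ ℤ.* ℤ.1ℤ ℤ.+ b ℤ.* ℤ.0ℤ ≡ ℤ.0ℤ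
      lem₅ = solve-∀
      column₁ : (d , ℤ.- c′) ≡ 𝟎
      column₁ = kernel (d , ℤ.- c′) (cong₂ _,_ (≡.trans (lem₁ a b c′ d) det≡0) (lem₂ c′ d))
      column₂ : (ℤ.- b , a) ≡ 𝟎
      column₂ = kernel (ℤ.- b , a) (cong₂ _,_ (lem₃ a b) (≡.trans (lem₄ a b c′ d) det≡0))
      image : mul M e₁ ≡ 𝟎
      image = cong₂ _,_
        (≡.trans (cong (λ i → i ℤ.* ℤ.1ℤ ℤ.+ b ℤ.* ℤ.0ℤ) (cong proj₂ column₂)) (lem₅ b))
        (≡.trans (cong (λ i → i ℤ.* ℤ.1ℤ ℤ.+ d ℤ.* ℤ.0ℤ) (ℤₚ.neg-injective {c′} {ℤ.0ℤ} (cong proj₂ column₁)))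
            (lem₅ d))

  reciprocal : ∀ i → i ≢ ℤ.0ℤ → ∃[ r ] r * fromℤ i ≈ 1#
  reciprocal i i≢0 with ℤₚ.<-cmp ℤ.0ℤ i
  ... | tri< 0<i _ _ = let r , e , _ = inverse (fromℤ-0< 0<i) in r , e
  ... | tri≈ _ 0≡i _ = ⊥-elim (i≢0 (≡.sym 0≡i))
  ... | tri> _ _ i<0 = let r , e , _ = inverse (fromℤ-0< {ℤ.- i} (ℤₚ.neg-mono-< i<0)) in
          - r , R.trans (lem r (fromℤ i)) (R.trans (*-congˡ (R.sym (fromℤ-neg i))) e)
    where
    lem : ∀ r i → - r * i ≈ r * - i
    lem = solve 2 (λ r i → :- r :* i := r :* :- i) R.refl

  module _ (L : Lattice 2) (M : Matrix) (det≢0 : determinant M ≢ ℤ.0ℤ) where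
    open Matrix M using () renaming (a to a′; b to b′; c to c′; d to d′)
    private
      v = vectors L
      r = proj₁ (reciprocal (determinant M) det≢0)
      A = fromℤ a′
      B = fromℤ b′
      C = fromℤ c′
      D = fromℤ d′

      r-det : r * (A * D - B * C) ≈ 1#
      r-det = R.trans (*-congˡ (R.sym
          (R.trans (fromℤ-- (a′ ℤ.* d′) (b′ ℤ.* c′)) (+-cong (fromℤ-* a′ d′) (-‿cong (fromℤ-* b′ c′))))))
          (proj₂ (reciprocal (determinant M) det≢0))

      -- `κ i` is a column of the inverse of `M`, with `r` the reciprocal of its determinant: the
      -- new basis in terms of the old.
      κ : Fin 2 → Vec 2
      κ 0F 0F = r * D
      κ 0F 1F = - (r * C)
      κ 1F 0F = - (r * B)
      κ 1F 1F = r * A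

      v′ : Vecᴹ 2
      v′ i = linComb (κ i) v

      image : Vec 2 → Vec 2
      image t 0F = A * t 0F + B * t 1F
      image t 1F = C * t 0F + D * t 1F

      linComb-image : ∀ t → linComb t v ≈ᴹ linComb (image t) v′
      linComb-image t = ≈ᴹ-sym (≈ᴹ-trans (linComb-linComb (image t) κ v)
        (linComb-congˡ {2} {λ j → sum (λ i → image t i * κ i j)} {t} {v}
          (each (R.trans (lem₁ r A B C D (t 0F) (t 1F)) (R.trans (*-congʳ r-det) (*-identityˡ _)))
                (R.trans (lem₂ r A B C D (t 0F) (t 1F)) (R.trans (*-congʳ r-det) (*-identityˡ _))))))
        where
        lem₁ : ∀ r A B C D x y → (A * x + B * y) * (r * D) + ((C * x + D * y) * - (r * B) + 0#) ≈ r *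
            (A * D - B * C) * x
        lem₁ = solve 7 (λ r A B C D x y → (A :* x :+ B :* y) :* (r :* D) :+
            ((C :* x :+ D :* y) :* :- (r :* B) :+ con ℤ.0ℤ) := r :* (A :* D :- B :* C) :* x) R.refl
        lem₂ : ∀ r A B C D x y → (A * x + B * y) * - (r * C) + ((C * x + D * y) * (r * A) + 0#) ≈ r *
            (A * D - B * C) * y
        lem₂ = solve 7 (λ r A B C D x y → (A :* x :+ B :* y) :* :- (r :* C) :+
            ((C :* x :+ D :* y) :* (r :* A) :+ con ℤ.0ℤ) := r :* (A :* D :- B :* C) :* y) R.refl

      v′-independent : LinearlyIndependent v′
      v′-independent s e = each
          (R.trans (R.sym (R.trans (lem₁ r A B C D (s 0F) (s 1F)) (R.trans (*-congʳ r-det) (*-identityˡ _))))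
              (zero-combination A B))
          (R.trans (R.sym (R.trans (lem₂ r A B C D (s 0F) (s 1F)) (R.trans (*-congʳ r-det) (*-identityˡ _))))
              (zero-combination C D))
        where
        pulled : ∀ j → sum (λ i → s i * κ i j) ≈ 0#
        pulled = independent L _ (≈ᴹ-trans (≈ᴹ-sym (linComb-linComb s κ v)) e)
        zero-combination : ∀ x y → x * sum (λ i → s i * κ i 0F) + y * sum (λ i → s i * κ i 1F) ≈ 0#
        zero-combination x y = R.trans
            (+-cong (R.trans (*-congˡ (pulled 0F)) (zeroʳ x)) (R.trans (*-congˡ (pulled 1F)) (zeroʳ y)))
            (+-identityˡ 0#)
        lem₁ : ∀ r A B C D x y → A * (x * (r * D) + (y * - (r * B) + 0#)) + B * (x * - (r * C) + (y * (r * A) + 0#))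
            ≈ r * (A * D - B * C) * x
        lem₁ = solve 7 (λ r A B C D x y → A :* (x :* (r :* D) :+ (y :* :- (r :* B) :+ con ℤ.0ℤ)) :+ B :*
            (x :* :- (r :* C) :+ (y :* (r :* A) :+ con ℤ.0ℤ)) := r :* (A :* D :- B :* C) :* x) R.refl
        lem₂ : ∀ r A B C D x y → C * (x * (r * D) + (y * - (r * B) + 0#)) + D * (x * - (r * C) + (y * (r * A) + 0#))
            ≈ r * (A * D - B * C) * y
        lem₂ = solve 7 (λ r A B C D x y → C :* (x :* (r :* D) :+ (y :* :- (r :* B) :+ con ℤ.0ℤ)) :+ D :*
            (x :* :- (r :* C) :+ (y :* (r :* A) :+ con ℤ.0ℤ)) := r :* (A :* D :- B :* C) :* y) R.refl

    refinement : Lattice 2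
    refinement = record { basis = record
      { vectors = v′ ; independent = v′-independent
      ; spanning = λ x → let t , e = spanning L x in image t , ≈ᴹ-trans e (linComb-image t) } }

    refinement-refines : Refines L refinement M
    refinement-refines = record
      { nonsingular = det≢0
      ; change = λ z → ≈ᴹ-trans (linComb-image (ι z))
            (linComb-congˡ {2} {image (ι z)} {ι (mul M z)} {v′} (each (integral a′ b′ z) (integral c′ d′ z))) }
      where
      integral : ∀ p q ((x , y) : Pt) → fromℤ p * fromℤ x + fromℤ q * fromℤ y ≈ fromℤ (p ℤ.* x ℤ.+ q ℤ.* y)
      integral p q (x , y) = R.sym (R.trans (fromℤ-+ (p ℤ.* x) (q ℤ.* y)) (+-cong (fromℤ-* p x) (fromℤ-* q y)))

  refines⇒inclusion : ∀ {L L′ M} → Refines L L′ M → latticePoints L ⊆ latticePoints L′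
  refines⇒inclusion {M = M} ref (ζ , e) = vec (mul M (pt ζ)) , ≈ᴹ-trans e (Refines.change ref (pt ζ))

-- Minkowski sums and lattice translates in terms of support functions.

module MinkowskiSums
  {c ℓ₁ ℓ₂ m ℓm : Level}
  (ℝ : RealField c ℓ₁ ℓ₂)
  (V : Module (RealField.commutativeRing ℝ) m ℓm)
  where
  open RealField ℝ hiding (zero; refl; sym; trans; isEquivalence; complete)
  open RealFacts ℝ
  open Geometry ℝ V
  open Module V using (Carrierᴹ; _≈ᴹ_; _+ᴹ_; -ᴹ_; 0ᴹ; _*ₗ_; ≈ᴹ-setoid; ≈ᴹ-refl; ≈ᴹ-sym; ≈ᴹ-trans; +ᴹ-cong; +ᴹ-congˡ; +ᴹ-congʳ; +ᴹ-assoc; +ᴹ-comm; +ᴹ-identityˡ; +ᴹ-identityʳ; *ₗ-identityˡ; *ₗ-cong; -ᴹ‿cong; -ᴹ‿inverseʳ; -ᴹ‿inverseˡ; *ₗ-zeroʳ)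
  open import Relation.Unary using (_⊆_)
  open import Relation.Binary.Reasoning.Setoid ≈ᴹ-setoid
  open Plane using (Pt; dot; _⊞_; ⊟_; dot-⊞ˡ; dot-⊟ˡ)
  open Chains using (_⇢_; dot-⇢)
  open Support using (support; support-upper; support-attained; support-unique)
  open Carathéodory
  open ConvexCombinations ℝ V
  open Lattices ℝ V
  open Lattice using (vectors; independent; spanning)
  open Polytope using (points; generators; inLattice)

  pairs : ∀ {k n} → (Fin (suc k) → Pt) → (Fin (suc n) → Pt) → Fin (suc k ℕ.* suc n) → Pt
  pairs {k} {n} S T l = S (proj₁ (Fin.remQuot {suc k} (suc n) l)) ⊞ T (proj₂ (Fin.remQuot {suc k} (suc n) l))

  support-pairs : ∀ {k n} (S : Fin (suc k) → Pt) (T : Fin (suc n) → Pt) u → support (pairs S T) u ≡ support S u ℤ.+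
      support T u
  support-pairs {k} {n} S T u with support-attained S u | support-attained T u
  ... | i , e | j , f = support-unique (pairs S T) u
        (λ l → subst (ℤ._≤ support S u ℤ.+ support T u) (≡.sym (dot-⊞ˡ (S _) (T _) u))
            (ℤₚ.+-mono-≤ (support-upper S u _) (support-upper T u _)))
        (Fin.combine i j , ≡.trans (cong (λ (p , q) → dot (S p ⊞ T q) u) (Finₚ.remQuot-combine i j))
          (≡.trans (dot-⊞ˡ (S i) (T j) u) (cong₂ ℤ._+_ (≡.sym e) (≡.sym f))))

  conv-shift : ∀ {n} {g : Vecᴹ n} {x} s → conv g x → conv (λ i → g i +ᴹ s) (x +ᴹ s)
  conv-shift {n} {g} {x} s (w , 0≤w , sum≈1 , e) = w , 0≤w , sum≈1 , ≈ᴹ-sym (begin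
    linComb w (λ i → g i +ᴹ s)              ≈⟨ linComb-+ʳ w g (λ _ → s) ⟩
    linComb w g +ᴹ linComb w (λ _ → s)      ≈⟨ +ᴹ-congˡ (linComb-const w s) ⟩
    linComb w g +ᴹ (sum w *ₗ s)             ≈⟨ +ᴹ-cong (≈ᴹ-sym e)
        (≈ᴹ-trans (*ₗ-cong sum≈1 ≈ᴹ-refl) (*ₗ-identityˡ s)) ⟩
    x +ᴹ s                                  ∎)

  IsSum : Pt → ∀ {k n l} → (Fin (suc k) → Pt) → (Fin (suc n) → Pt) → (Fin (suc l) → Pt) → Set
  IsSum t S X Y = ∀ u → support S u ≡ dot t u ℤ.+ (support X u ℤ.+ support Y u)

  module _ {L : Lattice 2} (P X Y : Polytope L) where
    private
      v = vectors L
      SP = family P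
      SX = family X
      SY = family Y
      lX : Fin _ → Fin (suc (Polytope.size X))
      lX l = proj₁ (Fin.remQuot {suc (Polytope.size X)} (suc (Polytope.size Y)) l)
      lY : Fin _ → Fin (suc (Polytope.size Y))
      lY l = proj₂ (Fin.remQuot {suc (Polytope.size X)} (suc (Polytope.size Y)) l)

    module _ (t : Pt) (isSum : IsSum t SP SX SY) where
      private
        τ = φ v t

        -- A vertex of P, moved back by `t`, is dominated by the sums of vertices of X and Y, hence
        -- a mean of three of them. The same weights on the two components split it into a point of
        -- X and a point of Y.
        vertex-mean : ∀ i → WeightedMean (pairs SX SY) (t ⇢ SP i)
        vertex-mean i = weighted-mean (pairs SX SY) {t ⇢ SP i} λ u → Plane.≤-by (Plane.≤⇒0≤ (support-upper SP u i))
            (≡.trans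
          (cong₂ ℤ._-_ (≡.trans (isSum u) (cong (λ h → dot t u ℤ.+ h) (≡.sym (support-pairs SX SY u))))
              (dot-⇢ t (SP i) u))
          (lem (dot t u) (support (pairs SX SY) u) (dot (t ⇢ SP i) u)))
          where
          lem : ∀ t h s → t ℤ.+ h ℤ.- (t ℤ.+ s) ≡ h ℤ.- s
          lem = solve-∀

        xpart ypart : Fin (suc (Polytope.size P)) → Carrierᴹ
        xpart i = linComb weights (λ l → generators X (lX (selected l)))
          where open Mean (vertex-mean i)
        ypart i = linComb weights (λ l → generators Y (lY (selected l)))
          where open Mean (vertex-mean i)

        back-there : ∀ s t → (t ⇢ s) ⊞ t ≡ s
        back-there (a , b) (c , d) = cong₂ _,_ (lem a c) (lem b d)
          where
          lem : ∀ a c → a ℤ.+ ℤ.- c ℤ.+ c ≡ a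
          lem = solve-∀

        generator-split : ∀ i → generators P i ≈ᴹ (xpart i +ᴹ ypart i) +ᴹ τ
        generator-split i = begin
          generators P i                         ≈⟨ generator≈ P i ⟩
          φ v (SP i)                             ≡⟨ cong (φ v) (≡.sym (back-there (SP i) t)) ⟩
          φ v ((t ⇢ SP i) ⊞ t)                   ≈⟨ φ-⊞ v (t ⇢ SP i) t ⟩
          φ v (t ⇢ SP i) +ᴹ τ                    ≈⟨ +ᴹ-congʳ split ⟩
          (xpart i +ᴹ ypart i) +ᴹ τ              ∎
          where
          open Mean (vertex-mean i)
          split : φ v (t ⇢ SP i) ≈ᴹ xpart i +ᴹ ypart i
          split = begin
            φ v (t ⇢ SP i)
              ≈⟨ φ-mean v ⟩
            linComb weights (λ l → φ v (pairs SX SY (selected l)))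
              ≈⟨ linComb-congʳ {3} {weights} {λ l → φ v (pairs SX SY (selected l))}
                  (λ l → ≈ᴹ-trans (φ-⊞ v (SX (lX (selected l))) (SY (lY (selected l))))
                   (+ᴹ-cong (≈ᴹ-sym (generator≈ X (lX (selected l)))) (≈ᴹ-sym (generator≈ Y (lY (selected l)))))) ⟩
            linComb weights (λ l → generators X (lX (selected l)) +ᴹ generators Y (lY (selected l)))
              ≈⟨ linComb-+ʳ weights (λ l → generators X (lX (selected l))) (λ l → generators Y (lY (selected l))) ⟩
            xpart i +ᴹ ypart i ∎

        split-points : points P ⊆ translate (points X ⊕ points Y) τ
        split-points {x} (w , 0≤w , sum≈1 , e) = linComb w xpart +ᴹ linComb w ypart ,
          (linComb w xpart , linComb w ypart ,
            conv-convex {p = xpart} {generators X} (λ i → Mean.mean∈conv (vertex-mean i) (generators X) lX)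
                (w , 0≤w , sum≈1 , ≈ᴹ-refl) ,
            conv-convex {p = ypart} {generators Y} (λ i → Mean.mean∈conv (vertex-mean i) (generators Y) lY)
                (w , 0≤w , sum≈1 , ≈ᴹ-refl) , ≈ᴹ-refl) ,
          (begin
            x                                                        ≈⟨ e ⟩
            linComb w (generators P)                                 ≈⟨ linComb-congʳ {_} {w} generator-split ⟩
            linComb w (λ i → (xpart i +ᴹ ypart i) +ᴹ τ)              ≈⟨ linComb-+ʳ w (λ i → xpart i +ᴹ ypart i)
                (λ _ → τ) ⟩
            linComb w (λ i → xpart i +ᴹ ypart i) +ᴹ linComb w (λ _ → τ)
              ≈⟨ +ᴹ-cong (linComb-+ʳ w xpart ypart)
                  (≈ᴹ-trans (linComb-const w τ) (≈ᴹ-trans (*ₗ-cong sum≈1 ≈ᴹ-refl) (*ₗ-identityˡ τ))) ⟩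
            (linComb w xpart +ᴹ linComb w ypart) +ᴹ τ ∎)

        vertex-sum : ∀ i j → points P (generators Y j +ᴹ (τ +ᴹ generators X i))
        vertex-sum i j = conv-resp {g = generators P}
            (≈ᴹ-trans (φ-⊞ v (SY j) (t ⊞ SX i))
            (+ᴹ-cong (≈ᴹ-sym (generator≈ Y j)) (≈ᴹ-trans (φ-⊞ v t (SX i)) (+ᴹ-congˡ (≈ᴹ-sym (generator≈ X i))))))
          (dominated⇒conv {v = v} {generators P} {SP} (generator≈ P) {SY j ⊞ (t ⊞ SX i)} λ u → Plane.≤-by
            (Plane.0≤+ (Plane.≤⇒0≤ (support-upper SX u i)) (Plane.≤⇒0≤ (support-upper SY u j)))
            (≡.trans (lem (support SX u) (dot (SX i) u) (support SY u) (dot (SY j) u) (dot t u))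
              (cong₂ ℤ._-_ (≡.sym (isSum u))
                  (≡.sym (≡.trans (dot-⊞ˡ (SY j) (t ⊞ SX i) u)
                  (cong (λ h → dot (SY j) u ℤ.+ h) (dot-⊞ˡ t (SX i) u)))))))
          where
          lem : ∀ X x Y y t → X ℤ.- x ℤ.+ (Y ℤ.- y) ≡ t ℤ.+ (X ℤ.+ Y) ℤ.- (y ℤ.+ (t ℤ.+ x))
          lem = solve-∀

        -- Convexity is used in one summand at a time: for a fixed vertex of X the point of Y
        -- varies, and then, for that point fixed, the point of X.
        join-points : translate (points X ⊕ points Y) τ ⊆ points P
        join-points {x} (s , (a , b , a∈ , b∈ , s≈) , x≈) = conv-resp {g = generators P} regroup
          (conv-convex {p = λ i → generators X i +ᴹ (b +ᴹ τ)} {generators P} fixed-x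
              (conv-shift {g = generators X} (b +ᴹ τ) a∈))
          where
          fixed-x : ∀ i → points P (generators X i +ᴹ (b +ᴹ τ))
          fixed-x i = conv-resp {g = generators P} (≈ᴹ-trans (≈ᴹ-sym (+ᴹ-assoc b τ (generators X i))) (+ᴹ-comm _ _))
            (conv-convex {p = λ j → generators Y j +ᴹ (τ +ᴹ generators X i)} {generators P} (vertex-sum i)
                (conv-shift {g = generators Y} (τ +ᴹ generators X i) b∈))
          regroup : a +ᴹ (b +ᴹ τ) ≈ᴹ x
          regroup = ≈ᴹ-trans (≈ᴹ-sym (+ᴹ-assoc a b τ)) (≈ᴹ-trans (+ᴹ-congʳ (≈ᴹ-sym s≈)) (≈ᴹ-sym x≈))

      support⇒translate : IsLatticeTranslate L (points P) (points X ⊕ points Y)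
      support⇒translate = τ , (vec t , ≈ᴹ-refl) , split-points , join-points

    translate⇒support : IsLatticeTranslate L (points P) (points X ⊕ points Y) → ∃[ t ] IsSum t SP SX SY
    translate⇒support (τ , (ζ , τ≈) , P⊆ , ⊆P) = t , λ u → ℤₚ.≤-antisym (upper u) (lower u)
      where
      t = pt ζ
      upper : ∀ u → support SP u ℤ.≤ dot t u ℤ.+ (support SX u ℤ.+ support SY u)
      upper u with support-attained SP u
      ... | i , e with P⊆ (vertex∈conv (generators P) i)
      ...   | s , (a , b , a∈ , b∈ , s≈) , g≈ = subst (ℤ._≤ _) (≡.sym e)
            (fromℤ-cancel-≤ (≤-resp (R.sym left) (R.sym right)
              (+-mono-≤ (≤-reflexive (dotᴿ-ι t u))
                  (+-mono-≤ (conv⇒≤support {v = v} {generators X} {SX} (generator≈ X) (independent L) {t = α} a∈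
                  (proj₂ (spanning L a)) u)
                  (conv⇒≤support {v = v} {generators Y} {SY} (generator≈ Y) (independent L) {t = β} b∈
                  (proj₂ (spanning L b)) u)))))
        where
        -- The vertex splits into points `a` and `b` of X and Y that may be no lattice points, so
        -- they are compared through real coordinates.
        α = proj₁ (spanning L a)
        β = proj₁ (spanning L b)
        coordinates : ∀ j → ι (SP i) j ≈ ι t j + (α j + β j)
        coordinates = independent-≈ v (independent L) (ι (SP i)) (λ j → ι t j + (α j + β j)) (begin
          φ v (SP i)                                       ≈⟨ generator≈ P i ⟨
          generators P i                                   ≈⟨ g≈ ⟩
          s +ᴹ τ                                           ≈⟨ +ᴹ-comm s τ ⟩
          τ +ᴹ s                                           ≈⟨ +ᴹ-cong τ≈ s≈ ⟩
          φ v t +ᴹ (a +ᴹ b)                                ≈⟨ +ᴹ-congˡ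
              (+ᴹ-cong (proj₂ (spanning L a)) (proj₂ (spanning L b))) ⟩
          φ v t +ᴹ (linComb α v +ᴹ linComb β v)            ≈⟨ +ᴹ-congˡ (linComb-+ α β v) ⟨
          φ v t +ᴹ linComb (λ j → α j + β j) v             ≈⟨ linComb-+ (ι t) (λ j → α j + β j) v ⟨
          linComb (λ j → ι t j + (α j + β j)) v            ∎)
        lem : ∀ s p q s′ p′ q′ x y → (s + (p + q)) * x + (s′ + (p′ + q′)) * y ≈ (s * x + s′ * y) +
            ((p * x + p′ * y) + (q * x + q′ * y))
        lem = solve 8 (λ s p q s′ p′ q′ x y → (s :+ (p :+ q)) :* x :+ (s′ :+ (p′ :+ q′)) :* y := (s :* x :+ s′ :* y)
            :+ ((p :* x :+ p′ :* y) :+ (q :* x :+ q′ :* y))) R.refl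
        left : fromℤ (dot (SP i) u) ≈ dotᴿ (ι t) u + (dotᴿ α u + dotᴿ β u)
        left = R.trans (R.sym (dotᴿ-ι (SP i) u))
            (R.trans (dotᴿ-cong {ι (SP i)} {λ j → ι t j + (α j + β j)} coordinates u)
          (lem (ι t 0F) (α 0F) (β 0F) (ι t 1F) (α 1F) (β 1F) (fromℤ (proj₁ u)) (fromℤ (proj₂ u))))
        right : fromℤ (dot t u ℤ.+ (support SX u ℤ.+ support SY u)) ≈ fromℤ (dot t u) +
            (fromℤ (support SX u) + fromℤ (support SY u))
        right = R.trans (fromℤ-+ (dot t u) _) (+-congˡ (fromℤ-+ (support SX u) (support SY u)))
      lower : ∀ u → dot t u ℤ.+ (support SX u ℤ.+ support SY u) ℤ.≤ support SP u
      lower u with support-attained SX u | support-attained SY u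
      ... | i , e | j , f = subst (ℤ._≤ support SP u) value
            (conv⇒dominated {v = v} {generators P} {SP} (generator≈ P) (independent L) {t ⊞ (SX i ⊞ SY j)} member u)
        where
        value : dot (t ⊞ (SX i ⊞ SY j)) u ≡ dot t u ℤ.+ (support SX u ℤ.+ support SY u)
        value = ≡.trans (dot-⊞ˡ t (SX i ⊞ SY j) u)
            (cong (λ h → dot t u ℤ.+ h) (≡.trans (dot-⊞ˡ (SX i) (SY j) u) (cong₂ ℤ._+_ (≡.sym e) (≡.sym f))))
        member : points P (φ v (t ⊞ (SX i ⊞ SY j)))
        member = ⊆P (generators X i +ᴹ generators Y j ,
          (generators X i , generators Y j , vertex∈conv (generators X) i , vertex∈conv (generators Y) j , ≈ᴹ-refl)
              , (begin
            φ v (t ⊞ (SX i ⊞ SY j))                        ≈⟨ φ-⊞ v t (SX i ⊞ SY j) ⟩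
            φ v t +ᴹ φ v (SX i ⊞ SY j)                     ≈⟨ +ᴹ-cong (≈ᴹ-sym τ≈)
                (≈ᴹ-trans (φ-⊞ v (SX i) (SY j)) (+ᴹ-cong (≈ᴹ-sym (generator≈ X i)) (≈ᴹ-sym (generator≈ Y j)))) ⟩
            τ +ᴹ (generators X i +ᴹ generators Y j)        ≈⟨ +ᴹ-comm _ _ ⟩
            (generators X i +ᴹ generators Y j) +ᴹ τ        ∎))

  neg-unique : ∀ {x y} → y +ᴹ x ≈ᴹ 0ᴹ → y ≈ᴹ -ᴹ x
  neg-unique {x} {y} e = begin
    y                     ≈⟨ +ᴹ-identityʳ y ⟨
    y +ᴹ 0ᴹ               ≈⟨ +ᴹ-congˡ (-ᴹ‿inverseʳ x) ⟨
    y +ᴹ (x +ᴹ -ᴹ x)      ≈⟨ +ᴹ-assoc y x (-ᴹ x) ⟨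
    (y +ᴹ x) +ᴹ -ᴹ x      ≈⟨ +ᴹ-congʳ e ⟩
    0ᴹ +ᴹ -ᴹ x            ≈⟨ +ᴹ-identityˡ _ ⟩
    -ᴹ x                  ∎

  neg-involutive : ∀ x → x ≈ᴹ -ᴹ (-ᴹ x)
  neg-involutive x = neg-unique (-ᴹ‿inverseʳ x)

  linComb-negʳ : ∀ {n} (w : Vec n) (g : Vecᴹ n) → linComb w (λ i → -ᴹ g i) ≈ᴹ -ᴹ linComb w g
  linComb-negʳ {n} w g = neg-unique (begin
    linComb w (λ i → -ᴹ g i) +ᴹ linComb w g     ≈⟨ linComb-+ʳ w (λ i → -ᴹ g i) g ⟨
    linComb w (λ i → -ᴹ g i +ᴹ g i)             ≈⟨ linComb-congʳ {n} {w} (λ i → -ᴹ‿inverseˡ (g i)) ⟩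
    linComb w (λ _ → 0ᴹ)                        ≈⟨ linComb-const w 0ᴹ ⟩
    sum w *ₗ 0ᴹ                                 ≈⟨ *ₗ-zeroʳ (sum w) ⟩
    0ᴹ                                          ∎)

  conv-neg : ∀ {n} {g : Vecᴹ n} {x} → conv g x → conv (λ i → -ᴹ g i) (-ᴹ x)
  conv-neg {g = g} (w , 0≤w , sum≈1 , e) = w , 0≤w , sum≈1 , ≈ᴹ-trans (-ᴹ‿cong e) (≈ᴹ-sym (linComb-negʳ w g))

  reflect : ∀ {L : Lattice 2} → Polytope L → Polytope L
  reflect {L} Y = record
    { generators = λ i → -ᴹ generators Y i
    ; inLattice = λ i → let ζ , e = inLattice Y i in
        (λ j → ℤ.- ζ j) , ≈ᴹ-trans (-ᴹ‿cong e) (≈ᴹ-sym (φ-⊟ (vectors L) (pt ζ))) }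

  conv-resp-generators : ∀ {n} {g h : Vecᴹ n} → (∀ i → g i ≈ᴹ h i) → ∀ {x} → conv g x → conv h x
  conv-resp-generators {n} g≈h (w , 0≤w , sum≈1 , e) = w , 0≤w , sum≈1 , ≈ᴹ-trans e (linComb-congʳ {n} {w} g≈h)

  module _ {L : Lattice 2} (X Y : Polytope L) where
    difference⇒sum : (points X ⊖ points Y) ⊆ (points X ⊕ points (reflect Y))
    difference⇒sum (a , b , a∈ , b∈ , e) = a , -ᴹ b , a∈ , conv-neg {g = generators Y} b∈ , e

    sum⇒difference : (points X ⊕ points (reflect Y)) ⊆ (points X ⊖ points Y)
    sum⇒difference (a , b , a∈ , b∈ , e) = a , -ᴹ b , a∈ ,
      conv-resp-generators {g = λ i → -ᴹ (-ᴹ generators Y i)} (λ i → ≈ᴹ-sym (neg-involutive (generators Y i)))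
          (conv-neg {g = λ i → -ᴹ generators Y i} b∈) ,
      ≈ᴹ-trans e (+ᴹ-congˡ (neg-involutive b))

  translate-resp : ∀ {a b d} {L : Lattice 2} {A : Carrierᴹ → Set a} {S : Carrierᴹ → Set b} {T : Carrierᴹ → Set d} →
                   S ⊆ T → T ⊆ S → IsLatticeTranslate L A S → IsLatticeTranslate L A T
  translate-resp S⊆T T⊆S (v , v∈ , to , from) = v , v∈ ,
    (λ x∈ → let s , s∈ , e = to x∈ in s , S⊆T s∈ , e) , (λ (s , s∈ , e) → from (s , T⊆S s∈ , e))

  support-⊟ : ∀ {n} (S : Fin (suc n) → Pt) u → support (λ i → ⊟ S i) u ≡ support S (⊟ u)
  support-⊟ S u with support-attained S (⊟ u)
  ... | i , e = support-unique (λ i → ⊟ S i) u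
        (λ i → subst (ℤ._≤ support S (⊟ u)) (≡.sym (swap-sign (S i))) (support-upper S (⊟ u) i))
            (i , ≡.trans (swap-sign (S i)) (≡.sym e))
    where
    swap-sign : ∀ z → dot (⊟ z) u ≡ dot z (⊟ u)
    swap-sign z = ≡.trans (dot-⊟ˡ z u) (≡.sym (Plane.dot-⊟ʳ z u))

-- Counting in rectangles and in thickened multiples of a polygon.

module GridCounts where
  open ℤ using (ℤ; +_; 0ℤ; _+_; _*_; _-_; -_; _≤_; _<_; +<+; ∣_∣)
  open import Data.Nat.GCD using (gcd; c*gcd[m,n]≡gcd[cm,cn])
  open Plane
  open Chains
  open Support
  open Pick
  open PickTheorem
  open Summands using (doubled-area)

  record Range (f : Pt → ℤ) (xs : List Pt) : Set where
    field
      low high : Pt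
      low∈     : low ∈ xs
      high∈    : high ∈ xs
      bounds   : ∀ {z} → z ∈ xs → f low ≤ f z × f z ≤ f high

  range : ∀ f x xs → Range f (x ∷ xs)
  range f x [] = record { low = x ; high = x ; low∈ = here refl ; high∈ = here refl ; bounds = λ
      { (here refl) → ℤₚ.≤-refl , ℤₚ.≤-refl } }
  range f x (y ∷ ys) = record
    { low = proj₁ lower ; high = proj₁ upper ; low∈ = proj₁ (proj₂ lower) ; high∈ = proj₁ (proj₂ upper)
    ; bounds = λ { (here refl) → proj₁ (proj₂ (proj₂ lower)) , proj₁ (proj₂ (proj₂ upper))
                 ; (there z∈)  → ℤₚ.≤-trans (proj₂ (proj₂ (proj₂ lower))) (proj₁ (tail.bounds z∈)) , ℤₚ.≤-trans
                       (proj₂ (tail.bounds z∈)) (proj₂ (proj₂ (proj₂ upper))) } }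
    where
    module tail = Range (range f y ys)
    lower : ∃[ w ] w ∈ x ∷ y ∷ ys × f w ≤ f x × f w ≤ f tail.low
    lower with ℤₚ.≤-total (f x) (f tail.low)
    ... | inj₁ p = x , here refl , ℤₚ.≤-refl , p
    ... | inj₂ p = tail.low , there tail.low∈ , p , ℤₚ.≤-refl
    upper : ∃[ w ] w ∈ x ∷ y ∷ ys × f x ≤ f w × f tail.high ≤ f w
    upper with ℤₚ.≤-total (f x) (f tail.high)
    ... | inj₁ p = tail.high , there tail.high∈ , p , ℤₚ.≤-refl
    ... | inj₂ p = x , here refl , ℤₚ.≤-refl , p

  offset-injective : ∀ {l i j} → l ≤ i → l ≤ j → ∣ i - l ∣ ≡ ∣ j - l ∣ → i ≡ j
  offset-injective {l} {i} {j} l≤i l≤j e = ≡.trans (lem i l) (≡.trans (cong (_+ l) same) (≡.sym (lem j l)))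
    where
    lem : ∀ i l → i ≡ i - l + l
    lem = solve-∀
    same : i - l ≡ j - l
    same = ≡.trans (≡.sym (ℤₚ.0≤i⇒+∣i∣≡i (≤⇒0≤ l≤i))) (≡.trans (cong +_ e) (ℤₚ.0≤i⇒+∣i∣≡i (≤⇒0≤ l≤j)))

  -- Pigeonhole for distinct lattice points in a rectangle.
  rectangle : ∀ {xs} → Unique xs → (X : Range proj₁ xs) (Y : Range proj₂ xs) →
              length xs ℕ.≤ suc ∣ proj₁ (Range.high X) - proj₁ (Range.low X) ∣ ℕ.* suc ∣ proj₂ (Range.high Y) -
                  proj₂ (Range.low Y) ∣
  rectangle {xs} unique X Y = Finₚ.injective⇒≤ {f = position} λ {i} {j} e →
      let ex , ey = Finₚ.combine-injective (column i) (row i) (column j) (row j) e in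
      lookup-injective unique i j (cong₂ _,_
        (offset-injective (proj₁ (X.bounds (∈ₚ.∈-lookup i))) (proj₁ (X.bounds (∈ₚ.∈-lookup j)))
            (Finₚ.fromℕ<-injective _ _ (column< i) (column< j) ex))
        (offset-injective (proj₁ (Y.bounds (∈ₚ.∈-lookup i))) (proj₁ (Y.bounds (∈ₚ.∈-lookup j)))
            (Finₚ.fromℕ<-injective _ _ (row< i) (row< j) ey)))
    where
    module X = Range X
    module Y = Range Y
    offset< : ∀ {l i h} → l ≤ i → i ≤ h → ∣ i - l ∣ ℕ.< suc ∣ h - l ∣
    offset< l≤i i≤h = s≤s (ℤₚ.drop‿+≤+
        (subst₂ _≤_ (≡.sym (ℤₚ.0≤i⇒+∣i∣≡i (≤⇒0≤ l≤i))) (≡.sym (ℤₚ.0≤i⇒+∣i∣≡i (≤⇒0≤ (ℤₚ.≤-trans l≤i i≤h))))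
        (ℤₚ.+-monoˡ-≤ _ i≤h)))
    column< : ∀ i → ∣ proj₁ (lookup xs i) - proj₁ X.low ∣ ℕ.< suc ∣ proj₁ X.high - proj₁ X.low ∣
    column< i = let p , q = X.bounds (∈ₚ.∈-lookup i) in offset< p q
    row< : ∀ i → ∣ proj₂ (lookup xs i) - proj₂ Y.low ∣ ℕ.< suc ∣ proj₂ Y.high - proj₂ Y.low ∣
    row< i = let p , q = Y.bounds (∈ₚ.∈-lookup i) in offset< p q
    column : ∀ i → Fin (suc ∣ proj₁ X.high - proj₁ X.low ∣)
    column i = Fin.fromℕ< (column< i)
    row : ∀ i → Fin (suc ∣ proj₂ Y.high - proj₂ Y.low ∣)
    row i = Fin.fromℕ< (row< i)
    position : Fin (length xs) → Fin _
    position i = Fin.combine (column i) (row i)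

  -- Every point goes to the one set named by its own witness, so overlapping sets do no harm when a
  -- cover is counted set by set.
  record Split {k ℓ} (Q : Fin (suc k) → Pt → Set ℓ) (zs : List Pt) : Set ℓ where
    field
      here-part there-part : List Pt
      size    : length zs ≡ length here-part ℕ.+ length there-part
      here⊆   : ∀ {z} → z ∈ here-part → z ∈ zs
      there⊆  : ∀ {z} → z ∈ there-part → z ∈ zs
      unique₁ : Unique here-part
      unique₂ : Unique there-part
      all₁    : All (Q zero) here-part
      all₂    : All (λ z → ∃[ i ] Q (suc i) z) there-part

  split : ∀ {k ℓ} (Q : Fin (suc k) → Pt → Set ℓ) zs → Unique zs → All (λ z → ∃[ i ] Q i z) zs → Split Q zs
  split Q [] _ _ = record { here-part = [] ; there-part = [] ; size = refl ; here⊆ = id ; there⊆ = id ; unique₁ = []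
      ; unique₂ = [] ; all₁ = [] ; all₂ = [] }
  split Q (z ∷ zs) (z≢ ∷ u) ((zero , q) ∷ qs) = record
    { here-part = z ∷ here-part ; there-part = there-part ; size = cong suc size
    ; here⊆ = λ { (here e) → here e ; (there w∈) → there (here⊆ w∈) } ; there⊆ = there ∘ there⊆
    ; unique₁ = All.tabulate (λ w∈ → All.lookup z≢ (here⊆ w∈)) ∷ unique₁ ; unique₂ = unique₂ ; all₁ = q ∷ all₁ ;
          all₂ = all₂ }
    where open Split (split Q zs u qs)
  split Q (z ∷ zs) (z≢ ∷ u) ((suc i , q) ∷ qs) = record
    { here-part = here-part ; there-part = z ∷ there-part ; size = ≡.trans (cong suc size) (≡.sym (ℕₚ.+-suc _ _))
    ; here⊆ = there ∘ here⊆ ; there⊆ = λ { (here e) → here e ; (there w∈) → there (there⊆ w∈) }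
    ; unique₁ = unique₁ ; unique₂ = All.tabulate (λ w∈ → All.lookup z≢ (there⊆ w∈)) ∷ unique₂ ; all₁ = all₁ ; all₂ =
          (i , q) ∷ all₂ }
    where open Split (split Q zs u qs)

  dilation : ∀ n → Triangular
  dilation n = record { α = + suc n ; γ = 0ℤ ; δ = + suc n ; 0<α = +<+ (s≤s z≤n) ; 0<δ = +<+ (s≤s z≤n) }

  dilate : ℕ → Pt → Pt
  dilate n = Triangular.apply (dilation n)

  -- The mixed term of `area` under concatenation. It is linear in the first list under dilation,
  -- which makes the area of a dilated polygon plus a fixed one quadratic.
  crosses : List Pt → List Pt → ℕ
  crosses []      G = 0
  crosses (f ∷ F) G = cross f G ℕ.+ crosses F G

  module _ where
    open import Data.Nat.Tactic.RingSolver renaming (solve-∀ to solveℕ-∀)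

    cross-++ : ∀ f F G → cross f (F ++ G) ≡ cross f F ℕ.+ cross f G
    cross-++ f []      G = refl
    cross-++ f (g ∷ F) G = ≡.trans (cong (∣ det f g ∣ ℕ.+_) (cross-++ f F G)) (≡.sym (ℕₚ.+-assoc ∣ det f g ∣ _ _))

    area-++ : ∀ F G → area (F ++ G) ≡ area F ℕ.+ crosses F G ℕ.+ area G
    area-++ []      G = refl
    area-++ (f ∷ F) G = ≡.trans (cong₂ ℕ._+_ (cross-++ f F G) (area-++ F G))
        (lem (cross f F) (cross f G) (area F) (crosses F G) (area G))
      where
      lem : ∀ a b c d e → a ℕ.+ b ℕ.+ (c ℕ.+ d ℕ.+ e) ≡ a ℕ.+ c ℕ.+ (b ℕ.+ d) ℕ.+ e
      lem = solveℕ-∀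

    dilate-⊡ : ∀ n f → dilate n f ≡ + suc n ⊡ f
    dilate-⊡ n (x , y) = cong (+ suc n * x ,_) (lem (+ suc n) x y)
      where
      lem : ∀ n x y → 0ℤ * x + n * y ≡ n * y
      lem = solve-∀

    crosses-dilate : ∀ n F G → crosses (map (dilate n) F) G ≡ suc n ℕ.* crosses F G
    crosses-dilate n [] G = ≡.sym (ℕₚ.*-zeroʳ (suc n))
    crosses-dilate n (f ∷ F) G = ≡.trans (cong₂ ℕ._+_ (cross-dilate G) (crosses-dilate n F G))
        (≡.sym (ℕₚ.*-distribˡ-+ (suc n) (cross f G) (crosses F G)))
      where
      det-lem : ∀ n x y a b → n * x * b - n * y * a ≡ n * (x * b - y * a)
      det-lem = solve-∀
      det-⊡ : ∀ f g → det (+ suc n ⊡ f) g ≡ + suc n * det f g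
      det-⊡ (x , y) (a , b) = det-lem (+ suc n) x y a b
      cross-dilate : ∀ G → cross (dilate n f) G ≡ suc n ℕ.* cross f G
      cross-dilate [] = ≡.sym (ℕₚ.*-zeroʳ (suc n))
      cross-dilate (g ∷ G) = ≡.trans
          (cong₂ ℕ._+_ (≡.trans (cong (λ w → ∣ det w g ∣) (dilate-⊡ n f))
          (≡.trans (cong ∣_∣ (det-⊡ f g)) (ℤₚ.abs-* (+ suc n) (det f g)))) (cross-dilate G))
        (≡.sym (ℕₚ.*-distribˡ-+ (suc n) ∣ det f g ∣ (cross f G)))

    perimeter-dilate : ∀ n F → perimeter (map (dilate n) F) ≡ suc n ℕ.* perimeter F
    perimeter-dilate n [] = ≡.sym (ℕₚ.*-zeroʳ (suc n))
    perimeter-dilate n (f@(x , y) ∷ F) = ≡.trans (cong₂ ℕ._+_ content-dilate (perimeter-dilate n F))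
        (≡.sym (ℕₚ.*-distribˡ-+ (suc n) (content f) (perimeter F)))
      where
      content-dilate : content (dilate n f) ≡ suc n ℕ.* content f
      content-dilate = ≡.trans (cong content (dilate-⊡ n f))
          (≡.trans (cong₂ gcd (ℤₚ.abs-* (+ suc n) x) (ℤₚ.abs-* (+ suc n) y))
          (≡.sym (c*gcd[m,n]≡gcd[cm,cn] (suc n) ∣ x ∣ ∣ y ∣)))

    area-dilate : ∀ n F → area (map (dilate n) F) ≡ suc n ℕ.* suc n ℕ.* area F
    area-dilate n F = Matrices.area-apply (dilation n) F

    -- The translate of a square of side 2 to [-2,0]².
    square : Pt → ℤ
    square u = dot (- + 2 , - + 2) u + zono ((+ 2 , 0ℤ) ∷ (0ℤ , + 2) ∷ []) u

    square-boundary : Boundary square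
    square-boundary = record
      { base = - + 2 , - + 2 ; up = E ; lo = E ; up>0 = E>0 ; lo>0 = E>0 ; closed = refl ; upper = λ _ _ → refl ;
            lower = λ _ _ → refl }
      where
      E : List Pt
      E = (+ 2 , 0ℤ) ∷ (0ℤ , + 2) ∷ []
      E>0 : All LexPos E
      E>0 = inj₁ (+<+ (s≤s z≤n)) ∷ inj₂ (refl , +<+ (s≤s z≤n)) ∷ []

    module _ {H : Pt → ℤ} (B : Boundary H) where
      open Boundary B

      thickened : ℕ → Pt → ℤ
      thickened n u = H (Triangular.transpose (dilation n) u) + square u

      private
        E = Boundary.up square-boundary

      linear-term constant-term : ℕ
      linear-term   = crosses up E ℕ.+ crosses lo E ℕ.+ perimeter up ℕ.+ perimeter lo
      constant-term = area E ℕ.+ area E ℕ.+ perimeter E ℕ.+ perimeter E ℕ.+ 2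

      -- Pick's theorem for (n + 1)P + [-2,0]²: a quadratic polynomial in n + 1 whose leading
      -- coefficient is twice the area of P. Of the lower coefficients it only matters that they do
      -- not depend on n.
      thickened-count : ∀ n → ∃[ k ] Enumeration (Dominated (thickened n)) k ×
        2 ℕ.* k ≡ suc n ℕ.* suc n ℕ.* doubled-area B ℕ.+ suc n ℕ.* linear-term ℕ.+ constant-term
      thickened-count n = let k , enum , e = pick (boundary-+ (Triangular.boundary-apply (dilation n) B) square-boundary) in
        k , enum , ≡.trans e (≡.trans
          (cong₂ (λ (a , b) (p , q) → a ℕ.+ b ℕ.+ p ℕ.+ q ℕ.+ 2) (cong₂ _,_ (areas up) (areas lo))
              (cong₂ _,_ (perimeters up) (perimeters lo)))
          (lem (suc n) (area up) (crosses up E) (area E) (area lo) (crosses lo E) (perimeter up) (perimeter E)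
              (perimeter lo)))
        where
        areas : ∀ F → area (map (dilate n) F ++ E) ≡ suc n ℕ.* suc n ℕ.* area F ℕ.+ suc n ℕ.* crosses F E ℕ.+ area E
        areas F = ≡.trans (area-++ (map (dilate n) F) E)
            (cong₂ (λ i j → i ℕ.+ j ℕ.+ area E) (area-dilate n F) (crosses-dilate n F E))
        perimeters : ∀ F → perimeter (map (dilate n) F ++ E) ≡ suc n ℕ.* perimeter F ℕ.+ perimeter E
        perimeters F = ≡.trans (Decomposition.perimeter-++ (map (dilate n) F) E)
            (cong (ℕ._+ perimeter E) (perimeter-dilate n F))
        lem : ∀ n a c e b d p q r → (n ℕ.* n ℕ.* a ℕ.+ n ℕ.* c ℕ.+ e) ℕ.+ (n ℕ.* n ℕ.* b ℕ.+ n ℕ.* d ℕ.+ e) ℕ.+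
            (n ℕ.* p ℕ.+ q) ℕ.+ (n ℕ.* r ℕ.+ q) ℕ.+ 2
              ≡ n ℕ.* n ℕ.* (a ℕ.+ b) ℕ.+ n ℕ.* (c ℕ.+ d ℕ.+ p ℕ.+ r) ℕ.+ (e ℕ.+ e ℕ.+ q ℕ.+ q ℕ.+ 2)
        lem = solveℕ-∀

-- The area defined by box covers is half of `doubled-area`.

module Areas
  {c ℓ₁ ℓ₂ m ℓm : Level}
  (ℝ : RealField c ℓ₁ ℓ₂)
  (V : Module (RealField.commutativeRing ℝ) m ℓm)
  where
  open RealField ℝ hiding (zero; refl; sym; trans; isEquivalence; complete)
  open RealFacts ℝ
  open Geometry ℝ V
  open Module V using (Carrierᴹ; _≈ᴹ_; _*ₗ_; ≈ᴹ-setoid; ≈ᴹ-sym; *ₗ-cong)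
  open Plane using (Pt; dot)
  open Chains using (pos; ≤pos; 0≤pos)
  open Support
  open PickTheorem using (Dominated; Enumeration)
  open Matrices using (Matrix; pick-matrix)
  open Matrix using (determinant; mul)
  open Summands using (doubled-area; boundary-length; scalar)
  open GridCounts
  open ConvexCombinations ℝ V
  open Lattices ℝ V
  open Lattice using (vectors; independent; spanning)
  open Polytope using (points; generators)

  ℕ⇒ℝ-+ : ∀ i j → ℕ⇒ℝ (i ℕ.+ j) ≈ ℕ⇒ℝ i + ℕ⇒ℝ j
  ℕ⇒ℝ-+ i j = fromℤ-+ (ℤ.+ i) (ℤ.+ j)

  ℕ⇒ℝ-* : ∀ i j → ℕ⇒ℝ (i ℕ.* j) ≈ ℕ⇒ℝ i * ℕ⇒ℝ j
  ℕ⇒ℝ-* i j = R.trans (R.reflexive (cong fromℤ (ℤₚ.pos-* i j))) (fromℤ-* (ℤ.+ i) (ℤ.+ j))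

  ℕ⇒ℝ-≤ : ∀ {i j} → i ℕ.≤ j → ℕ⇒ℝ i ≤ ℕ⇒ℝ j
  ℕ⇒ℝ-≤ p = fromℤ-≤ (ℤ.+≤+ p)

  module _ {X₀ X₁ Y₀ Y₁ : Carrier} (X₀≤X₁ : X₀ ≤ X₁) (Y₀≤Y₁ : Y₀ ≤ Y₁) where

    InRectangle : Pt → Set ℓ₂
    InRectangle (x , y) = (X₀ ≤ fromℤ x × fromℤ x ≤ X₁) × (Y₀ ≤ fromℤ y × fromℤ y ≤ Y₁)

    -- Real bounds cannot simply be rounded to integers, as this would decide comparisons. The
    -- extreme points of the list itself provide an integer rectangle inside the real one.
    count-rectangle : ∀ {xs} → Unique xs → All InRectangle xs → ℕ⇒ℝ (length xs) ≤ (X₁ - X₀ + 1#) * (Y₁ - Y₀ + 1#)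
    count-rectangle {[]} _ _ = 0≤* (0≤+ (≤⇒0≤ X₀≤X₁) (<⇒≤ 0<1)) (0≤+ (≤⇒0≤ Y₀≤Y₁) (<⇒≤ 0<1))
    count-rectangle {x ∷ xs} unique inside = ≤-trans (ℕ⇒ℝ-≤ (rectangle unique X Y))
        (≤-resp (R.sym (ℕ⇒ℝ-* (suc w) (suc h))) R.refl
        (product (<⇒≤ (0<suc w)) (side w X₀ X₁ (proj₁ X.low) (proj₁ X.high) w≡ (proj₁ (proj₁ (at X.low∈)))
            (proj₂ (proj₁ (at X.high∈))))
                 (<⇒≤ (0<suc h)) (side h Y₀ Y₁ (proj₂ Y.low) (proj₂ Y.high) h≡ (proj₁ (proj₂ (at Y.low∈)))
                     (proj₂ (proj₂ (at Y.high∈))))))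
      where
      X = range proj₁ x xs
      Y = range proj₂ x xs
      module X = Range X
      module Y = Range Y
      w = ℤ.∣ proj₁ X.high ℤ.- proj₁ X.low ∣
      h = ℤ.∣ proj₂ Y.high ℤ.- proj₂ Y.low ∣
      at : ∀ {z} → z ∈ x ∷ xs → InRectangle z
      at = All.lookup inside
      w≡ : ℤ.+ w ≡ proj₁ X.high ℤ.- proj₁ X.low
      w≡ = ℤₚ.0≤i⇒+∣i∣≡i (Plane.≤⇒0≤ (proj₁ (X.bounds X.high∈)))
      h≡ : ℤ.+ h ≡ proj₂ Y.high ℤ.- proj₂ Y.low
      h≡ = ℤₚ.0≤i⇒+∣i∣≡i (Plane.≤⇒0≤ (proj₁ (Y.bounds Y.high∈)))
      side : ∀ n lo hi i j → ℤ.+ n ≡ j ℤ.- i → lo ≤ fromℤ i → fromℤ j ≤ hi → ℕ⇒ℝ (suc n) ≤ hi - lo + 1#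
      side n lo hi i j e lo≤ ≤hi = ≤-by (0≤+ (≤⇒0≤ lo≤) (≤⇒0≤ ≤hi)) (R.trans (lem (fromℤ i) (fromℤ j) lo hi 1#)
          (+-congˡ (-‿cong (+-congˡ (R.trans (R.sym (fromℤ-- j i)) (R.reflexive (cong fromℤ (≡.sym e))))))))
        where
        lem : ∀ i j lo hi o → (i - lo) + (hi - j) ≈ (hi - lo + o) - (o + (j - i))
        lem = solve 5 (λ i j lo hi o → (i :- lo) :+ (hi :- j) := (hi :- lo :+ o) :- (o :+ (j :- i))) R.refl
      product : ∀ {a b p q} → 0# ≤ a → a ≤ b → 0# ≤ p → p ≤ q → a * p ≤ b * q
      product {a} {b} {p} {q} 0≤a a≤b 0≤p p≤q = ≤-by (0≤+ (0≤* (≤⇒0≤ a≤b) 0≤p) (0≤* (≤-trans 0≤a a≤b) (≤⇒0≤ p≤q)))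
          (lem a b p q)
        where
        lem : ∀ a b p q → (b - a) * p + b * (q - p) ≈ b * q - a * p
        lem = solve 4 (λ a b p q → (b :- a) :* p :+ b :* (q :- p) := b :* q :- a :* p) R.refl

  double-cancel : ∀ {x y} → x + x < y + y → x < y
  double-cancel {x} {y} p with <-cotrans p (x + y)
  ... | inj₁ q = <-by (<⇒0< q) (lem x y)
    where
    lem : ∀ x y → x + y - (x + x) ≈ y - x
    lem = solve 2 (λ x y → x :+ y :- (x :+ x) := y :- x) R.refl
  ... | inj₂ q = <-by (<⇒0< q) (lem x y)
    where
    lem : ∀ x y → y + y - (x + y) ≈ y - x
    lem = solve 2 (λ x y → y :+ y :- (x :+ y) := y :- x) R.refl

  half : ∀ x → ∃[ h ] h + h ≈ x
  half x = h * x , R.trans (lem h x) (R.trans (*-congʳ (proj₁ (proj₂ two))) (*-identityˡ x))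
    where
    two = inverse (0<suc 1)
    h = proj₁ two
    lem : ∀ h x → h * x + h * x ≈ h * ℕ⇒ℝ 2 * x
    lem = solve 2 (λ h x → h :* x :+ h :* x := h :* con (ℤ.+ 2) :* x) R.refl

  module _ (L : Lattice 2) where
    open Measure L
    open Box
    private
      v = vectors L

    module _ {n : ℕ} {L′ : Lattice 2} (ref : Refines L L′ (scalar n)) where
      -- In L-coordinates the points of L′ have denominator n.
      scaled-coordinates : ∀ z t → φ (vectors L′) z ≈ᴹ linComb t v → ∀ j → ℕ⇒ℝ n * t j ≈ ι z j
      scaled-coordinates z t e = independent-≈ v (independent L) (λ j → ℕ⇒ℝ n * t j) (ι z) (begin
        linComb (λ j → ℕ⇒ℝ n * t j) v              ≈⟨ linComb-* (ℕ⇒ℝ n) t v ⟩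
        ℕ⇒ℝ n *ₗ linComb t v                       ≈⟨ *ₗ-cong R.refl (≈ᴹ-sym e) ⟩
        ℕ⇒ℝ n *ₗ φ (vectors L′) z                  ≈⟨ linComb-* (ℕ⇒ℝ n) (ι z) (vectors L′) ⟨
        linComb (λ j → ℕ⇒ℝ n * ι z j) (vectors L′) ≈⟨ linComb-congˡ {2} {λ j → ℕ⇒ℝ n * ι z j} {ι (mul (scalar n) z)}
            {vectors L′} (each (first (proj₁ z) (proj₂ z)) (second (proj₁ z) (proj₂ z))) ⟩
        φ (vectors L′) (mul (scalar n) z)          ≈⟨ Refines.change ref z ⟨
        φ v z                                      ∎)
        where
        open import Relation.Binary.Reasoning.Setoid ≈ᴹ-setoid
        lem₁ : ∀ n x y → n ℤ.* x ≡ n ℤ.* x ℤ.+ ℤ.0ℤ ℤ.* y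
        lem₁ = solve-∀
        lem₂ : ∀ n x y → n ℤ.* y ≡ ℤ.0ℤ ℤ.* x ℤ.+ n ℤ.* y
        lem₂ = solve-∀
        first : ∀ x y → ℕ⇒ℝ n * fromℤ x ≈ fromℤ (ℤ.+ n ℤ.* x ℤ.+ ℤ.0ℤ ℤ.* y)
        first x y = R.trans (R.sym (fromℤ-* (ℤ.+ n) x)) (R.reflexive (cong fromℤ (lem₁ (ℤ.+ n) x y)))
        second : ∀ x y → ℕ⇒ℝ n * fromℤ y ≈ fromℤ (ℤ.0ℤ ℤ.* x ℤ.+ ℤ.+ n ℤ.* y)
        second x y = R.trans (R.sym (fromℤ-* (ℤ.+ n) y)) (R.reflexive (cong fromℤ (lem₂ (ℤ.+ n) x y)))

    sides : ∀ {k} → (Fin k → Box) → Carrier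
    sides B = sum (λ i → (upper (B i) 0F - lower (B i) 0F) + (upper (B i) 1F - lower (B i) 1F))

    module Scaled (N : Carrier) (0≤N : 0# ≤ N) where
      *-mono : ∀ {x y} → x ≤ y → N * x ≤ N * y
      *-mono {x} {y} p = ≤-by (0≤* 0≤N (≤⇒0≤ p)) (lem N x y)
        where
        lem : ∀ n x y → n * (y - x) ≈ n * y - n * x
        lem = solve 3 (λ n x y → n :* (y :- x) := n :* y :- n :* x) R.refl

      InBox : Box → Pt → Set ℓ₂
      InBox B = InRectangle (*-mono (lower≤upper B 0F)) (*-mono (lower≤upper B 1F))

      -- The product (N w + 1)(N h + 1) for a box of width w and height h, expanded in powers of
      -- `N`.
      box-bound : Box → Carrier
      box-bound B = N * N * boxArea B + N * ((upper B 0F - lower B 0F) + (upper B 1F - lower B 1F)) + 1#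

      count-box : ∀ (B : Box) {xs} → Unique xs → All (InBox B) xs → ℕ⇒ℝ (length xs) ≤ box-bound B
      count-box B u inside = ≤-resp R.refl (lem N (upper B 0F) (lower B 0F) (upper B 1F) (lower B 1F))
          (count-rectangle (*-mono (lower≤upper B 0F)) (*-mono (lower≤upper B 1F)) u inside)
        where
        lem : ∀ n a b c d → (n * a - n * b + 1#) * (n * c - n * d + 1#) ≈ n * n * ((a - b) * (c - d)) + n *
            ((a - b) + (c - d)) + 1#
        lem n a b c d = R.trans (*-cong (+-congˡ (R.sym fromℤ-1)) (+-congˡ (R.sym fromℤ-1)))
            (R.trans (lem′ n a b c d) (+-congˡ fromℤ-1))
          where
          lem′ : ∀ n a b c d → (n * a - n * b + fromℤ ℤ.1ℤ) * (n * c - n * d + fromℤ ℤ.1ℤ) ≈ n * n *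
              ((a - b) * (c - d)) + n * ((a - b) + (c - d)) + fromℤ ℤ.1ℤ
          lem′ = solve 5 (λ n a b c d → (n :* a :- n :* b :+ con ℤ.1ℤ) :* (n :* c :- n :* d :+ con ℤ.1ℤ) := n :* n
              :* ((a :- b) :* (c :- d)) :+ n :* ((a :- b) :+ (c :- d)) :+ con ℤ.1ℤ) R.refl

      count-boxes : ∀ {k} (B : Fin k → Box) {zs} → Unique zs → All (λ z → ∃[ i ] InBox (B i) z) zs → ℕ⇒ℝ (length zs)
          ≤ sum (box-bound ∘ B)
      count-boxes {zero} B {[]} _ _ = ≤-refl
      count-boxes {zero} B {z ∷ zs} _ ((() , _) ∷ _)
      count-boxes {suc k} B {zs} u cover = ≤-resp
          (R.sym (R.trans (R.reflexive (cong ℕ⇒ℝ size)) (ℕ⇒ℝ-+ (length here-part) (length there-part)))) R.refl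
          (+-mono-≤ (count-box (B zero) unique₁ all₁) (count-boxes (B ∘ suc) unique₂ all₂))
        where open Split (split (InBox ∘ B) zs u cover)

      sum-bound : ∀ {k} (B : Fin k → Box) → sum (box-bound ∘ B) ≈ N * N * totalArea B + N * sides B + ℕ⇒ℝ k
      sum-bound {zero} B = lem N
        where
        lem : ∀ n → 0# ≈ n * n * 0# + n * 0# + 0#
        lem = solve 1 (λ n → con ℤ.0ℤ := n :* n :* con ℤ.0ℤ :+ n :* con ℤ.0ℤ :+ con ℤ.0ℤ) R.refl
      sum-bound {suc k} B = R.trans (+-congˡ (sum-bound (B ∘ suc)))
          (lem N (boxArea (B zero)) ((upper (B zero) 0F - lower (B zero) 0F) +
              (upper (B zero) 1F - lower (B zero) 1F)) (totalArea (B ∘ suc)) (sides (B ∘ suc)) 1# (ℕ⇒ℝ k))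
        where
        lem : ∀ n a s A S o k → n * n * a + n * s + o + (n * n * A + n * S + k) ≈ n * n * (a + A) + n * (s + S) +
            (o + k)
        lem = solve 7 (λ n a s A S o k → n :* n :* a :+ n :* s :+ o :+ (n :* n :* A :+ n :* S :+ k) := n :* n :*
            (a :+ A) :+ n :* (s :+ S) :+ (o :+ k)) R.refl

    module _ (P : Polytope L) where
      private
        S = family P
        B₀ = boundary S
        A = doubled-area B₀

      module _ {a : Carrier} (a+a≈A : a + a ≈ ℕ⇒ℝ A) where
        private
          module Grid (n : ℕ) where
            N = ℕ⇒ℝ (suc n)
            M = scalar (suc n)
            nonsingular : determinant M ≢ ℤ.0ℤ
            nonsingular ()
            L′ = refinement L M nonsingular
            ref = refinement-refines L M nonsingular
            counted = pick-matrix B₀ M nonsingular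
            k = proj₁ counted
            open Enumeration (proj₁ (proj₂ counted)) public
            open Scaled N (0≤ℕ (suc n)) public
            -- Pick's theorem without its boundary terms.
            N²A≤k+k : N * N * (a + a) ≤ ℕ⇒ℝ k + ℕ⇒ℝ k
            N²A≤k+k = ≤-resp (R.trans (ℕ⇒ℝ-* (suc n ℕ.* suc n) A) (*-cong (ℕ⇒ℝ-* (suc n) (suc n)) (R.sym a+a≈A)))
                (R.trans (R.reflexive (cong (λ i → ℕ⇒ℝ (k ℕ.+ i)) (ℕₚ.+-identityʳ k))) (ℕ⇒ℝ-+ k k))
                (ℕ⇒ℝ-≤ (subst (suc n ℕ.* suc n ℕ.* A ℕ.≤_) (≡.sym (proj₂ (proj₂ counted)))
                  (subst (λ i → i ℕ.* A ℕ.≤ ℤ.∣ determinant M ∣ ℕ.* A ℕ.+ boundary-length B₀ M ℕ.+ 2) det≡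
                    (ℕₚ.≤-trans (ℕₚ.m≤m+n _ (boundary-length B₀ M)) (ℕₚ.m≤m+n _ 2)))))
              where
              det≡ : ℤ.∣ determinant M ∣ ≡ suc n ℕ.* suc n
              det≡ = ≡.trans (cong ℤ.∣_∣ (lem (ℤ.+ suc n))) (ℤₚ.abs-* (ℤ.+ suc n) (ℤ.+ suc n))
                where
                lem : ∀ n → n ℤ.* n ℤ.- ℤ.0ℤ ℤ.* ℤ.0ℤ ≡ n ℤ.* n
                lem = solve-∀
            in-boxes : ∀ {k} (B : Fin k → Box) → Covers B (points P) → All (λ z → ∃[ i ] InBox (B i) z) list
            in-boxes B covers = All.tabulate λ {z} z∈ →
              let i , t , bounds , e = covers (φ (vectors L′) z) (dominated⇒member ref P {z} (sound z∈))
                  t≈ = scaled-coordinates {suc n} ref z t e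
              in i , (≤-resp R.refl (t≈ 0F) (*-mono (proj₁ (bounds 0F))) , ≤-resp (t≈ 0F) R.refl
                    (*-mono (proj₂ (bounds 0F)))) ,
                     (≤-resp R.refl (t≈ 1F) (*-mono (proj₁ (bounds 1F))) , ≤-resp (t≈ 1F) R.refl
                         (*-mono (proj₂ (bounds 1F))))
            k≤ : ∀ {l} (B : Fin l → Box) → Covers B (points P) → ℕ⇒ℝ k ≤ N * N * totalArea B + N * sides B + ℕ⇒ℝ l
            k≤ B covers = ≤-resp (R.reflexive (cong ℕ⇒ℝ size)) (sum-bound B)
                (count-boxes B unique (in-boxes B covers))

        -- Otherwise n²(2a) ≤ 2|nP ∩ ℤ²| ≤ n²(2 Σ area) + O(n) fails for large n.
        area-lower : ∀ {l} (B : Fin l → Box) → Covers B (points P) → a ≤ totalArea B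
        area-lower {l} B covers T<a = ≤-trans N²A≤k+k (+-mono-≤ (k≤ B covers) (k≤ B covers)) (<-by large
            (R.trans (lem N 1# a T E K) R.refl))
          where
          T = totalArea B
          E = sides B
          K = ℕ⇒ℝ l
          δ = (a + a) - (T + T)
          0<δ : 0# < δ
          0<δ = <⇒0< (+-mono-< T<a T<a)
          recip = inverse 0<δ
          -- Makes N δ exceed 2E + 2K. Multiplied by `N` this beats the linear terms of twice the
          -- count; the constant 2K may be enlarged to 2KN because N ≥ 1.
          bound = archimedean ((E + K + (E + K)) * proj₁ recip)
          n = proj₁ bound
          open Grid n
          below : E + K + (E + K) < N * δ
          below = <-by (*-pos (<⇒0< (<-≤-trans (proj₂ bound) (ℕ⇒ℝ-≤ (ℕₚ.n≤1+n n)))) 0<δ)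
            (R.trans (lem′ N (E + K + (E + K)) (proj₁ recip) δ)
                (+-congˡ (-‿cong (R.trans (*-congˡ (proj₁ (proj₂ recip))) (*-identityʳ _)))))
            where
            lem′ : ∀ N x i d → (N - x * i) * d ≈ N * d - x * (i * d)
            lem′ = solve 4 (λ N x i d → (N :- x :* i) :* d := N :* d :- x :* (i :* d)) R.refl
          0≤N-1 : 0# ≤ N - 1#
          0≤N-1 = ≤-resp R.refl (lem″ 1# (ℕ⇒ℝ n)) (0≤ℕ n)
            where
            lem″ : ∀ o n → n ≈ o + n - o
            lem″ = solve 2 (λ o n → n := o :+ n :- o) R.refl
          -- The last summand is zero. It lets `1#` be treated as a variable of the ring identity,
          -- whose own constant 1 is `1# + 0#`.
          large : 0# < N * (N * δ - (E + K + (E + K))) + (N - 1#) * (K + K) + (1# - 1#) * (K + K)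
          large = <-resp R.refl (R.sym (R.trans (+-congˡ (R.trans (*-congʳ (-‿inverseʳ 1#)) (zeroˡ _)))
              (+-identityʳ _)))
            (0<+ (*-pos (0<suc n) (<⇒0< below)) (0≤* 0≤N-1 (0≤+ (0≤ℕ l) (0≤ℕ l))))
          lem : ∀ N o a T E K → N * (N * ((a + a) - (T + T)) - (E + K + (E + K))) + (N - o) * (K + K) + (o - 1#) *
              (K + K) ≈
                N * N * (a + a) - ((N * N * T + N * E + K) + (N * N * T + N * E + K))
          lem N o a T E K = R.trans (+-congˡ (*-congʳ (+-congˡ (-‿cong (R.sym fromℤ-1))))) (lem′ N o a T E K)
            where
            lem′ : ∀ N o a T E K → N * (N * ((a + a) - (T + T)) - (E + K + (E + K))) + (N - o) * (K + K) +
                (o - fromℤ ℤ.1ℤ) * (K + K) ≈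
                   N * N * (a + a) - ((N * N * T + N * E + K) + (N * N * T + N * E + K))
            lem′ = solve 6 (λ N o a T E K → N :* (N :* ((a :+ a) :- (T :+ T)) :- (E :+ K :+ (E :+ K))) :+ (N :- o)
                :* (K :+ K) :+ (o :- con ℤ.1ℤ) :* (K :+ K) :=
                   N :* N :* (a :+ a) :- ((N :* N :* T :+ N :* E :+ K) :+ (N :* N :* T :+ N :* E :+ K))) R.refl

        -- A grid square meeting nP has its corner in nP + [-2,0]², whose lattice
        -- points are counted by Pick's theorem.
        private
          -- A floor with tolerance η, since the exact one would decide comparisons of reals. The
          -- search climbs from an Archimedean lower bound; at each step cotransitivity between j +
          -- 1 and j + 1 + η says whether to stop.
          locate : ∀ {η} → 0# < η → ∀ s → ∃[ j ] fromℤ j < s × s < fromℤ j + (1# + η)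
          locate {η} 0<η s = search (l ℕ.+ h) (ℤ.- (ℤ.+ l)) low high
            where
            l = proj₁ (archimedean (- s))
            h = proj₁ (archimedean s)
            low : fromℤ (ℤ.- (ℤ.+ l)) < s
            low = <-resp (R.sym (fromℤ-neg (ℤ.+ l))) R.refl (<-by (<⇒0< (proj₂ (archimedean (- s)))) (lem (ℕ⇒ℝ l) s))
              where
              lem : ∀ l s → l - - s ≈ s - - l
              lem = solve 2 (λ l s → l :- :- s := s :- :- l) R.refl
            high : s < fromℤ (ℤ.- (ℤ.+ l) ℤ.+ ℤ.+ (l ℕ.+ h))
            high = <-resp R.refl (R.reflexive (cong fromℤ (lem (ℤ.+ l) (ℤ.+ h)))) (proj₂ (archimedean s))
              where
              lem : ∀ l h → h ≡ ℤ.- l ℤ.+ (l ℤ.+ h)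
              lem = solve-∀
            search : ∀ fuel j → fromℤ j < s → s < fromℤ (j ℤ.+ ℤ.+ fuel) → ∃[ j ] fromℤ j < s × s < fromℤ j + (1# + η)
            search zero j j<s s<j = ⊥-elim
                (<-irrefl R.refl (<-trans j<s (<-resp R.refl (R.reflexive (cong fromℤ (ℤₚ.+-identityʳ j))) s<j)))
            search (suc fuel) j j<s s<j+ with <-cotrans {fromℤ (j ℤ.+ ℤ.1ℤ)} {fromℤ j + (1# + η)} (<-by 0<η step) s
              where
              lem : ∀ η j o → η ≈ (j + (o + η)) - (j + o)
              lem = solve 3 (λ η j o → η := (j :+ (o :+ η)) :- (j :+ o)) R.refl
              step : η ≈ (fromℤ j + (1# + η)) - fromℤ (j ℤ.+ ℤ.1ℤ)
              step = R.trans (lem η (fromℤ j) 1#)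
                  (+-congˡ (-‿cong (R.sym (R.trans (fromℤ-+ j ℤ.1ℤ) (+-congˡ fromℤ-1)))))
            ... | inj₁ j+1<s = search fuel (j ℤ.+ ℤ.1ℤ) j+1<s
                  (<-resp R.refl (R.reflexive (cong fromℤ (lem j (ℤ.+ fuel)))) s<j+)
              where
              lem : ∀ j f → j ℤ.+ (ℤ.1ℤ ℤ.+ f) ≡ j ℤ.+ ℤ.1ℤ ℤ.+ f
              lem = solve-∀
            ... | inj₂ s<j+1+η = j , j<s , s<j+1+η

          sum-const : ∀ k x → sum {k} (λ _ → x) ≈ ℕ⇒ℝ k * x
          sum-const zero    x = R.sym (zeroˡ x)
          sum-const (suc k) x = R.trans (+-cong (R.sym (*-identityˡ x)) (sum-const k x))
              (R.sym (distribʳ x 1# (ℕ⇒ℝ k)))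

          module Thick (n : ℕ) where
            N = ℕ⇒ℝ (suc n)
            recip = inverse (0<suc n)
            e = proj₁ recip
            eN≈1 : e * N ≈ 1#
            eN≈1 = proj₁ (proj₂ recip)
            0<e : 0# < e
            0<e = proj₂ (proj₂ recip)
            counted = thickened-count B₀ n
            k = proj₁ counted
            open Enumeration (proj₁ (proj₂ counted)) public

            -- Slightly more than a grid square, so that the tolerance e = 1/N of `locate` is
            -- absorbed; the total area grows only by the factor (1 + e)².
            side : Carrier
            side = 1# + e

            0≤side : 0# ≤ side
            0≤side = 0≤+ (<⇒≤ 0<1) (<⇒≤ 0<e)

            square-at : Pt → Box
            square-at j = record
              { lower = λ i → e * ι j i ; upper = λ i → e * (ι j i + side)
              ; lower≤upper = λ i → ≤-by (0≤* (<⇒≤ 0<e) 0≤side) (lem e (ι j i) side) }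
              where
              lem : ∀ e j s → e * s ≈ e * (j + s) - e * j
              lem = solve 3 (λ e j s → e :* s := e :* (j :+ s) :- e :* j) R.refl

            squares : Fin (length list) → Box
            squares i = square-at (lookup list i)

            total-squares : totalArea squares ≈ ℕ⇒ℝ k * (e * side * (e * side))
            total-squares = R.trans (sum-cong {length list}
                (λ i → lem e (ι (lookup list i) 0F) (ι (lookup list i) 1F) side))
                (R.trans (sum-const (length list) (e * side * (e * side))) (*-congʳ (R.reflexive (cong ℕ⇒ℝ size))))
              where
              lem : ∀ e i j s → (e * (i + s) - e * i) * (e * (j + s) - e * j) ≈ e * s * (e * s)
              lem = solve 4 (λ e i j s → (e :* (i :+ s) :- e :* i) :* (e :* (j :+ s) :- e :* j) := e :* s :*
                  (e :* s)) R.refl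

            e≤1 : e ≤ 1#
            e≤1 = ≤-by (0≤* (<⇒≤ 0<e) (0≤ℕ n)) (R.trans (lem e 1# (ℕ⇒ℝ n)) (+-cong eN≈1 (-‿cong (*-identityʳ e))))
              where
              lem : ∀ e o n → e * n ≈ e * (o + n) - e * o
              lem = solve 3 (λ e o n → e :* n := e :* (o :+ n) :- e :* o) R.refl

            covers : Covers squares (points P)
            covers x x∈P = i , t , bounds , x≈
              where
              t = proj₁ (spanning L x)
              x≈ = proj₂ (spanning L x)
              located : ∀ i → ∃[ j ] fromℤ j < N * t i × N * t i < fromℤ j + (1# + e)
              located i = locate 0<e (N * t i)
              j : Pt
              j = proj₁ (located 0F) , proj₁ (located 1F)
              -- N t - j lies between 0 and 1 + e ≤ 2, so j is N t plus the vector d - 2 with both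
              -- entries in [-2, 0]. This puts j into the thickened polygon and explains the side
              -- length 2.
              d : Vec 2
              d i = ι j i - N * t i + ℕ⇒ℝ 2
              bounds-d : ∀ i → fromℤ (vec j i) < N * t i → N * t i < fromℤ (vec j i) + (1# + e) → 0# ≤ d i × d i ≤
                  ℕ⇒ℝ 2
              bounds-d i p q =
                ≤-by (0≤+ (<⇒≤ (<⇒0< q)) (≤⇒0≤ e≤1))
                    (R.trans (lem₁ (ι j i) (N * t i) 1# e)
                    (R.trans (+-congˡ (-‿cong (-‿inverseʳ 1#)))
                    (+-congʳ (+-congˡ (+-congˡ (R.sym (+-identityʳ 1#))))))) ,
                ≤-by (<⇒≤ (<⇒0< p)) (lem₂ (ι j i) (N * t i) (ℕ⇒ℝ 2))
                where
                lem₁ : ∀ j s o e → (j + (o + e) - s) + (o - e) ≈ (j - s + (o + o)) - (o - o)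
                lem₁ = solve 4 (λ j s o e → (j :+ (o :+ e) :- s) :+ (o :- e) := (j :- s :+ (o :+ o)) :- (o :- o))
                    R.refl
                lem₂ : ∀ j s t → s - j ≈ t - (j - s + t)
                lem₂ = solve 3 (λ j s t → s :- j := t :- (j :- s :+ t)) R.refl
              in-square : ∀ i → 0# ≤ d i × d i ≤ ℕ⇒ℝ 2
              in-square = each (bounds-d 0F (proj₁ (proj₂ (located 0F))) (proj₂ (proj₂ (located 0F))))
                    (bounds-d 1F (proj₁ (proj₂ (located 1F))) (proj₂ (proj₂ (located 1F))))
              term≤ : ∀ {x} → 0# ≤ x × x ≤ ℕ⇒ℝ 2 → ∀ b c → c ≡ ℤ.+ 2 ℤ.* b → x * fromℤ b ≤ fromℤ (pos c)
              term≤ {x} (0≤x , x≤2) b c refl with ℤₚ.≤-total ℤ.0ℤ b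
              ... | inj₁ 0≤b = ≤-trans (≤-by (0≤* (≤⇒0≤ x≤2) (fromℤ-0≤ 0≤b))
                    (R.trans (lem (ℕ⇒ℝ 2) x (fromℤ b)) (+-congʳ (R.sym (fromℤ-* (ℤ.+ 2) b))))) (fromℤ-≤ (≤pos c))
                where
                lem : ∀ t x b → (t - x) * b ≈ t * b - x * b
                lem = solve 3 (λ t x b → (t :- x) :* b := t :* b :- x :* b) R.refl
              ... | inj₂ b≤0 = ≤-trans (≤-by (0≤* 0≤x (fromℤ-0≤ (Plane.0≤-neg b≤0)))
                    (R.trans (*-congˡ (fromℤ-neg b)) (lem x (fromℤ b)))) (fromℤ-≤ (0≤pos c))
                where
                lem : ∀ x b → x * - b ≈ 0# - x * b
                lem = solve 2 (λ x b → x :* :- b := con ℤ.0ℤ :- x :* b) R.refl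
              dominated : Dominated (thickened B₀ n) j
              dominated u@(a′ , b′) = fromℤ-cancel-≤ (≤-resp left right
                  (+-mono-≤ (conv⇒≤support {v = v} {generators P} {S} (generator≈ P) (independent L) {t = t} x∈P x≈
                      u′)
                    (+-mono-≤ (≤-refl {fromℤ base})
                        (+-mono-≤ (term≤ (in-square 0F) a′ _ (lem₁ a′ b′))
                        (term≤ (in-square 1F) b′ _ (lem₂ a′ b′))))))
                where
                u′ = Support.Triangular.transpose (dilation n) u
                base = dot (ℤ.- (ℤ.+ 2) , ℤ.- (ℤ.+ 2)) u
                c₁ = dot (ℤ.+ 2 , ℤ.0ℤ) u
                c₂ = dot (ℤ.0ℤ , ℤ.+ 2) u
                lem₁ : ∀ a b → ℤ.+ 2 ℤ.* a ℤ.+ ℤ.0ℤ ℤ.* b ≡ ℤ.+ 2 ℤ.* a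
                lem₁ = solve-∀
                lem₂ : ∀ a b → ℤ.0ℤ ℤ.* a ℤ.+ ℤ.+ 2 ℤ.* b ≡ ℤ.+ 2 ℤ.* b
                lem₂ = solve-∀
                right : fromℤ (support S u′) + (fromℤ base + (fromℤ (pos c₁) + fromℤ (pos c₂))) ≈ fromℤ
                    (thickened B₀ n u)
                right = R.sym (R.trans (fromℤ-+ (support S u′) (square u)) (+-congˡ (R.trans (fromℤ-+ base _) (+-congˡ
                  (R.trans (fromℤ-+ (pos c₁) _) (+-congˡ (R.reflexive (cong fromℤ (ℤₚ.+-identityʳ (pos c₂))))))))))
                lem₃ : ∀ t₀ t₁ N j₀ j₁ a b →
                  (t₀ * (N * a + 0# * b) + t₁ * (N * b)) +
                      ((- ℕ⇒ℝ 2 * a + - ℕ⇒ℝ 2 * b) + ((j₀ - N * t₀ + ℕ⇒ℝ 2) * a + (j₁ - N * t₁ + ℕ⇒ℝ 2) * b)) ≈ j₀ *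
                      a + j₁ * b
                lem₃ = solve 7 (λ t₀ t₁ N j₀ j₁ a b →
                  (t₀ :* (N :* a :+ con ℤ.0ℤ :* b) :+ t₁ :* (N :* b)) :+
                      ((:- con (ℤ.+ 2) :* a :+ :- con (ℤ.+ 2) :* b) :+
                      ((j₀ :- N :* t₀ :+ con (ℤ.+ 2)) :* a :+ (j₁ :- N :* t₁ :+ con (ℤ.+ 2)) :* b)) := j₀ :* a :+ j₁
                      :* b) R.refl
                two-term : ∀ p q r s → fromℤ (p ℤ.* r ℤ.+ q ℤ.* s) ≈ fromℤ p * fromℤ r + fromℤ q * fromℤ s
                two-term p q r s = R.trans (fromℤ-+ (p ℤ.* r) (q ℤ.* s)) (+-cong (fromℤ-* p r) (fromℤ-* q s))
                left : dotᴿ t u′ + (fromℤ base + (d 0F * fromℤ a′ + d 1F * fromℤ b′)) ≈ fromℤ (dot j u)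
                left = R.trans (+-cong (+-cong (*-congˡ (two-term (ℤ.+ suc n) ℤ.0ℤ a′ b′))
                    (*-congˡ (fromℤ-* (ℤ.+ suc n) b′)))
                                       (+-congʳ (two-term (ℤ.- (ℤ.+ 2)) (ℤ.- (ℤ.+ 2)) a′ b′)))
                  (R.trans (lem₃ (t 0F) (t 1F) N (ι j 0F) (ι j 1F) (fromℤ a′) (fromℤ b′))
                      (R.sym (two-term (proj₁ j) (proj₂ j) a′ b′)))
              i = Any.index (complete {j} dominated)
              box-j : lookup list i ≡ j
              box-j = ≡.sym (Anyₚ.lookup-index (complete {j} dominated))
              unscale : ∀ i → t i ≈ e * (N * t i)
              unscale i = R.sym (R.trans (R.sym (*-assoc e N (t i))) (R.trans (*-congʳ eN≈1) (*-identityˡ (t i))))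
              scale-≤ : ∀ {x y} → x ≤ y → e * x ≤ e * y
              scale-≤ = Scaled.*-mono e (<⇒≤ 0<e)
              bounds-at : ∀ i → fromℤ (vec j i) < N * t i → N * t i < fromℤ (vec j i) + (1# + e) → e * ι j i ≤ t i ×
                  t i ≤ e * (ι j i + side)
              bounds-at i p q = ≤-resp R.refl (R.sym (unscale i)) (scale-≤ (<⇒≤ p)) , ≤-resp (R.sym (unscale i))
                  R.refl (scale-≤ (<⇒≤ q))
              bounds : ∀ l → lower (squares i) l ≤ t l × t l ≤ upper (squares i) l
              bounds l = subst (λ w → e * ι w l ≤ t l × t l ≤ e * (ι w l + side)) (≡.sym box-j)
                (each {P = λ l → e * ι j l ≤ t l × t l ≤ e * (ι j l + side)}
                  (bounds-at 0F (proj₁ (proj₂ (located 0F))) (proj₂ (proj₂ (located 0F))))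
                      (bounds-at 1F (proj₁ (proj₂ (located 1F))) (proj₂ (proj₂ (located 1F)))) l)

        area-upper : ∀ ε → 0# < ε → ∃[ k ] Σ[ B ∈ (Fin k → Box) ] Covers B (points P) × totalArea B < a + ε
        area-upper ε 0<ε = length list , squares , covers , double-cancel (<-by positive identity)
          where
          one = fromℤ ℤ.1ℤ
          C = linear-term B₀
          D = constant-term B₀
          Cᴿ = ℕ⇒ℝ C
          Dᴿ = ℕ⇒ℝ D
          -- With A = a + a this is 3A + 4C + 4D, the coefficient of `e` in the estimate behind
          -- `slack`; `n` is chosen so that e K < ε.
          K = (a + a) + (a + a) + (a + a) + ℕ⇒ℝ 4 * (Cᴿ + Dᴿ)
          ε⁻¹ = inverse 0<ε
          bound = archimedean (K * proj₁ ε⁻¹)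
          n = proj₁ bound
          open Thick n
          0≤A : 0# ≤ a + a
          0≤A = ≤-resp R.refl (R.sym a+a≈A) (0≤ℕ A)
          K<Nε : K < N * ε
          K<Nε = <-by (*-pos (<⇒0< (<-≤-trans (proj₂ bound) (ℕ⇒ℝ-≤ (ℕₚ.n≤1+n n)))) 0<ε)
            (R.trans (lem N K (proj₁ ε⁻¹) ε)
                (+-congˡ (-‿cong (R.trans (*-congˡ (proj₁ (proj₂ ε⁻¹))) (*-identityʳ K)))))
            where
            lem : ∀ N x i d → (N - x * i) * d ≈ N * d - x * (i * d)
            lem = solve 4 (λ N x i d → (N :- x :* i) :* d := N :* d :- x :* (i :* d)) R.refl
          count≈ : ℕ⇒ℝ k + ℕ⇒ℝ k ≈ N * N * (a + a) + N * Cᴿ + Dᴿ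
          count≈ = R.trans (R.sym (ℕ⇒ℝ-+ k k))
              (R.trans (R.reflexive (cong ℕ⇒ℝ
              (≡.trans (cong (k ℕ.+_) (≡.sym (ℕₚ.+-identityʳ k))) (proj₂ (proj₂ counted)))))
            (R.trans (ℕ⇒ℝ-+ (suc n ℕ.* suc n ℕ.* A ℕ.+ suc n ℕ.* C) D)
                (+-congʳ (R.trans (ℕ⇒ℝ-+ (suc n ℕ.* suc n ℕ.* A) (suc n ℕ.* C))
              (+-cong (R.trans (ℕ⇒ℝ-* (suc n ℕ.* suc n) A) (*-cong (ℕ⇒ℝ-* (suc n) (suc n)) (R.sym a+a≈A)))
                  (ℕ⇒ℝ-* (suc n) C))))))
          -- (A + Ce + De²)(1 + e)² ≤ A + (3A + 4C + 4D)e for 0 ≤ e ≤ 1.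
          slack : Carrier
          slack = (a + a) * (e * (one - e)) + Cᴿ * (e * (one - e) * (one + one + one + e)) + Dᴿ *
              (e * (one - e) * (one + one + one + one + (one + one + one) * e + e * e))
          0≤slack : 0# ≤ slack
          0≤slack = 0≤+ (0≤+ (0≤* 0≤A f) (0≤* (0≤ℕ C) (0≤* f (0≤+ (0≤+ (0≤+ o o) o) p))))
              (0≤* (0≤ℕ D) (0≤* f (0≤+ (0≤+ (0≤+ (0≤+ (0≤+ o o) o) o) (0≤* (0≤+ (0≤+ o o) o) p)) (0≤* p p))))
            where
            o = 0≤ℕ 1
            p = <⇒≤ 0<e
            f = 0≤* p (≤⇒0≤ (≤-resp R.refl (R.sym fromℤ-1) e≤1))
          positive : 0# < (e * (N * ε - K) + ε) + slack
          positive = 0<+ (0<+ (*-pos 0<e (<⇒0< K<Nε)) (<⇒≤ 0<ε)) 0≤slack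
          -- The relation e N = 1 is not part of the ring identities, so `w` is replaced by `one`
          -- before the main identity and restored after it.
          w = e * N
          w≈one : w ≈ one
          w≈one = R.trans eN≈1 (R.sym fromℤ-1)
          total≈ : totalArea squares + totalArea squares ≈ (N * N * (a + a) + N * Cᴿ + Dᴿ) * (e * side * (e * side))
          total≈ = R.trans (+-cong total-squares total-squares)
              (R.trans (R.sym (distribʳ _ (ℕ⇒ℝ k) (ℕ⇒ℝ k))) (*-congʳ count≈))
          identity : (e * (N * ε - K) + ε) + slack ≈ (a + ε + (a + ε)) - (totalArea squares + totalArea squares)
          identity = begin
            (e * (N * ε - K) + ε) + slack
              ≈⟨ +-congʳ (lem₁ e N ε K) ⟩
            (w * ε - e * K + ε) + slack
              ≈⟨ +-congʳ (+-congʳ (+-congʳ (*-congʳ w≈one))) ⟩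
            (one * ε - e * K + ε) + slack
              ≈⟨ lem₂ a ε e Cᴿ Dᴿ ⟩
            (a + ε + (a + ε)) - ((a + a) * (one * one) + Cᴿ * (e * one) + Dᴿ * (e * e)) * ((one + e) * (one + e))
              ≈⟨ +-congˡ (-‿cong (*-cong (+-congʳ
                  (+-cong (*-congˡ (*-cong (R.sym w≈one) (R.sym w≈one))) (*-congˡ (*-congˡ (R.sym w≈one)))))
                  (*-cong (+-congʳ fromℤ-1) (+-congʳ fromℤ-1)))) ⟩
            (a + ε + (a + ε)) - ((a + a) * (w * w) + Cᴿ * (e * w) + Dᴿ * (e * e)) * (side * side)
              ≈⟨ +-congˡ (-‿cong (lem₃ (a + a) e N Cᴿ Dᴿ side)) ⟩
            (a + ε + (a + ε)) - (N * N * (a + a) + N * Cᴿ + Dᴿ) * (e * side * (e * side))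
              ≈⟨ +-congˡ (-‿cong total≈) ⟨
            (a + ε + (a + ε)) - (totalArea squares + totalArea squares) ∎
            where
            open import Relation.Binary.Reasoning.Setoid R.setoid
            lem₁ : ∀ e N ε K → e * (N * ε - K) + ε ≈ e * N * ε - e * K + ε
            lem₁ = solve 4 (λ e N ε K → e :* (N :* ε :- K) :+ ε := e :* N :* ε :- e :* K :+ ε) R.refl
            lem₂ : ∀ a ε e C D →
              (one * ε - e * ((a + a) + (a + a) + (a + a) + ℕ⇒ℝ 4 * (C + D)) + ε) +
                ((a + a) * (e * (one - e)) + C * (e * (one - e) * (one + one + one + e)) + D *
                    (e * (one - e) * (one + one + one + one + (one + one + one) * e + e * e))) ≈
              (a + ε + (a + ε)) - ((a + a) * (one * one) + C * (e * one) + D * (e * e)) * ((one + e) * (one + e))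
            lem₂ = solve 5 (λ a ε e C D →
              let o = con ℤ.1ℤ in
              (o :* ε :- e :* ((a :+ a) :+ (a :+ a) :+ (a :+ a) :+ con (ℤ.+ 4) :* (C :+ D)) :+ ε) :+
                ((a :+ a) :* (e :* (o :- e)) :+ C :* (e :* (o :- e) :* (o :+ o :+ o :+ e)) :+ D :*
                    (e :* (o :- e) :* (o :+ o :+ o :+ o :+ (o :+ o :+ o) :* e :+ e :* e))) :=
              (a :+ ε :+ (a :+ ε)) :- ((a :+ a) :* (o :* o) :+ C :* (e :* o) :+ D :* (e :* e)) :*
                  ((o :+ e) :* (o :+ e))) R.refl
            lem₃ : ∀ A e N C D s → (A * (e * N * (e * N)) + C * (e * (e * N)) + D * (e * e)) * (s * s) ≈
                (N * N * A + N * C + D) * (e * s * (e * s))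
            lem₃ = solve 6 (λ A e N C D s → (A :* (e :* N :* (e :* N)) :+ C :* (e :* (e :* N)) :+ D :* (e :* e)) :*
                (s :* s) := (N :* N :* A :+ N :* C :+ D) :* (e :* s :* (e :* s))) R.refl

        isArea : IsArea (points P) a
        isArea = area-lower , area-upper

  -- If b < a, a cover with excess less than a - b would have total area below a. This gives
  -- uniqueness of the area.
  IsArea-≤ : ∀ {L : Lattice 2} {ℓ} {S : Carrierᴹ → Set ℓ} {a b} → Measure.IsArea L S a → Measure.IsArea L S b → a ≤ b
  IsArea-≤ {L} {S = S} {a} {b} (a-lower , _) (_ , b-upper) b<a with b-upper (a - b) (<⇒0< b<a)
  ... | k , B , covers , total<a = a-lower B covers (<-resp R.refl (lem a b) total<a)
    where
    lem : ∀ a b → b + (a - b) ≈ a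
    lem = solve 2 (λ a b → b :+ (a :- b) := a) R.refl

  polygon-area : ∀ {L : Lattice 2} → Polytope L → ℕ
  polygon-area P = doubled-area (boundary (family P))

  equal-areas : ∀ {L : Lattice 2} (P Q : Polytope L) → polygon-area P ≡ polygon-area Q → EqualAreas L (points P)
      (points Q)
  equal-areas {L} P Q e = proj₁ h , isArea L P (proj₂ h) , isArea L Q (R.trans (proj₂ h) (R.reflexive (cong ℕ⇒ℝ e)))
    where h = half (ℕ⇒ℝ (polygon-area P))

  equal-areas⁻¹ : ∀ {L : Lattice 2} (P Q : Polytope L) → EqualAreas L (points P) (points Q) → polygon-area P ≡
      polygon-area Q
  equal-areas⁻¹ {L} P Q (a , P-area , Q-area) = ℤₚ.+-injective
      (fromℤ-injective (R.trans (R.sym (double P P-area)) (double Q Q-area)))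
    where
    double : ∀ (P : Polytope L) → Measure.IsArea L (points P) a → a + a ≈ ℕ⇒ℝ (polygon-area P)
    double P P-area = R.trans (+-cong a≈h a≈h) (proj₂ h)
      where
      h = half (ℕ⇒ℝ (polygon-area P))
      exact = isArea L P (proj₂ h)
      a≈h : a ≈ proj₁ h
      a≈h = ≤-antisym (IsArea-≤ P-area exact) (IsArea-≤ exact P-area)

-- The two implications.

module Characterisation
  {c ℓ₁ ℓ₂ m ℓm : Level}
  (ℝ : RealField c ℓ₁ ℓ₂)
  (V : Module (RealField.commutativeRing ℝ) m ℓm)
  where
  open Geometry ℝ V
  open Module V using (≈ᴹ-refl)
  open Plane using (Pt; dot)
  open Support
  open Matrices using (Matrix; pick-matrix)
  open Matrix using (determinant; mul)
  open Decomposition using (primitive-boundary; PrimitiveBoundary; perimeter-++)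
  open Summands
  open Pick using (perimeter)
  open ConvexCombinations ℝ V
  open Lattices ℝ V
  open MinkowskiSums ℝ V
  open Areas ℝ V
  open Lattice using (vectors)
  open Polytope using (points)

  module _ {L : Lattice 2} where

    SameCardinalities : Polytope L → Polytope L → Lattice 2 → Set _
    SameCardinalities P Q L′ = ∃[ k ] CountingFunction P L′ k × CountingFunction Q L′ k

    same-counts : ∀ (P Q : Polytope L) → (∀ M det≢0 → SameCardinalities P Q (refinement L M det≢0)) →
                  (B : Boundary (support (family P))) (C : Boundary (support (family Q))) → SameCounts B C
    same-counts P Q same B C M det≢0 =
      let ref = refinement-refines L M det≢0
          k , P-count , Q-count = same M det≢0
          i , P-points , P-formula = pick-matrix B M det≢0
          j , Q-points , Q-formula = pick-matrix C M det≢0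
          i≡j = ≡.trans (cardinality-unique (enumeration⇒cardinality ref P P-points) P-count)
                        (cardinality-unique Q-count (enumeration⇒cardinality ref Q Q-points))
      in ℕₚ.+-cancelʳ-≡ 2 _ _ (≡.trans (≡.sym P-formula) (≡.trans (cong (2 ℕ.*_) i≡j) Q-formula))

    -- Any two edge descriptions of one support function yield the same counts in every finer
    -- lattice, and the counts determine the area.
    area-unique : ∀ (P : Polytope L) (B : Boundary (support (family P))) → doubled-area B ≡ polygon-area P
    area-unique P B = same-area B (boundary (family P)) (same-counts P P counts B (boundary (family P)))
      where
      counts : ∀ M det≢0 → SameCardinalities P P (refinement L M det≢0)
      counts M det≢0 = let k , P-points , _ = pick-matrix B M det≢0
                           count = enumeration⇒cardinality (refinement-refines L M det≢0) P P-points
                       in k , count , count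

    polytope-of : ∀ {n} → (Fin (suc n) → Pt) → Polytope L
    polytope-of S = record { generators = λ i → φ (vectors L) (S i) ; inLattice = λ i → vec (S i) , ≈ᴹ-refl }

    IsDecomposition : Polytope L → Polytope L → Set _
    IsDecomposition P Q = Σ[ X ∈ Polytope L ] Σ[ Y ∈ Polytope L ]
        IsLatticeTranslate L (points P) (points X ⊕ points Y)
      × IsLatticeTranslate L (points Q) (points X ⊖ points Y)

    module _ (P Q : Polytope L) where

      summand⇒decomposition : Summand (support (family P)) (support (family Q)) → IsDecomposition P Q
      summand⇒decomposition D = polytope-of X , polytope-of Y ,
          support⇒translate P (polytope-of X) (polytope-of Y) v sum ,
          translate-resp {L = L} (sum⇒difference (polytope-of X) (polytope-of Y))
              (difference⇒sum (polytope-of X) (polytope-of Y))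
            (support⇒translate Q (polytope-of X) (reflect (polytope-of Y)) w λ u →
              ≡.trans (difference u) (cong (λ h → dot w u ℤ.+ (support X u ℤ.+ h)) (≡.sym (support-⊟ Y u))))
        where open Summand D

      counts⇒decomposition : EqualCountingFunctions P Q → EqualAreas L (points P) (points Q) × IsDecomposition P Q
      counts⇒decomposition equal =
          equal-areas P Q (same-area (boundary (family P)) (boundary (family Q))
              (same (boundary (family P)) (boundary (family Q)))) ,
          summand⇒decomposition (decompose PB QB
              (same (PrimitiveBoundary.boundary′ PB) (PrimitiveBoundary.boundary′ QB)))
        where
        same = same-counts P Q λ M det≢0 → equal (refinement L M det≢0)
            (refines⇒inclusion (refinement-refines L M det≢0))
        PB = primitive-boundary (boundary (family P))
        QB = primitive-boundary (boundary (family Q))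

      decomposition⇒counts : EqualAreas L (points P) (points Q) × IsDecomposition P Q → EqualCountingFunctions P Q
      decomposition⇒counts (areas , X , Y , P-sum , Q-difference) L′ L⊆L′ = i ,
          enumeration⇒cardinality ref P (proj₁ (proj₂ P-count)) ,
          subst (CountingFunction Q L′) (≡.sym i≡j) (enumeration⇒cardinality ref Q (proj₁ (proj₂ Q-count)))
        where
        refined = inclusion⇒refines L L′ L⊆L′
        M = proj₁ refined
        ref = proj₂ refined
        BX = boundary (family X)
        BY = boundary (family Y)
        P-support = translate⇒support P X Y P-sum
        Q-support = translate⇒support Q X (reflect Y)
            (translate-resp {L = L} (difference⇒sum X Y) (sum⇒difference X Y) Q-difference)
        -- `P` is described by the edges of X and Y instead of those of its own hull, so that its
        -- boundary length can be compared with that of `Q` list by list; `area-unique` ties this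
        -- description to the area of `P`.
        BP : Boundary (support (family P))
        BP = boundary-resp (λ u → ≡.sym (proj₂ P-support u)) (boundary-shift (proj₁ P-support) (boundary-+ BX BY))
        BQ : Boundary (support (family Q))
        BQ = boundary-resp (λ u → ≡.trans
            (cong (λ h → dot (proj₁ Q-support) u ℤ.+ (support (family X) u ℤ.+ h)) (≡.sym (support-⊟ (family Y) u)))
            (≡.sym (proj₂ Q-support u)))
          (boundary-shift (proj₁ Q-support) (boundary-+ BX (boundary-⊟ BY)))
        P-count = pick-matrix BP M (Refines.nonsingular ref)
        Q-count = pick-matrix BQ M (Refines.nonsingular ref)
        i = proj₁ P-count
        j = proj₁ Q-count
        same-areas : doubled-area BP ≡ doubled-area BQ
        same-areas = ≡.trans (area-unique P BP) (≡.trans (equal-areas⁻¹ P Q areas) (≡.sym (area-unique Q BQ)))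
        same-lengths : boundary-length BP M ≡ boundary-length BQ M
        same-lengths = ≡.trans (cong₂ ℕ._+_ (split BX.up BY.up) (split BX.lo BY.lo))
            (≡.trans (lem (length-of BX.up) (length-of BY.up) (length-of BX.lo) (length-of BY.lo))
              (≡.sym (cong₂ ℕ._+_ (split BX.up BY.lo) (split BX.lo BY.up))))
          where
          open import Data.Nat.Tactic.RingSolver renaming (solve-∀ to solveℕ-∀)
          module BX = Boundary BX
          module BY = Boundary BY
          length-of : List Pt → ℕ
          length-of F = perimeter (map (mul M) F)
          split : ∀ F G → length-of (F ++ G) ≡ length-of F ℕ.+ length-of G
          split F G = ≡.trans (cong perimeter (Listₚ.map-++ (mul M) F G))
              (perimeter-++ (map (mul M) F) (map (mul M) G))
          lem : ∀ a b c d → a ℕ.+ b ℕ.+ (c ℕ.+ d) ≡ a ℕ.+ d ℕ.+ (c ℕ.+ b)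
          lem = solveℕ-∀
        i≡j : i ≡ j
        i≡j = ℕₚ.*-cancelˡ-≡ i j 2 (≡.trans (proj₂ (proj₂ P-count)) (≡.trans
          (cong₂ (λ a l → ℤ.∣ determinant M ∣ ℕ.* a ℕ.+ l ℕ.+ 2) same-areas same-lengths)
              (≡.sym (proj₂ (proj₂ Q-count)))))

theorem3 : ∀ {c ℓ₁ ℓ₂ m ℓm : Level}
    (ℝ : RealField c ℓ₁ ℓ₂) (V : Module (RealField.commutativeRing ℝ) m ℓm) →
    let open Geometry ℝ V
        open Polytope using (points)
        open Polygon using (polytope)
    in
    Basis 2 → (L : Lattice 2) (P Q : Polygon L) →
    EqualCountingFunctions (polytope P) (polytope Q)
    ⇔
    ( EqualAreas L (points (polytope P)) (points (polytope Q))
    × (Σ[ X ∈ Polytope L ] Σ[ Y ∈ Polytope L ]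
    IsLatticeTranslate L (points (polytope P)) (points X ⊕ points Y)
    × IsLatticeTranslate L (points (polytope Q)) (points X ⊖ points Y)) )
theorem3 ℝ V _ L P Q = mk⇔ (counts⇒decomposition (polytope P) (polytope Q))
    (decomposition⇒counts (polytope P) (polytope Q))
  where
  open Characterisation ℝ V
  open Geometry ℝ V
  open Polygon using (polytope)
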